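{- Let $H^*_{\mathbb{Q}(i),3}$ be the greedy set of nonzero Gaussian integers avoiding $3$-term geometric progressions with ratios in $\mathbb{Z}\setminus\{0,\pm1\}$, and let $f(x)=\left(1-\frac{1}{x}\right)\prod_{i=0}^{\infty}\left(1+\frac{1}{x^{3^i}}\right)$. Then the density of $H^*_{\mathbb{Q}(i),3}$ equals $\prod_p f(p^2)$ (product over all rational primes $p$), which is approximately $0.939735$.
   Context: A $3$-term geometric progression with ratio in $\mathbb{Z}\setminus\{0,\pm 1\}$ in $\mathbb{Z}[i]$ is a set $\{n,nr,nr^2\}$ with $n\in\mathbb{Z}[i]$ nonzero and $r\in\mathbb{Z}$, $|r|\ge 2$. The greedy set is built by going through the nonzero Gaussian integers in order of nondecreasing norm $N(a+bi)=a^2+b^2$ (ties in arbitrary order), including an element if and only if it does not form such a progression with two elements already included. The density of $A\subseteq\mathbb{Z}[i]$ is $\lim_{n\to\infty}|A\cap I_n|/|I_n|$ with $I_n=\{m\in\mathbb{Z}[i]:N(m)\le n\}$. -}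

module Defs where

open import Data.Bool using (Bool; true; false; not; _∧_)
open import Data.Nat as ℕ using (ℕ; zero; suc; _≤ᵇ_)
open import Data.Nat.Primality using (prime?)
open import Data.Integer as ℤ using (ℤ; +_; -[1+_]; ∣_∣)
open import Data.Product using (_×_; _,_; ∃; ∃₂)
open import Data.Sum using (_⊎_)
open import Data.List using (List; []; _∷_; map; upTo; _++_; concatMap; foldr)
open import Data.Rational as ℚ using (ℚ; 0ℚ; 1ℚ)
open import Relation.Nullary using (¬_; does)
open import Relation.Binary.PropositionalEquality using (_≡_)
open import Function.Bundles using (_⇔_)

-- Gaussian integers a + b i as pairs (a , b)
GI : Set
GI = ℤ × ℤ

zeroGI : GI
zeroGI = (+ 0 , + 0)

N : GI → ℕ
N (a , b) = ∣ a ∣ ℕ.* ∣ a ∣ ℕ.+ ∣ b ∣ ℕ.* ∣ b ∣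

_·_ : GI → ℤ → GI
(a , b) · r = (a ℤ.* r , b ℤ.* r)

In3 : GI → GI → GI → GI → Set
In3 u a b c = u ≡ a ⊎ u ≡ b ⊎ u ≡ c

-- {x, y, z} is (as a set) a 3-term geometric progression {n, nr, nr²}
-- with n ≠ 0 in ℤ[i] and r ∈ ℤ, |r| ≥ 2
IsGP3 : GI → GI → GI → Set
IsGP3 x y z = ∃₂ λ (n : GI) (r : ℤ) →
  ¬ (n ≡ zeroGI) × 2 ℕ.≤ ∣ r ∣ ×
  ((In3 x n (n · r) ((n · r) · r) × In3 y n (n · r) ((n · r) · r) × In3 z n (n · r) ((n · r) · r)) ×
   (In3 n x y z × In3 (n · r) x y z × In3 ((n · r) · r) x y z))

record NormOrder (e : ℕ → GI) : Set where
  field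
    nonzero   : ∀ k → ¬ (e k ≡ zeroGI)
    injective : ∀ i j → e i ≡ e j → i ≡ j
    onto      : ∀ m → ¬ (m ≡ zeroGI) → ∃ λ k → e k ≡ m
    monotone  : ∀ i j → i ℕ.≤ j → N (e i) ℕ.≤ N (e j)

record IsGreedy (e : ℕ → GI) (A : GI → Bool) : Set where
  field
    zeroOut : A zeroGI ≡ false
    step    : ∀ k → (A (e k) ≡ true) ⇔ (
                ¬ (∃₂ λ i j → i ℕ.< k × j ℕ.< k × A (e i) ≡ true × A (e j) ≡ true
                              × IsGP3 (e i) (e j) (e k)))

countB : {X : Set} → (X → Bool) → List X → ℕ
countB p = foldr (λ x c → if p x then suc c else c) 0
  where
  if_then_else_ : {Y : Set} → Bool → Y → Y → Y
  if true then a else _ = a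
  if false then _ else b = b

box : ℕ → List ℤ
box n = map +_ (upTo (suc n)) ++ map -[1+_] (upTo n)

-- all Gaussian integers a+bi with |a|,|b| ≤ n (this contains I_n)
square : ℕ → List GI
square n = concatMap (λ a → map (λ b → (a , b)) (box n)) (box n)

isZeroB : GI → Bool
isZeroB (a , b) = does (a ℤ.≟ + 0) ∧ does (b ℤ.≟ + 0)

-- number of nonzero m with N(m) ≤ n ; so |I_n| = suc (countNZ n)
countNZ : ℕ → ℕ
countNZ n = countB (λ m → not (isZeroB m) ∧ (N m ≤ᵇ n)) (square n)

countA : (GI → Bool) → ℕ → ℕ
countA A n = countB (λ m → not (isZeroB m) ∧ (N m ≤ᵇ n) ∧ A m) (square n)

ratio : (GI → Bool) → ℕ → ℚ
ratio A n = + (countA A n) ℚ./ suc (countNZ n)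

-- 1/x as a rational (x ≥ 1 in all uses; 1/0 is set to 0 by convention)
inv : ℕ → ℚ
inv zero = 0ℚ
inv (suc k) = + 1 ℚ./ suc k

prodℚ : List ℚ → ℚ
prodℚ = foldr ℚ._*_ 1ℚ

fTrunc : ℕ → ℕ → ℚ
fTrunc M x = (1ℚ ℚ.- inv x) ℚ.* prodℚ (map (λ i → 1ℚ ℚ.+ inv (x ℕ.^ (3 ℕ.^ i))) (upTo M))

primesUpTo : ℕ → List ℕ
primesUpTo M = go (upTo (suc M))
  where
  go : List ℕ → List ℕ
  go [] = []
  go (p ∷ ps) with does (prime? p)
  ... | true = p ∷ go ps
  ... | false = go ps

-- P_M = ∏_{p prime, p ≤ M} fTrunc M (p²);  P_M → ∏_p f(p²) as M → ∞
P : ℕ → ℚ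
P M = prodℚ (map (λ p → fTrunc M (p ℕ.* p)) (primesUpTo M))

approx : ℚ
approx = + 939735 ℚ./ 1000000

{-# OPTIONS --safe #-}

-- Write content m for the gcd of the coordinates of m.  By induction along the enumeration, m is in the
-- greedy set iff every prime exponent of content m has only the ternary digits 0 and 1: such exponents
-- contain no 3-term progression, and any v is the last term of a progression u, u + f, v of which u and
-- u + f are such exponents.
--
-- For a fixed D the indicator of this condition at the primes p ≤ D, with exponents below 3^D, is a finite
-- combination of the functions [k ∣ content m], with Dirichlet polynomial
-- ∏_{p ≤ D} (1 - p^(-s)) ∏_{i<D} (1 + p^(-s 3^i)).  Among the m with N m ≤ n the condition k ∣ content m
-- has density 1/k² up to O(√n) points, since k divides one in k points of each row and column; π is
-- never needed.  So the indicator has density P D.  It differs from the greedy set only where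
-- content m > D, a set of upper density at most 9/D.  That the P D form a Cauchy sequence
-- follows by comparing both P D and P M with the same ratio A n.
--
-- For the numerical value, the factors of the primes up to 120 are enclosed between explicit fractions
-- and the remaining ones lie between 1 - p⁻⁴ and 1.
module Submission where

-- The order of choices shapes the proof. The expansion for a given D has many terms, each with its
-- own error, and their number grows with D; so D is fixed before n grows. What lies beyond D then
-- needs a bound valid for all n and all divisors at once, which those error terms cannot give.
-- Hence the separate, cruder estimate `C-upper`.
--
-- One parameter D can bound primes, digits and contents together: a positive g ≤ D has only prime
-- factors up to D and exponents below 3^D, so the truncated condition is exact on such g.
--
-- The shape of f: p^v divides m iff it divides both coordinates, so with x = p² the exponent of p
-- in the content is exactly v with density (1 - 1/x) x^(-v). A number with ternary digits 0 and 1
-- is a sum of distinct powers of 3 in exactly one way, so summing x^(-v) over such v gives the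
-- product of the 1 + x^(-3^i).

open import Defs

-- Arithmetic of rationals and of fractions of natural numbers.

module Rationals where

  open import Data.Nat as ℕ using (ℕ; zero; suc; NonZero)
  import Data.Nat.Properties as ℕP
  open import Data.Integer as ℤ using (+_)
  import Data.Integer.Properties as ℤP
  open import Data.Rational hiding (NonZero)
  open import Data.Rational.Properties
  import Data.Rational.Unnormalised as U
  import Data.Rational.Unnormalised.Properties as UP
  open import Data.Rational.Solver using (module +-*-Solver)
  open +-*-Solver using (solve; _:=_; _:+_; _:*_; _:-_; :-_; con)
  open import Data.Sum using (inj₁; inj₂)
  open import Relation.Binary.PropositionalEquality

  ι : ℕ → ℚ
  ι n = + n / 1

  -- Fractions in `ℚ` are normalised by a gcd that does not compute on variables; in unnormalised
  -- form the identities for `ι` and `inv` reduce to cross-multiplication.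
  toℚᵘ-/ : ∀ a b → toℚᵘ (+ a / suc b) U.≃ U.mkℚᵘ (+ a) b
  toℚᵘ-/ a b = toℚᵘ-fromℚᵘ (U.mkℚᵘ (+ a) b)

  ι-+ : ∀ m n → ι (m ℕ.+ n) ≡ ι m + ι n
  ι-+ m n = toℚᵘ-injective (UP.≃-trans (toℚᵘ-/ (m ℕ.+ n) 0)
    (UP.≃-sym (UP.≃-trans (toℚᵘ-homo-+ (ι m) (ι n))
      (UP.≃-trans (UP.+-cong (toℚᵘ-/ m 0) (toℚᵘ-/ n 0))
        (U.*≡* (cong (ℤ._* + 1) (cong₂ ℤ._+_ (ℤP.*-identityʳ (+ m)) (ℤP.*-identityʳ (+ n)))))))))

  ι-* : ∀ m n → ι (m ℕ.* n) ≡ ι m * ι n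
  ι-* m n = toℚᵘ-injective (UP.≃-trans (toℚᵘ-/ (m ℕ.* n) 0)
    (UP.≃-sym (UP.≃-trans (toℚᵘ-homo-* (ι m) (ι n))
      (UP.≃-trans (UP.*-cong (toℚᵘ-/ m 0) (toℚᵘ-/ n 0))
        (U.*≡* (cong (ℤ._* + 1) (sym (ℤP.pos-* m n))))))))

  ι-mono-≤ : ∀ {m n} → m ℕ.≤ n → ι m ≤ ι n
  ι-mono-≤ {m} {n} m≤n = toℚᵘ-cancel-≤ (UP.≤-respˡ-≃ (UP.≃-sym (toℚᵘ-/ m 0)) (UP.≤-respʳ-≃ (UP.≃-sym (toℚᵘ-/ n 0))
    (U.*≤* (ℤP.*-monoʳ-≤-nonNeg (+ 1) (ℤ.+≤+ m≤n)))))

  /≡ι*inv : ∀ a b → + a / suc b ≡ ι a * inv (suc b)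
  /≡ι*inv a b = toℚᵘ-injective (UP.≃-trans (toℚᵘ-/ a b)
    (UP.≃-sym (UP.≃-trans (toℚᵘ-homo-* (ι a) (inv (suc b)))
      (UP.≃-trans (UP.*-cong (toℚᵘ-/ a 0) (toℚᵘ-/ 1 b))
        (U.*≡* (cong₂ ℤ._*_ (ℤP.*-identityʳ (+ a)) (cong (λ t → + suc t) (sym (ℕP.+-identityʳ b)))))))))

  ι*inv : ∀ n .{{_ : NonZero n}} → ι n * inv n ≡ 1ℚ
  ι*inv (suc n) = trans (sym (/≡ι*inv (suc n) n)) (toℚᵘ-injective (UP.≃-trans (toℚᵘ-/ (suc n) n)
    (U.*≡* (ℤP.*-comm (+ suc n) (+ 1)))))

  0≤ι : ∀ n → 0ℚ ≤ ι n
  0≤ι n = ι-mono-≤ {0} {n} ℕ.z≤n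

  *-monoˡ-≤ : ∀ {r p q} → 0ℚ ≤ r → p ≤ q → r * p ≤ r * q
  *-monoˡ-≤ {r} 0≤r = *-monoˡ-≤-nonNeg r {{nonNegative 0≤r}}

  *-monoʳ-≤ : ∀ {r p q} → 0ℚ ≤ r → p ≤ q → p * r ≤ q * r
  *-monoʳ-≤ {r} 0≤r = *-monoʳ-≤-nonNeg r {{nonNegative 0≤r}}

  *-mono-≤ : ∀ {p q r s} → 0ℚ ≤ p → 0ℚ ≤ s → p ≤ q → r ≤ s → p * r ≤ q * s
  *-mono-≤ 0≤p 0≤s p≤q r≤s = ≤-trans (*-monoˡ-≤ 0≤p r≤s) (*-monoʳ-≤ 0≤s p≤q)

  0≤* : ∀ {p q} → 0ℚ ≤ p → 0ℚ ≤ q → 0ℚ ≤ p * q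
  0≤* {p} {q} 0≤p 0≤q = subst (_≤ p * q) (*-zeroʳ p) (*-monoˡ-≤ 0≤p 0≤q)

  0≤+ : ∀ {p q} → 0ℚ ≤ p → 0ℚ ≤ q → 0ℚ ≤ p + q
  0≤+ {p} {q} 0≤p 0≤q = +-mono-≤ 0≤p 0≤q

  0≤inv : ∀ n → 0ℚ ≤ inv n
  0≤inv zero = ≤-refl
  0≤inv (suc n) = nonNegative⁻¹ _ {{normalize-nonNeg 1 (suc n)}}

  -- The convention `inv 0` = 0 makes this hold for zero arguments too, so products of fractions can
  -- be merged without side conditions. In the remaining case the unknown inverse is multiplied by 1
  -- = (m · 1/m)(n · 1/n) and regrouped.
  inv-* : ∀ m n → inv (m ℕ.* n) ≡ inv m * inv n
  inv-* zero n = sym (*-zeroˡ (inv n))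
  inv-* (suc m) zero = trans (cong inv (ℕP.*-zeroʳ m)) (sym (*-zeroʳ (inv (suc m))))
  inv-* (suc m) (suc n) = begin
    i                                       ≡⟨ solve 1 (λ i → i := con 1ℚ :* con 1ℚ :* i) refl i ⟩
    1ℚ * 1ℚ * i                             ≡⟨ cong (_* i) (cong₂ _*_ (sym (ι*inv (suc m))) (sym (ι*inv (suc n)))) ⟩
    (x * inv (suc m)) * (y * inv (suc n)) * i
      ≡⟨ solve 5 (λ x y a b i → (x :* a) :* (y :* b) :* i := (a :* b) :* ((x :* y) :* i)) refl x y (inv (suc m)) (inv (suc n)) i ⟩
    (inv (suc m) * inv (suc n)) * ((x * y) * i) ≡⟨ cong ((inv (suc m) * inv (suc n)) *_)
        (trans (cong (_* i) (sym (ι-* (suc m) (suc n)))) (ι*inv (suc m ℕ.* suc n))) ⟩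
    (inv (suc m) * inv (suc n)) * 1ℚ        ≡⟨ *-identityʳ _ ⟩
    inv (suc m) * inv (suc n) ∎
    where
    open ≡-Reasoning
    i = inv (suc m ℕ.* suc n)
    x = ι (suc m)
    y = ι (suc n)

  -- The hypothesis is cleared of denominators: a/k ≤ b/l.
  ι*inv-mono-≤ : ∀ a b k l .{{_ : NonZero k}} .{{_ : NonZero l}} → a ℕ.* l ℕ.≤ b ℕ.* k → ι a * inv k ≤ ι b * inv l
  ι*inv-mono-≤ a b k l le = subst₂ _≤_ (eq a k l) (trans (cong (ι (b ℕ.* k) *_) (*-comm (inv k) (inv l))) (eq b l k))
    (*-monoʳ-≤ (0≤* (0≤inv k) (0≤inv l)) (ι-mono-≤ le))
    where
    eq : ∀ a k l .{{_ : NonZero k}} .{{_ : NonZero l}} → ι (a ℕ.* l) * (inv k * inv l) ≡ ι a * inv k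
    eq a k l = begin
      ι (a ℕ.* l) * (inv k * inv l)   ≡⟨ cong (_* (inv k * inv l)) (ι-* a l) ⟩
      (ι a * ι l) * (inv k * inv l)   ≡⟨ solve 4 (λ a l i j → (a :* l) :* (i :* j) := (a :* i) :* (l :* j)) refl (ι a) (ι l) (inv k) (inv l) ⟩
      (ι a * inv k) * (ι l * inv l)   ≡⟨ cong ((ι a * inv k) *_) (ι*inv l) ⟩
      (ι a * inv k) * 1ℚ              ≡⟨ *-identityʳ _ ⟩
      ι a * inv k                     ∎
      where open ≡-Reasoning

  ∣p∣≤q : ∀ {p q} → p ≤ q → - p ≤ q → ∣ p ∣ ≤ q
  ∣p∣≤q {p} {q} p≤q -p≤q with ∣p∣≡p∨∣p∣≡-p p
  ... | inj₁ eq = subst (_≤ q) (sym eq) p≤q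
  ... | inj₂ eq = subst (_≤ q) (sym eq) -p≤q

  p≤q+r⇒p-q≤r : ∀ {p q r} → p ≤ q + r → p - q ≤ r
  p≤q+r⇒p-q≤r {p} {q} {r} le = subst (p - q ≤_) (solve 2 (λ q r → (q :+ r) :- q := r) refl q r) (+-monoˡ-≤ (- q) le)

  ∣p-q∣≤r : ∀ {p q r} → p ≤ q + r → q ≤ p + r → ∣ p - q ∣ ≤ r
  ∣p-q∣≤r {p} {q} {r} le₁ le₂ = ∣p∣≤q (p≤q+r⇒p-q≤r {p} {q} le₁)
    (subst (_≤ r) (solve 2 (λ p q → q :- p := :- (p :- q)) refl p q ) (p≤q+r⇒p-q≤r {q} {p} le₂))

-- Sums over boxes of lattice points.

module LatticeCounting where

  open import Data.Bool using (Bool; true; false; not; _∧_; T)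
  open import Data.Nat
  open import Data.Nat.Properties
  open import Data.Nat.Divisibility
  open import Data.Nat.GCD using (gcd; gcd[m,n]∣m; gcd[m,n]∣n; gcd-greatest)
  open import Data.Nat.Solver using (module +-*-Solver)
  open +-*-Solver using (solve; _:=_; _:+_; _:*_; con)
  open import Data.Integer as ℤ using (ℤ; -[1+_])
  open import Data.List using (List; []; _∷_; map; _++_; concatMap; upTo; applyUpTo)
  open import Data.List.Properties using (applyUpTo-∷ʳ)
  open import Data.Product using (_×_; _,_; ∃; proj₁; proj₂)
  open import Data.Sum using (_⊎_; inj₁; inj₂)
  open import Function using (_∘_; id)
  open import Relation.Nullary using (¬_; yes; no; does; contradiction)
  open import Relation.Nullary.Decidable using (dec-true; dec-false)
  open import Relation.Binary.PropositionalEquality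

  private variable X Y : Set

  bit : Bool → ℕ
  bit true  = 1
  bit false = 0

  bit-∧ : ∀ b c → bit (b ∧ c) ≡ bit b * bit c
  bit-∧ true  c = sym (+-identityʳ (bit c))
  bit-∧ false c = refl

  bit≤1 : ∀ b → bit b ≤ 1
  bit≤1 true  = ≤-refl
  bit≤1 false = z≤n

  sumL : (X → ℕ) → List X → ℕ
  sumL f []       = 0
  sumL f (x ∷ xs) = f x + sumL f xs

  countB≡sumL : ∀ (p : X → Bool) xs → countB p xs ≡ sumL (bit ∘ p) xs
  countB≡sumL p []       = refl
  countB≡sumL p (x ∷ xs) with p x
  ... | true  = cong suc (countB≡sumL p xs)
  ... | false = countB≡sumL p xs

  sumL-cong : ∀ {f g : X → ℕ} → (∀ x → f x ≡ g x) → ∀ xs → sumL f xs ≡ sumL g xs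
  sumL-cong eq []       = refl
  sumL-cong eq (x ∷ xs) = cong₂ _+_ (eq x) (sumL-cong eq xs)

  sumL-mono : ∀ {f g : X → ℕ} → (∀ x → f x ≤ g x) → ∀ xs → sumL f xs ≤ sumL g xs
  sumL-mono le []       = z≤n
  sumL-mono le (x ∷ xs) = +-mono-≤ (le x) (sumL-mono le xs)

  sumL-++ : ∀ (f : X → ℕ) xs ys → sumL f (xs ++ ys) ≡ sumL f xs + sumL f ys
  sumL-++ f []       ys = refl
  sumL-++ f (x ∷ xs) ys = trans (cong (_ +_) (sumL-++ f xs ys)) (sym (+-assoc (f x) _ _))

  sumL-map : ∀ (f : Y → ℕ) (g : X → Y) xs → sumL f (map g xs) ≡ sumL (f ∘ g) xs
  sumL-map f g []       = refl
  sumL-map f g (x ∷ xs) = cong (_ +_) (sumL-map f g xs)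

  sumL-concatMap : ∀ (f : Y → ℕ) (g : X → List Y) xs → sumL f (concatMap g xs) ≡ sumL (λ x → sumL f (g x)) xs
  sumL-concatMap f g []       = refl
  sumL-concatMap f g (x ∷ xs) = trans (sumL-++ f (g x) (concatMap g xs)) (cong (_ +_) (sumL-concatMap f g xs))

  interchange : ∀ a b c d → (a + b) + (c + d) ≡ (a + c) + (b + d)
  interchange = solve 4 (λ a b c d → (a :+ b) :+ (c :+ d) := (a :+ c) :+ (b :+ d)) refl

  -- S n f = f 1 + ⋯ + f n
  S : ℕ → (ℕ → ℕ) → ℕ
  S zero    f = 0
  S (suc n) f = S n f + f (suc n)

  S-cong≤ : ∀ n {f g} → (∀ i → 1 ≤ i → i ≤ n → f i ≡ g i) → S n f ≡ S n g
  S-cong≤ zero    eq = refl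
  S-cong≤ (suc n) eq = cong₂ _+_ (S-cong≤ n (λ i p q → eq i p (m≤n⇒m≤1+n q))) (eq (suc n) (s≤s z≤n) ≤-refl)

  S-cong : ∀ n {f g} → (∀ i → f i ≡ g i) → S n f ≡ S n g
  S-cong n eq = S-cong≤ n (λ i _ _ → eq i)

  S-mono : ∀ n {f g} → (∀ i → f i ≤ g i) → S n f ≤ S n g
  S-mono zero    le = z≤n
  S-mono (suc n) le = +-mono-≤ (S-mono n le) (le (suc n))

  S-+ : ∀ n f g → S n (λ i → f i + g i) ≡ S n f + S n g
  S-+ zero    f g = refl
  S-+ (suc n) f g = trans (cong (_+ (f (suc n) + g (suc n))) (S-+ n f g)) (interchange (S n f) (S n g) _ _)

  S-*ˡ : ∀ n c f → S n (λ i → c * f i) ≡ c * S n f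
  S-*ˡ zero    c f = sym (*-zeroʳ c)
  S-*ˡ (suc n) c f = trans (cong (_+ c * f (suc n)) (S-*ˡ n c f)) (sym (*-distribˡ-+ c (S n f) (f (suc n))))

  S-const0 : ∀ n → S n (λ _ → 0) ≡ 0
  S-const0 zero    = refl
  S-const0 (suc n) = trans (+-identityʳ _) (S-const0 n)

  S-const1 : ∀ n → S n (λ _ → 1) ≡ n
  S-const1 zero    = refl
  S-const1 (suc n) = trans (+-comm _ 1) (cong suc (S-const1 n))

  S-length-mono : ∀ {m n} f → m ≤ n → S m f ≤ S n f
  S-length-mono {m} {zero}  f z≤n = z≤n
  S-length-mono {m} {suc n} f m≤n with m≤n⇒m<n∨m≡n m≤n
  ... | inj₁ (s≤s le) = ≤-trans (S-length-mono f le) (m≤m+n _ _)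
  ... | inj₂ refl     = ≤-refl

  term≤S : ∀ n f i → 1 ≤ i → i ≤ n → f i ≤ S n f
  term≤S n f (suc i) _ le = ≤-trans (m≤n+m (f (suc i)) (S i f)) (S-length-mono f le)

  S-swap : ∀ n m (F : ℕ → ℕ → ℕ) → S n (λ i → S m (F i)) ≡ S m (λ j → S n (λ i → F i j))
  S-swap zero    m F = sym (S-const0 m)
  S-swap (suc n) m F = trans (cong (_+ S m (F (suc n))) (S-swap n m F)) (sym (S-+ m _ (F (suc n))))

  sumL-S : ∀ (F : X → ℕ → ℕ) m xs → sumL (λ x → S m (F x)) xs ≡ S m (λ j → sumL (λ x → F x j) xs)
  sumL-S F m []       = sym (S-const0 m)
  sumL-S F m (x ∷ xs) = trans (cong (_ +_) (sumL-S F m xs)) (sym (S-+ m (F x) _))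

  sumL-applyUpTo : ∀ (f : X → ℕ) (g : ℕ → X) (h : ℕ → ℕ) → (∀ i → f (g i) ≡ h (suc i)) →
    ∀ n → sumL f (applyUpTo g n) ≡ S n h
  sumL-applyUpTo f g h eq zero    = refl
  sumL-applyUpTo f g h eq (suc n) = begin
    sumL f (applyUpTo g (suc n))               ≡⟨ cong (sumL f) (sym (applyUpTo-∷ʳ g n)) ⟩
    sumL f (applyUpTo g n ++ g n ∷ [])         ≡⟨ sumL-++ f (applyUpTo g n) _ ⟩
    sumL f (applyUpTo g n) + (f (g n) + 0)     ≡⟨ cong₂ _+_ (sumL-applyUpTo f g h eq n) (trans (+-identityʳ _) (eq n)) ⟩
    S n h + h (suc n)                          ∎
    where open ≡-Reasoning

  -- B n f is the sum of f ∣ a ∣ over -n ≤ a ≤ n.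
  B : ℕ → (ℕ → ℕ) → ℕ
  B n f = f 0 + (S n f + S n f)

  sumL-box : ∀ (f : ℤ → ℕ) (h : ℕ → ℕ) → (∀ a → f a ≡ h ℤ.∣ a ∣) → ∀ n → sumL f (box n) ≡ B n h
  sumL-box f h eq n = begin
    sumL f (map ℤ.+_ (upTo (suc n)) ++ map -[1+_] (upTo n))            ≡⟨ sumL-++ f (map ℤ.+_ (upTo (suc n))) _ ⟩
    sumL f (map ℤ.+_ (upTo (suc n))) + sumL f (map -[1+_] (upTo n))    ≡⟨ cong₂ _+_ (sumL-map f ℤ.+_ (upTo (suc n))) (sumL-map f -[1+_] (upTo n)) ⟩
    (f (ℤ.+ 0) + sumL (f ∘ ℤ.+_) (applyUpTo suc n)) + sumL (f ∘ -[1+_]) (upTo n)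
      ≡⟨ cong₂ _+_ (cong₂ _+_ (eq (ℤ.+ 0)) (sumL-applyUpTo (f ∘ ℤ.+_) suc h (λ i → eq (ℤ.+ suc i)) n))
                   (sumL-applyUpTo (f ∘ -[1+_]) id h (λ i → eq -[1+ i ]) n) ⟩
    (h 0 + S n h) + S n h                                            ≡⟨ +-assoc (h 0) _ _ ⟩
    B n h ∎
    where open ≡-Reasoning

  sumL-square : ∀ (f : GI → ℕ) (h : ℕ → ℕ → ℕ) → (∀ a b → f (a , b) ≡ h ℤ.∣ a ∣ ℤ.∣ b ∣) →
    ∀ n → sumL f (square n) ≡ B n (λ i → B n (h i))
  sumL-square f h eq n = trans (sumL-concatMap f (λ a → map (a ,_) (box n)) (box n))
    (sumL-box _ (λ i → B n (h i)) (λ a → trans (sumL-map f (a ,_) (box n)) (sumL-box _ (h ℤ.∣ a ∣) (eq a) n)) n)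

  B-cong : ∀ n {f g} → (∀ i → f i ≡ g i) → B n f ≡ B n g
  B-cong n eq = cong₂ _+_ (eq 0) (cong₂ _+_ (S-cong n eq) (S-cong n eq))

  B-mono : ∀ n {f g} → (∀ i → f i ≤ g i) → B n f ≤ B n g
  B-mono n le = +-mono-≤ (le 0) (+-mono-≤ (S-mono n le) (S-mono n le))

  B-+ : ∀ n f g → B n (λ i → f i + g i) ≡ B n f + B n g
  B-+ n f g = trans (cong (f 0 + g 0 +_) (cong₂ _+_ (S-+ n f g) (S-+ n f g)))
    (solve 4 (λ a b c d → (a :+ b) :+ ((c :+ d) :+ (c :+ d)) := (a :+ (c :+ c)) :+ (b :+ (d :+ d))) refl (f 0) (g 0) (S n f) (S n g))

  B-*ˡ : ∀ n c f → B n (λ i → c * f i) ≡ c * B n f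
  B-*ˡ n c f = trans (cong (c * f 0 +_) (cong₂ _+_ (S-*ˡ n c f) (S-*ˡ n c f)))
    (solve 3 (λ c a b → c :* a :+ (c :* b :+ c :* b) := c :* (a :+ (b :+ b))) refl c (f 0) (S n f))

  B-*ʳ : ∀ n c f → B n (λ i → f i * c) ≡ B n f * c
  B-*ʳ n c f = trans (B-cong n (λ i → *-comm (f i) c)) (trans (B-*ˡ n c f) (*-comm c _))

  B-swap : ∀ n (F : ℕ → ℕ → ℕ) → B n (λ i → B n (F i)) ≡ B n (λ j → B n (λ i → F i j))
  B-swap n F = begin
    (F 0 0 + (r + r)) + (S n (λ i → B n (F i)) + S n (λ i → B n (F i)))
      ≡⟨ cong (λ t → (F 0 0 + (r + r)) + (t + t)) (split F) ⟩
    (F 0 0 + (r + r)) + ((c + (d + d)) + (c + (d + d)))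
      ≡⟨ solve 4 (λ a r c d → (a :+ (r :+ r)) :+ ((c :+ (d :+ d)) :+ (c :+ (d :+ d))) := (a :+ (c :+ c)) :+ ((r :+ (d :+ d)) :+ (r :+ (d :+ d)))) refl (F 0 0) r c d ⟩
    (F 0 0 + (c + c)) + ((r + (d + d)) + (r + (d + d)))
      ≡⟨ cong (λ t → (F 0 0 + (c + c)) + ((r + (t + t)) + (r + (t + t)))) (S-swap n n F) ⟩
    (F 0 0 + (c + c)) + ((r + (d' + d')) + (r + (d' + d')))
      ≡⟨ cong (λ t → (F 0 0 + (c + c)) + (t + t)) (sym (split (λ j i → F i j))) ⟩
    B n (λ j → B n (λ i → F i j)) ∎
    where
    open ≡-Reasoning
    r = S n (F 0)
    c = S n (λ i → F i 0)
    d = S n (λ i → S n (F i))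
    d' = S n (λ j → S n (λ i → F i j))
    split : ∀ F → S n (λ i → B n (F i)) ≡ S n (λ i → F i 0) + (S n (λ i → S n (F i)) + S n (λ i → S n (F i)))
    split F = trans (S-+ n (λ i → F i 0) _) (cong (S n (λ i → F i 0) +_) (S-+ n (λ i → S n (F i)) _))

  Antitone : (ℕ → Bool) → Set
  Antitone q = ∀ i j → i ≤ j → q j ≡ true → q i ≡ true

  bool-cases : ∀ b → b ≡ true ⊎ b ≡ false
  bool-cases true  = inj₁ refl
  bool-cases false = inj₂ refl

  bit≡1 : ∀ {b} → b ≡ true → bit b ≡ 1
  bit≡1 refl = refl

  bit≡0 : ∀ {b} → b ≡ false → bit b ≡ 0
  bit≡0 refl = refl

  -- The indices in 1..n at which `q` holds form an initial segment 1..t. One t serves every weight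
  -- w, so that all points of a row and its multiples of k are counted on the same segment.
  antitone-prefix : ∀ q → Antitone q → ∀ n → ∃ λ t → t ≤ n × (1 ≤ t → q t ≡ true) ×
    (∀ w → S n (λ i → bit (q i) * w i) ≡ S t w)
  antitone-prefix q anti zero = 0 , z≤n , (λ ()) , λ w → refl
  antitone-prefix q anti (suc n) with bool-cases (q (suc n))
  ... | inj₁ eq = suc n , ≤-refl , (λ _ → eq) , λ w →
        S-cong≤ (suc n) (λ i _ le → trans (cong (λ b → b * w i) (bit≡1 (anti i (suc n) le eq))) (*-identityˡ (w i)))
  ... | inj₂ eq with antitone-prefix q anti n
  ...   | t , t≤n , qt , h = t , m≤n⇒m≤1+n t≤n , qt , λ w →
        trans (cong (λ b → S n (λ i → bit (q i) * w i) + b * w (suc n)) (bit≡0 eq)) (trans (+-identityʳ _) (h w))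

  dv : ℕ → ℕ → ℕ
  dv k i = bit (does (k ∣? i))

  dv-yes : ∀ {k i} → k ∣ i → dv k i ≡ 1
  dv-yes {k} {i} d = cong bit (dec-true (k ∣? i) d)

  dv-no : ∀ {k i} → ¬ k ∣ i → dv k i ≡ 0
  dv-no {k} {i} d = cong bit (dec-false (k ∣? i) d)

  -- Turns a condition on the content into a product of conditions on the coordinates, so that rows
  -- and columns can be treated one after the other.
  dv-gcd : ∀ k i j → dv k (gcd i j) ≡ dv k i * dv k j
  dv-gcd k i j with k ∣? i | k ∣? j
  ... | yes p | yes q = trans (dv-yes (gcd-greatest p q)) refl
  ... | no p  | _     = dv-no (λ d → p (∣-trans d (gcd[m,n]∣m i j)))
  ... | yes p | no q  = dv-no (λ d → q (∣-trans d (gcd[m,n]∣n i j)))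

  -- Division with remainder: the quotient of t by k is the number of multiples of k in 1..t.
  -- Passing to t + 1 raises the remainder, or, when it would reach k, resets it and produces a new
  -- multiple.
  S-dv : ∀ k .{{_ : NonZero k}} t → ∃ λ r → r < k × t ≡ k * S t (dv k) + r
  S-dv k zero = 0 , >-nonZero⁻¹ k , sym (trans (+-identityʳ _) (*-zeroʳ k))
  S-dv k (suc t) with S-dv k t
  ... | r , r<k , eq with k ∣? suc t | m≤n⇒m<n∨m≡n r<k
  ...   | yes d | inj₁ r+1<k = contradiction (∣m+n∣m⇒∣n (subst (k ∣_) eq' d) (m∣m*n _)) (>⇒∤ r+1<k)
    where
    eq' : suc t ≡ k * S t (dv k) + suc r
    eq' = trans (cong suc eq) (sym (+-suc _ r))
  ...   | yes d | inj₂ r+1≡k = 0 , >-nonZero⁻¹ k , (begin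
    suc t                          ≡⟨ cong suc eq ⟩
    suc (k * S t (dv k) + r)       ≡⟨ sym (+-suc _ r) ⟩
    k * S t (dv k) + suc r         ≡⟨ cong (k * S t (dv k) +_) r+1≡k ⟩
    k * S t (dv k) + k             ≡⟨ solve 2 (λ k s → k :* s :+ k := k :* (s :+ con 1) :+ con 0) refl k (S t (dv k)) ⟩
    k * (S t (dv k) + 1) + 0       ∎)
    where open ≡-Reasoning
  ...   | no d | inj₁ r+1<k = suc r , r+1<k , trans (cong suc eq) (trans (sym (+-suc _ r)) (cong (λ z → k * z + suc r) (sym (+-identityʳ _))))
  ...   | no d | inj₂ r+1≡k = contradiction
    (subst (k ∣_) (sym (trans (cong suc eq) (trans (sym (+-suc _ r)) (cong (k * S t (dv k) +_) r+1≡k)))) (∣m∣n⇒∣m+n (m∣m*n _) ∣-refl)) d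

  box-prefix : ∀ q → Antitone q → q 0 ≡ true → ∀ n → ∃ λ t → t ≤ n × q t ≡ true ×
    (∀ (w : ℕ → ℕ) → B n (λ i → bit (q i) * w i) ≡ w 0 + (S t w + S t w))
  box-prefix q anti q0 n with antitone-prefix q anti n
  ... | t , t≤n , qt , h = t , t≤n , qt′ t qt , λ w →
        cong₂ _+_ (trans (cong (_* w 0) (bit≡1 q0)) (*-identityˡ (w 0))) (cong₂ _+_ (h w) (h w))
    where
    qt′ : ∀ t → (1 ≤ t → q t ≡ true) → q t ≡ true
    qt′ zero    _ = q0
    qt′ (suc t) f = f (s≤s z≤n)

  box-empty : ∀ q → Antitone q → q 0 ≡ false → ∀ n (w : ℕ → ℕ) → B n (λ i → bit (q i) * w i) ≡ 0
  box-empty q anti q0 n w = trans (B-cong n {g = λ _ → 0} (λ i → cong (_* w i) (q≡0 i))) (cong (λ t → t + t) (S-const0 n))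
    where
    q≡0 : ∀ i → bit (q i) ≡ 0
    q≡0 i with bool-cases (q i)
    ... | inj₁ eq = contradiction (trans (sym (anti 0 i z≤n eq)) q0) λ ()
    ... | inj₂ eq = bit≡0 eq

  -- |X - Y| ≤ E, written without the truncated subtraction of ℕ.
  Near : ℕ → ℕ → ℕ → Set
  Near E X Y = X ≤ Y + E × Y ≤ X + E

  Near-trans : ∀ {E F X Y Z} → Near E X Y → Near F Y Z → Near (E + F) X Z
  Near-trans {E} {F} {X} {Y} {Z} (a , b) (c , d) =
    ≤-trans a (≤-trans (+-monoˡ-≤ E c) (≤-reflexive (trans (+-assoc Z F E) (cong (Z +_) (+-comm F E))))) ,
    ≤-trans d (≤-trans (+-monoˡ-≤ F b) (≤-reflexive (+-assoc X E F)))

  Near-weaken : ∀ {E F X Y} → E ≤ F → Near E X Y → Near F X Y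
  Near-weaken {X = X} {Y} le (a , b) = ≤-trans a (+-monoʳ-≤ Y le) , ≤-trans b (+-monoʳ-≤ X le)

  Near-*ˡ : ∀ c {E X Y} → Near E X Y → Near (c * E) (c * X) (c * Y)
  Near-*ˡ c {E} {X} {Y} (a , b) = ≤-trans (*-monoʳ-≤ c a) (≤-reflexive (*-distribˡ-+ c Y E)) ,
    ≤-trans (*-monoʳ-≤ c b) (≤-reflexive (*-distribˡ-+ c X E))

  Near-B : ∀ n {E X Y : ℕ → ℕ} → (∀ i → Near (E i) (X i) (Y i)) → Near (B n E) (B n X) (B n Y)
  Near-B n {E} {X} {Y} h = ≤-trans (B-mono n (λ i → proj₁ (h i))) (≤-reflexive (B-+ n Y E)) ,
    ≤-trans (B-mono n (λ i → proj₂ (h i))) (≤-reflexive (B-+ n X E))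

  ≤ᵇ-intro : ∀ {m n} → m ≤ n → (m ≤ᵇ n) ≡ true
  ≤ᵇ-intro {m} {n} le with m ≤ᵇ n | ≤⇒≤ᵇ le
  ... | true | _ = refl

  ≤ᵇ-elim : ∀ {m n} → (m ≤ᵇ n) ≡ true → m ≤ n
  ≤ᵇ-elim {m} {n} eq = ≤ᵇ⇒≤ m n (subst T (sym eq) _)

  q : ℕ → ℕ → ℕ → Bool
  q n i j = i * i + j * j ≤ᵇ n

  q-sym : ∀ n i j → q n i j ≡ q n j i
  q-sym n i j = cong (_≤ᵇ n) (+-comm (i * i) (j * j))

  q-anti : ∀ n i → Antitone (q n i)
  q-anti n i j k le eq = ≤ᵇ-intro (≤-trans (+-monoʳ-≤ (i * i) (*-mono-≤ le le)) (≤ᵇ-elim eq))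

  q-antiˡ : ∀ n j → Antitone (λ i → q n i j)
  q-antiˡ n j i k le eq = trans (q-sym n i j) (q-anti n j i k le (trans (q-sym n j k) eq))

  -- The number 1 + 2⌊√n⌋ of integers whose square is at most n.
  s : ℕ → ℕ
  s n = B n (λ i → bit (q n i 0))

  -- A nonempty row is a segment -t..t. With t = k u + r it has 1 + 2t points, 1 + 2u of them
  -- multiples of k, and k (1 + 2u) - (1 + 2t) = k - 1 - 2r. The factor `bit (q n i 0)` cancels the
  -- error of the rows that miss the disc; without it the errors would add up to order n instead of
  -- √n.
  row-near : ∀ n k .{{_ : NonZero k}} i →
    Near (k * bit (q n i 0)) (k * B n (λ j → bit (q n i j) * dv k j)) (B n (λ j → bit (q n i j)))
  row-near n k i with bool-cases (q n i 0)
  ... | inj₂ eq = subst₂ (Near (k * bit (q n i 0))) (trans (sym (*-zeroʳ k)) (cong (k *_) (sym (box-empty (q n i) (q-anti n i) eq n (dv k)))))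
         (trans (sym (box-empty (q n i) (q-anti n i) eq n (λ _ → 1))) (B-cong n {λ j → bit (q n i j) * 1} {λ j → bit (q n i j)} (λ j → *-identityʳ _))) (z≤n , z≤n)
  ... | inj₁ eq with box-prefix (q n i) (q-anti n i) eq n
  ...   | t , _ , _ , h with S-dv k t
  ...     | r , r<k , t≡ = subst₂ (Near (k * bit (q n i 0))) (cong (k *_) (sym Xeq)) (sym Yeq)
              (subst (λ e → Near e (k * (1 + (u + u))) (1 + (t + t))) (cong (k *_) (sym (bit≡1 eq))) (le₁ , le₂))
    where
    u = S t (dv k)
    Xeq : B n (λ j → bit (q n i j) * dv k j) ≡ 1 + (u + u)
    Xeq = trans (h (dv k)) (cong (_+ (u + u)) (dv-yes (k ∣0)))
    Yeq : B n (λ j → bit (q n i j)) ≡ 1 + (t + t)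
    Yeq = trans (B-cong n {λ j → bit (q n i j)} {λ j → bit (q n i j) * 1} (λ j → sym (*-identityʳ _))) (trans (h (λ _ → 1)) (cong (λ z → 1 + (z + z)) (S-const1 t)))
    le₁ : k * (1 + (u + u)) ≤ 1 + (t + t) + k * 1
    le₁ = begin
      k * (1 + (u + u))                               ≤⟨ m≤m+n _ (1 + (r + r)) ⟩
      k * (1 + (u + u)) + (1 + (r + r))               ≡⟨ solve 3 (λ k u r → k :* (con 1 :+ (u :+ u)) :+ (con 1 :+ (r :+ r)) := con 1 :+ ((k :* u :+ r) :+ (k :* u :+ r)) :+ k :* con 1) refl k u r ⟩
      1 + ((k * u + r) + (k * u + r)) + k * 1         ≡⟨ cong (λ z → 1 + (z + z) + k * 1) (sym t≡) ⟩
      1 + (t + t) + k * 1                             ∎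
      where open ≤-Reasoning
    le₂ : 1 + (t + t) ≤ k * (1 + (u + u)) + k * 1
    le₂ = begin
      1 + (t + t)                                     ≡⟨ cong (λ z → 1 + (z + z)) t≡ ⟩
      1 + ((k * u + r) + (k * u + r))                 ≡⟨ solve 3 (λ k u r → con 1 :+ ((k :* u :+ r) :+ (k :* u :+ r)) := (k :* u :+ k :* u) :+ ((con 1 :+ r) :+ r)) refl k u r ⟩
      (k * u + k * u) + (suc r + r)                   ≤⟨ +-monoʳ-≤ (k * u + k * u) (+-mono-≤ r<k (<⇒≤ r<k)) ⟩
      (k * u + k * u) + (k + k)                       ≡⟨ solve 2 (λ k u → (k :* u :+ k :* u) :+ (k :+ k) := k :* (con 1 :+ (u :+ u)) :+ k :* con 1) refl k u ⟩
      k * (1 + (u + u)) + k * 1                       ∎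
      where open ≤-Reasoning

  W : ℕ → ℕ → ℕ
  W n k = B n (λ i → B n (λ j → bit (q n i j) * (dv k i * dv k j)))

  W₁ : ℕ → ℕ
  W₁ n = B n (λ i → B n (λ j → bit (q n i j)))

  -- The row estimate is applied twice: within the rows with k ∣ i it removes the condition k ∣ j;
  -- then the coordinates are exchanged, by `B-swap` and the symmetry of the disc, and it removes
  -- the other condition. The first error acquires a factor k from the second division.
  W-near : ∀ n k .{{_ : NonZero k}} → Near (k * (k * s n) + k * s n) (k * (k * W n k)) (W₁ n)
  W-near n k = Near-trans (Near-*ˡ k divide-columns) divide-rows
    where
    R R₁ : ℕ → ℕ
    R i = B n (λ j → bit (q n i j) * dv k j)
    R₁ i = B n (λ j → bit (q n i j))
    E≡ : B n (λ i → k * bit (q n i 0)) ≡ k * s n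
    E≡ = B-*ˡ n k (λ i → bit (q n i 0))
    divide-rows : Near (k * s n) (k * B n R) (W₁ n)
    divide-rows = subst₂ (λ e x → Near e x (W₁ n)) E≡ (B-*ˡ n k R) (Near-B n (row-near n k))
    W≡ : B n (λ i → dv k i * (k * R i)) ≡ k * W n k
    W≡ = begin
      B n (λ i → dv k i * (k * R i))     ≡⟨ B-cong n (λ i → solve 3 (λ a b c → a :* (b :* c) := b :* (a :* c)) refl (dv k i) k (R i)) ⟩
      B n (λ i → k * (dv k i * R i))     ≡⟨ B-*ˡ n k (λ i → dv k i * R i) ⟩
      k * B n (λ i → dv k i * R i)       ≡⟨ cong (k *_) (B-cong n (λ i → trans (sym (B-*ˡ n (dv k i) _))
         (B-cong n (λ j → solve 3 (λ a b c → a :* (b :* c) := b :* (a :* c)) refl (dv k i) (bit (q n i j)) (dv k j))))) ⟩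
      k * W n k ∎
      where open ≡-Reasoning
    V≡ : B n (λ i → dv k i * R₁ i) ≡ B n R
    V≡ = begin
      B n (λ i → dv k i * R₁ i)                          ≡⟨ B-cong n (λ i → sym (B-*ˡ n (dv k i) _)) ⟩
      B n (λ i → B n (λ j → dv k i * bit (q n i j)))     ≡⟨ B-swap n (λ i j → dv k i * bit (q n i j)) ⟩
      B n (λ j → B n (λ i → dv k i * bit (q n i j)))     ≡⟨ B-cong n (λ j → B-cong n (λ i → trans (*-comm (dv k i) _) (cong (λ z → bit z * dv k i) (q-sym n i j)))) ⟩
      B n R ∎
      where open ≡-Reasoning
    divide-columns : Near (k * s n) (k * W n k) (B n R)
    divide-columns = subst₂ (Near (k * s n)) W≡ V≡ (Near-weaken
      (≤-trans (B-mono n (λ i → ≤-trans (*-monoˡ-≤ _ (bit≤1 (does (k ∣? i)))) (≤-reflexive (*-identityˡ _)))) (≤-reflexive E≡))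
      (Near-B n (λ i → Near-*ˡ (dv k i) (row-near n k i))))

  content : GI → ℕ
  content (a , b) = gcd ℤ.∣ a ∣ ℤ.∣ b ∣

  inB : ℕ → GI → Bool
  inB n m = not (isZeroB m) ∧ (N m ≤ᵇ n)

  C : ℕ → ℕ → ℕ
  C n k = sumL (λ m → bit (inB n m) * dv k (content m)) (square n)

  -- The number |I_n|, including 0.
  C₁ : ℕ → ℕ
  C₁ n = suc (countNZ n)

  zeroBit : ℕ → ℕ
  zeroBit zero    = 1
  zeroBit (suc _) = 0

  B-zeroBit : ∀ n → B n (λ i → B n (λ j → zeroBit i * zeroBit j)) ≡ 1
  B-zeroBit n = trans (B-cong n {g = zeroBit} (λ i → trans (B-*ˡ n (zeroBit i) zeroBit) (trans (cong (zeroBit i *_) B-zero) (*-identityʳ _)))) B-zero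
    where
    S-zero : ∀ n → S n zeroBit ≡ 0
    S-zero zero    = refl
    S-zero (suc n) = trans (+-identityʳ _) (S-zero n)
    B-zero : B n zeroBit ≡ 1
    B-zero = cong (λ t → 1 + (t + t)) (S-zero n)

  nonzeroTerm : ℕ → ℕ → ℕ → ℕ → ℕ
  nonzeroTerm n k i j = bit (not ((i ≡ᵇ 0) ∧ (j ≡ᵇ 0)) ∧ q n i j) * dv k (gcd i j)

  isZeroB-abs : ∀ a b → isZeroB (a , b) ≡ (ℤ.∣ a ∣ ≡ᵇ 0) ∧ (ℤ.∣ b ∣ ≡ᵇ 0)
  isZeroB-abs (ℤ.+ zero)  (ℤ.+ zero)  = refl
  isZeroB-abs (ℤ.+ zero)  (ℤ.+ suc b) = refl
  isZeroB-abs (ℤ.+ zero)  (-[1+ b ])  = refl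
  isZeroB-abs (ℤ.+ suc a) b = refl
  isZeroB-abs (-[1+ a ])  b = refl

  -- `W` also counts the origin, which every k divides. The product of the two `zeroBit` restores
  -- this single point inside the double sum.
  suc-C≡W : ∀ n k → suc (C n k) ≡ W n k
  suc-C≡W n k = begin
    suc (C n k)                         ≡⟨ +-comm 1 _ ⟩
    C n k + 1                           ≡⟨ cong₂ _+_ (sumL-square _ (nonzeroTerm n k) (λ a b → cong (λ z → bit (not z ∧ (N (a , b) ≤ᵇ n)) * dv k (content (a , b))) (isZeroB-abs a b)) n)
                                             (sym (B-zeroBit n)) ⟩
    B n (λ i → B n (nonzeroTerm n k i)) + B n (λ i → B n (λ j → zeroBit i * zeroBit j))
                                        ≡⟨ sym (B-+ n (λ i → B n (nonzeroTerm n k i)) (λ i → B n (λ j → zeroBit i * zeroBit j))) ⟩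
    B n (λ i → B n (nonzeroTerm n k i) + B n (λ j → zeroBit i * zeroBit j))
                                        ≡⟨ B-cong n (λ i → trans (sym (B-+ n (nonzeroTerm n k i) (λ j → zeroBit i * zeroBit j))) (B-cong n (pointwise i))) ⟩
    W n k                               ∎
    where
    open ≡-Reasoning
    pointwise : ∀ i j → nonzeroTerm n k i j + zeroBit i * zeroBit j ≡ bit (q n i j) * (dv k i * dv k j)
    pointwise zero zero = sym (trans (*-identityˡ _) (cong₂ _*_ (dv-yes (k ∣0)) (dv-yes (k ∣0))))
    pointwise zero (suc j) = trans (+-identityʳ _) (cong (bit (q n 0 (suc j)) *_) (dv-gcd k 0 (suc j)))
    pointwise (suc i) j = trans (+-identityʳ _) (cong (bit (q n (suc i) j) *_) (dv-gcd k (suc i) j))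

  countNZ≡C1 : ∀ n → countNZ n ≡ C n 1
  countNZ≡C1 n = trans (countB≡sumL (inB n) (square n)) (sumL-cong {f = bit ∘ inB n} (λ m → sym (trans (cong (bit (inB n m) *_) (dv-yes (1∣ content m))) (*-identityʳ _))) (square n))

  C₁≡W₁ : ∀ n → C₁ n ≡ W₁ n
  C₁≡W₁ n = trans (cong suc (countNZ≡C1 n)) (trans (suc-C≡W n 1)
    (B-cong n (λ i → B-cong n {g = λ j → bit (q n i j)} (λ j → trans (cong (bit (q n i j) *_) (cong₂ _*_ (dv-yes (1∣ i)) (dv-yes (1∣ j)))) (*-identityʳ _)))))

  1≤s : ∀ n → 1 ≤ s n
  1≤s n = m≤m+n 1 _

  -- The 3 collects three errors, each at most k² · `s n`: k² for the missing origin, and k² · `s n`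
  -- and k · `s n` from the two divisions.
  C-near : ∀ n k .{{_ : NonZero k}} → Near (3 * (k * k) * s n) (k * k * C n k) (C₁ n)
  C-near n k = Near-weaken le (Near-trans shift (subst (Near (k * (k * s n) + k * s n) (k * (k * W n k))) (sym (C₁≡W₁ n)) (W-near n k)))
    where
    shift : Near (k * k) (k * k * C n k) (k * (k * W n k))
    shift = subst (λ w → Near (k * k) (k * k * C n k) (k * (k * w))) (suc-C≡W n k)
      ( ≤-trans (m≤m+n _ (k * k + k * k)) (≤-reflexive (solve 2 (λ k c → k :* k :* c :+ (k :* k :+ k :* k) := k :* (k :* (con 1 :+ c)) :+ k :* k) refl k (C n k)))
      , ≤-reflexive (solve 2 (λ k c → k :* (k :* (con 1 :+ c)) := k :* k :* c :+ k :* k) refl k (C n k)))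
    le : k * k + (k * (k * s n) + k * s n) ≤ 3 * (k * k) * s n
    le = begin
      k * k + (k * (k * s n) + k * s n)                   ≤⟨ +-mono-≤ (≤-trans (≤-reflexive (sym (*-identityʳ (k * k)))) (*-monoʳ-≤ (k * k) (1≤s n)))
                                                              (+-monoʳ-≤ (k * (k * s n)) (*-monoʳ-≤ k (≤-trans (≤-reflexive (sym (*-identityˡ (s n)))) (*-monoˡ-≤ (s n) (>-nonZero⁻¹ k))))) ⟩
      k * k * s n + (k * (k * s n) + k * (k * s n))       ≡⟨ solve 2 (λ k s → k :* k :* s :+ (k :* (k :* s) :+ k :* (k :* s)) := con 3 :* (k :* k) :* s) refl k (s n) ⟩
      3 * (k * k) * s n ∎
      where open ≤-Reasoning

  -- Size of the disc, and bounds uniform in the divisor.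

  halve : ∀ t → ∃ λ u → u + u ≤ t × t ≤ 1 + (u + u)
  halve zero = 0 , z≤n , z≤n
  halve (suc zero) = 0 , z≤n , ≤-refl
  halve (suc (suc t)) with halve t
  ... | u , a , b = suc u , s≤s (≤-trans (≤-reflexive (+-suc u u)) (s≤s a)) ,
        ≤-trans (s≤s (s≤s b)) (≤-reflexive (cong (suc ∘ suc) (sym (+-suc u u))))

  S-ones : ∀ (p : ℕ → Bool) u n → u ≤ n → (∀ i → i ≤ u → p i ≡ true) → u ≤ S n (bit ∘ p)
  S-ones p u n u≤n all = ≤-trans (≤-reflexive (sym (trans (S-cong≤ u (λ i _ le → bit≡1 (all i le))) (S-const1 u)))) (S-length-mono (bit ∘ p) u≤n)

  -- t is the integer square root of n, obtained as the length of the segment on which i² ≤ n.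
  sqrt : ∀ n → ∃ λ t → t ≤ n × t * t ≤ n × s n ≡ 1 + (t + t) ×
    (∀ k → B n (λ i → bit (q n i 0) * dv k i) ≡ 1 + (S t (dv k) + S t (dv k)))
  sqrt n with box-prefix (λ i → q n i 0) (q-antiˡ n 0) refl n
  ... | t , t≤n , qt , h = t , t≤n , subst (_≤ n) (+-identityʳ _) (≤ᵇ-elim qt) ,
    trans (B-cong n {λ i → bit (q n i 0)} {λ i → bit (q n i 0) * 1} (λ i → sym (*-identityʳ _)))
          (trans (h (λ _ → 1)) (cong (λ z → 1 + (z + z)) (S-const1 t))) ,
    λ k → trans (h (dv k)) (cong (_+ (S t (dv k) + S t (dv k))) (dv-yes (k ∣0)))

  -- Serves to absorb a constant multiple of `s n` into `s n * s n` once n is large.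
  s-large : ∀ n x → x * x ≤ n → x ≤ s n
  s-large n zero    _  = z≤n
  s-large n x@(suc _) le = begin
    x                                     ≤⟨ S-ones (λ i → q n i 0) x n (≤-trans (m≤m*n x x) le)
                                              (λ i i≤x → ≤ᵇ-intro (≤-trans (≤-reflexive (+-identityʳ _)) (≤-trans (*-mono-≤ i≤x i≤x) le))) ⟩
    S n (λ i → bit (q n i 0))             ≤⟨ m≤m+n _ _ ⟩
    S n (λ i → bit (q n i 0)) + S n (λ i → bit (q n i 0))   ≤⟨ m≤n+m _ 1 ⟩
    s n ∎
    where open ≤-Reasoning

  -- The disc of radius √n contains the square of half-side u.
  square⊆disc : ∀ n u → (u + u) * (u + u) ≤ n → (1 + (u + u)) * (1 + (u + u)) ≤ C₁ n
  square⊆disc n u le = begin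
    (1 + (u + u)) * (1 + (u + u))                 ≤⟨ *-mono-≤ side side ⟩
    B n (bit ∘ p) * B n (bit ∘ p)                 ≡⟨ sym (B-*ʳ n (B n (bit ∘ p)) (bit ∘ p)) ⟩
    B n (λ i → bit (p i) * B n (bit ∘ p))         ≡⟨ B-cong n (λ i → sym (B-*ˡ n (bit (p i)) (bit ∘ p))) ⟩
    B n (λ i → B n (λ j → bit (p i) * bit (p j))) ≤⟨ B-mono n (λ i → B-mono n (pointwise i)) ⟩
    W₁ n                                          ≡⟨ sym (C₁≡W₁ n) ⟩
    C₁ n                                          ∎
    where
    open ≤-Reasoning
    -- From 2i² ≤ n and 2j² ≤ n follows i² + j² ≤ n; this splits membership in the inscribed square
    -- into one condition per coordinate.
    p : ℕ → Bool
    p i = 2 * (i * i) ≤ᵇ n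
    ones : ∀ i → i ≤ u → p i ≡ true
    ones i i≤u = ≤ᵇ-intro (≤-trans (≤-trans (*-monoʳ-≤ 2 (*-mono-≤ i≤u i≤u)) (≤-trans (m≤m+n _ (2 * (u * u)))
      (≤-reflexive (solve 1 (λ u → con 2 :* (u :* u) :+ con 2 :* (u :* u) := (u :+ u) :* (u :+ u)) refl u)))) le)
    u≤n : ∀ u → (u + u) * (u + u) ≤ n → u ≤ n
    u≤n zero      _  = z≤n
    u≤n v@(suc _) le = ≤-trans (≤-trans (m≤m+n v v) (m≤m*n (v + v) (v + v))) le
    side : 1 + (u + u) ≤ B n (bit ∘ p)
    side = let S≥ = S-ones p u n (u≤n u le) ones in +-monoʳ-≤ 1 (+-mono-≤ S≥ S≥)
    pointwise : ∀ i j → bit (p i) * bit (p j) ≤ bit (q n i j)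
    pointwise i j with bool-cases (p i) | bool-cases (p j)
    ... | inj₂ e | _      = ≤-trans (≤-reflexive (cong (_* bit (p j)) (bit≡0 e))) z≤n
    ... | inj₁ _ | inj₂ e = ≤-trans (≤-reflexive (trans (cong (bit (p i) *_) (bit≡0 e)) (*-zeroʳ (bit (p i))))) z≤n
    ... | inj₁ e | inj₁ f = ≤-reflexive (trans (cong₂ _*_ (bit≡1 e) (bit≡1 f)) (sym (bit≡1 (≤ᵇ-intro {i * i + j * j} {n}
          (*-cancelˡ-≤ 2 (≤-trans (≤-reflexive (*-distribˡ-+ 2 (i * i) (j * j))) (≤-trans (+-mono-≤ (≤ᵇ-elim {2 * (i * i)} {n} e) (≤ᵇ-elim {2 * (j * j)} {n} f))
            (≤-reflexive (cong (n +_) (sym (+-identityʳ n)))))))))))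

  -- v = 1 + 2⌊t/2⌋ counts the lattice points on a side of an inscribed square. With u = ⌊t/2⌋ one
  -- has 1 + 2t ≤ 3 + 4u ≤ 3v, and this 3 becomes the 9 of `s²≤9C₁`.
  disc-lower : ∀ n t → t * t ≤ n → ∃ λ v → t ≤ v × 1 + (t + t) ≤ 3 * v × v * v ≤ C₁ n
  disc-lower n t le with halve t
  ... | u , a , b = 1 + (u + u) , b ,
    ≤-trans (+-monoʳ-≤ 1 (+-mono-≤ b b)) (≤-trans (m≤m+n _ (u + u)) (≤-reflexive
      (solve 1 (λ u → (con 1 :+ ((con 1 :+ (u :+ u)) :+ (con 1 :+ (u :+ u)))) :+ (u :+ u) := con 3 :* (con 1 :+ (u :+ u))) refl u))) ,
    square⊆disc n u (≤-trans (*-mono-≤ a a) le)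

  nine : ∀ v → (3 * v) * (3 * v) ≡ 9 * (v * v)
  nine = solve 1 (λ v → (con 3 :* v) :* (con 3 :* v) := con 9 :* (v :* v)) refl

  s²≤9C₁ : ∀ n → s n * s n ≤ 9 * C₁ n
  s²≤9C₁ n = let t , _ , tt≤n , s≡ , _ = sqrt n ; v , _ , le , vv≤ = disc-lower n t tt≤n in begin
    s n * s n               ≡⟨ cong (λ z → z * z) s≡ ⟩
    (1 + (t + t)) * (1 + (t + t)) ≤⟨ *-mono-≤ le le ⟩
    (3 * v) * (3 * v)       ≡⟨ nine v ⟩
    9 * (v * v)             ≤⟨ *-monoʳ-≤ 9 vv≤ ⟩
    9 * C₁ n                ∎
    where open ≤-Reasoning

  -- The error 3 d² · `s n` of `C-near` swamps |I_n| for large d, while the sum over all d > D needs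
  -- a bound uniform in d. The disc is therefore enclosed in the square of half-side t = ⌊√n⌋, which
  -- has (1 + 2u)² points with both coordinates divisible by d, where u = ⌊t/d⌋. If u ≥ 1, then d ≤
  -- d u ≤ t and so d (1 + 2u) ≤ 3t.
  C-upper : ∀ n d .{{_ : NonZero d}} → d * d * C n d ≤ 9 * C₁ n
  C-upper n d = let t , _ , tt≤n , _ , h = sqrt n ; v , t≤v , _ , vv≤ = disc-lower n t tt≤n ; r , _ , t≡ = S-dv d t
                in go t v r h t≤v vv≤ t≡ (S t (dv d)) refl
    where
    open ≤-Reasoning
    Z = B n (λ i → bit (q n i 0) * dv d i)
    pointwise : ∀ i j → bit (q n i j) ≤ bit (q n i 0) * bit (q n j 0)
    pointwise i j with bool-cases (q n i j)
    ... | inj₂ e = ≤-trans (≤-reflexive (bit≡0 e)) z≤n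
    ... | inj₁ e = ≤-reflexive (trans (bit≡1 e) (sym (cong₂ _*_ (bit≡1 (q-anti n i 0 j z≤n e))
          (bit≡1 (trans (q-sym n j 0) (q-antiˡ n j 0 i z≤n e))))))
    W≤Z² : W n d ≤ Z * Z
    W≤Z² = begin
      W n d ≤⟨ B-mono n (λ i → B-mono n (λ j → ≤-trans (*-monoˡ-≤ (dv d i * dv d j) (pointwise i j))
                 (≤-reflexive (solve 4 (λ a b c d → a :* b :* (c :* d) := (a :* c) :* (b :* d)) refl (bit (q n i 0)) (bit (q n j 0)) (dv d i) (dv d j))))) ⟩
      B n (λ i → B n (λ j → (bit (q n i 0) * dv d i) * (bit (q n j 0) * dv d j)))
        ≡⟨ B-cong n (λ i → B-*ˡ n (bit (q n i 0) * dv d i) (λ j → bit (q n j 0) * dv d j)) ⟩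
      B n (λ i → (bit (q n i 0) * dv d i) * Z)  ≡⟨ B-*ʳ n Z (λ i → bit (q n i 0) * dv d i) ⟩
      Z * Z ∎
    go : ∀ t v r → (∀ k → B n (λ i → bit (q n i 0) * dv k i) ≡ 1 + (S t (dv k) + S t (dv k))) →
      t ≤ v → v * v ≤ C₁ n → t ≡ d * S t (dv d) + r → ∀ u → S t (dv d) ≡ u → d * d * C n d ≤ 9 * C₁ n
    -- For u = 0 only the origin is divisible by d, and `C` does not count it.
    go t v r h t≤v vv≤ t≡ zero u≡ = ≤-trans (≤-reflexive (trans (cong (d * d *_) (n≤0⇒n≡0 (s≤s⁻¹ C≤))) (*-zeroʳ (d * d)))) z≤n
      where
      C≤ : suc (C n d) ≤ 1
      C≤ = begin
        suc (C n d) ≡⟨ suc-C≡W n d ⟩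
        W n d       ≤⟨ W≤Z² ⟩
        Z * Z       ≡⟨ cong (λ z → z * z) (trans (h d) (cong (λ z → 1 + (z + z)) u≡)) ⟩
        1           ∎
    go t v r h t≤v vv≤ t≡ (suc u) u≡ = begin
      d * d * C n d       ≤⟨ *-monoʳ-≤ (d * d) (≤-trans (n≤1+n _) (≤-reflexive (suc-C≡W n d))) ⟩
      d * d * W n d       ≤⟨ *-monoʳ-≤ (d * d) W≤Z² ⟩
      d * d * (Z * Z)     ≡⟨ solve 2 (λ d z → d :* d :* (z :* z) := (d :* z) :* (d :* z)) refl d Z ⟩
      (d * Z) * (d * Z)   ≤⟨ *-mono-≤ dZ≤ dZ≤ ⟩
      (3 * v) * (3 * v)   ≡⟨ nine v ⟩
      9 * (v * v)         ≤⟨ *-monoʳ-≤ 9 vv≤ ⟩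
      9 * C₁ n            ∎
      where
      du≤t : d * suc u ≤ t
      du≤t = ≤-trans (≤-reflexive (cong (d *_) (sym u≡))) (≤-trans (m≤m+n _ r) (≤-reflexive (sym t≡)))
      dZ≤ : d * Z ≤ 3 * v
      dZ≤ = begin
        d * Z                             ≡⟨ cong (d *_) (trans (h d) (cong (λ z → 1 + (z + z)) u≡)) ⟩
        d * (1 + (suc u + suc u))         ≡⟨ solve 2 (λ d u → d :* (con 1 :+ (u :+ u)) := d :+ (d :* u :+ d :* u)) refl d (suc u) ⟩
        d + (d * suc u + d * suc u)       ≤⟨ +-mono-≤ (≤-trans (m≤m*n d (suc u)) du≤t) (+-mono-≤ du≤t du≤t) ⟩
        t + (t + t)                       ≤⟨ +-mono-≤ t≤v (+-mono-≤ t≤v t≤v) ⟩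
        v + (v + v)                       ≡⟨ cong (λ z → v + (v + z)) (sym (+-identityʳ v)) ⟩
        3 * v                             ∎

  -- 1/d² ≤ 1/(d-1) - 1/d telescopes; with denominators cleared the partial sum is D(D+T) Σ ≤ Y T.
  telescope : ∀ (X : ℕ → ℕ) Y D .{{_ : NonZero D}} → (∀ i → (D + suc i) * (D + suc i) * X (suc i) ≤ Y) →
    ∀ T → D * (D + T) * S T X ≤ Y * T
  telescope X Y D h zero = ≤-reflexive (trans (*-zeroʳ (D * (D + 0))) (sym (*-zeroʳ Y)))
  telescope X Y D h (suc T) = *-cancelˡ-≤ e {{e≢0}} (begin
    e * (D * (D + suc T) * (Σ + x))            ≡⟨ cong (λ z → e * (D * z * (Σ + x))) (+-suc D T) ⟩
    e * (D * suc e * (Σ + x))                  ≡⟨ solve 4 (λ e D Σ x → e :* (D :* (con 1 :+ e) :* (Σ :+ x)) := (con 1 :+ e) :* (D :* e :* Σ) :+ D :* (e :* (con 1 :+ e) :* x)) refl e D Σ x ⟩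
    suc e * (D * e * Σ) + D * (e * suc e * x)  ≤⟨ +-mono-≤ (*-monoʳ-≤ (suc e) (telescope X Y D h T)) (*-monoʳ-≤ D step) ⟩
    suc e * (Y * T) + D * Y                    ≡⟨ solve 3 (λ D Y T → (con 1 :+ (D :+ T)) :* (Y :* T) :+ D :* Y := (D :+ T) :* (Y :* (con 1 :+ T))) refl D Y T ⟩
    e * (Y * suc T)                            ∎)
    where
    open ≤-Reasoning
    e = D + T
    e≢0 : NonZero e
    e≢0 = >-nonZero (≤-trans (>-nonZero⁻¹ D) (m≤m+n D T))
    Σ = S T X
    x = X (suc T)
    step : e * suc e * x ≤ Y
    step = ≤-trans (*-monoˡ-≤ x (*-monoˡ-≤ (suc e) (n≤1+n e))) (subst (λ z → z * z * x ≤ Y) (+-suc D T) (h T))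

  bigContent : ℕ → ℕ → GI → ℕ
  bigContent n D m = bit (inB n m) * bit (D <ᵇ content m)

  content≤N : ∀ a b → ¬ ((ℤ.∣ a ∣ ≡ᵇ 0) ∧ (ℤ.∣ b ∣ ≡ᵇ 0) ≡ true) → content (a , b) ≤ N (a , b)
  content≤N a b nz = go ℤ.∣ a ∣ ℤ.∣ b ∣ nz
    where
    go : ∀ i j → ¬ ((i ≡ᵇ 0) ∧ (j ≡ᵇ 0) ≡ true) → gcd i j ≤ i * i + j * j
    go zero    zero    nz = contradiction refl nz
    go zero    (suc j) nz = ≤-trans (∣⇒≤ (gcd[m,n]∣n 0 (suc j))) (m≤m*n (suc j) (suc j))
    go (suc i) j       nz = ≤-trans (∣⇒≤ (gcd[m,n]∣m (suc i) j)) (≤-trans (m≤m*n (suc i) (suc i)) (m≤m+n _ _))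

  -- The single term i = content m - D suffices: D + i is then the content itself. This i is at most
  -- n because the content of a nonzero point is at most its norm.
  bigContent-union : ∀ n D m → bigContent n D m ≤ S n (λ i → bit (inB n m) * dv (D + i) (content m))
  bigContent-union n D m@(a , b) with bool-cases (inB n m)
  ... | inj₂ e = ≤-trans (≤-reflexive (cong (_* bit (D <ᵇ content m)) (bit≡0 e))) z≤n
  ... | inj₁ e with bool-cases (D <ᵇ content m)
  ...   | inj₂ f = ≤-trans (≤-reflexive (trans (cong (bit (inB n m) *_) (bit≡0 f)) (*-zeroʳ (bit (inB n m))))) z≤n
  ...   | inj₁ f = ≤-trans (≤-reflexive (cong (bit (inB n m) *_) (trans (bit≡1 f) (sym (dv-yes (∣-reflexive (m+[n∸m]≡n (<⇒≤ D<g))))))))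
          (term≤S n (λ i → bit (inB n m) * dv (D + i) (content m)) (content m ∸ D) (m<n⇒0<n∸m D<g) (≤-trans (m∸n≤m (content m) D) g≤n))
    where
    D<g : D < content m
    D<g = <ᵇ⇒< D (content m) (subst T (sym f) _)
    split : ∀ x y → not x ∧ y ≡ true → ¬ (x ≡ true) × y ≡ true
    split false true _ = (λ ()) , refl
    g≤n : content m ≤ n
    g≤n with split (isZeroB m) (N m ≤ᵇ n) e
    ... | nz , le = ≤-trans (content≤N a b (λ z → nz (trans (isZeroB-abs a b) z))) (≤ᵇ-elim le)

  -- The union bound adds up 9 |I_n| / (D + i)² for i ≤ n. After `telescope`, D + n ≥ n lets the
  -- factor n be cancelled, which leaves 9 |I_n| / D; hence the separate case n = 0, where the union
  -- is empty.
  bigContent-bound : ∀ n D .{{_ : NonZero D}} → D * sumL (bigContent n D) (square n) ≤ 9 * C₁ n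
  bigContent-bound zero D = ≤-trans (≤-trans (*-monoʳ-≤ D (sumL-mono (bigContent-union 0 D) (square 0))) (≤-reflexive (*-zeroʳ D))) z≤n
  bigContent-bound n@(suc n-1) D = *-cancelˡ-≤ n (begin
    n * (D * sumL (bigContent n D) (square n))       ≤⟨ *-monoʳ-≤ n (*-monoʳ-≤ D union) ⟩
    n * (D * Σ)                               ≤⟨ *-monoˡ-≤ (D * Σ) (m≤n+m n D) ⟩
    (D + n) * (D * Σ)                         ≡⟨ solve 3 (λ a b c → a :* (b :* c) := b :* a :* c) refl (D + n) D Σ ⟩
    D * (D + n) * Σ                           ≤⟨ telescope (λ i → C n (D + i)) (9 * C₁ n) D (λ i → C-upper n (D + suc i) {{D+i≢0 i}}) n ⟩
    9 * C₁ n * n                              ≡⟨ *-comm (9 * C₁ n) n ⟩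
    n * (9 * C₁ n)                            ∎)
    where
    open ≤-Reasoning
    Σ = S n (λ i → C n (D + i))
    D+i≢0 : ∀ i → NonZero (D + suc i)
    D+i≢0 i = >-nonZero (≤-trans (s≤s z≤n) (m≤n+m (suc i) D))
    union : sumL (bigContent n D) (square n) ≤ Σ
    union = ≤-trans (sumL-mono (bigContent-union n D) (square n))
      (≤-reflexive (sumL-S (λ m i → bit (inB n m) * dv (D + i) (content m)) n (square n)))

-- Ternary digits of exponents.

module Valuations where

  open import Data.Bool using (Bool; true; _∧_)
  open import Data.Bool.Properties using (∧-zeroʳ)
  open import Data.Nat
  open import Data.Nat.Properties
  open import Data.Nat.DivMod
  open import Data.Nat.Divisibility
  open import Data.Nat.Induction using (<-rec)
  open import Data.Nat.Primality using (Prime; prime⇒nonZero; prime⇒nonTrivial; prime⇒irreducible; euclidsLemma)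
  open import Data.Nat.Primality.Factorisation using (factorise; module PrimeFactorisation)
  open import Data.Nat.Solver using (module +-*-Solver)
  open +-*-Solver using (solve; _:=_; _:+_; _:*_; con)
  open import Data.List using ([]; _∷_)
  open import Data.Nat.ListAction using (product)
  open import Data.List.Relation.Unary.All using (All; []; _∷_)
  open import Data.Product using (_×_; _,_; ∃; ∃₂; proj₂)
  open import Data.Sum using (inj₁; inj₂)
  open import Function using (_∘_)
  open import Relation.Nullary using (¬_; yes; no; contradiction)
  open import Relation.Binary.PropositionalEquality

  -- no2 M v: v < 3^M and no ternary digit of v is 2.
  no2 : ℕ → ℕ → Bool
  no2 zero    v = v ≡ᵇ 0
  no2 (suc M) v = (v % 3 <ᵇ 2) ∧ no2 M (v / 3)

  module _ (q : ℕ) {r : ℕ} (r<3 : r < 3) where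
    [r+3q]%3 : (r + q * 3) % 3 ≡ r
    [r+3q]%3 = trans ([m+kn]%n≡m%n r q 3) (m<n⇒m%n≡m r<3)

    [r+3q]/3 : (r + q * 3) / 3 ≡ q
    [r+3q]/3 = trans (+-distrib-/-∣ʳ r (n∣m*n q)) (cong₂ _+_ (m<n⇒m/n≡0 r<3) (m*n/n≡m q 3))

    no2-digit : ∀ M → no2 (suc M) (r + q * 3) ≡ (r <ᵇ 2) ∧ no2 M q
    no2-digit M = cong₂ (λ a b → (a <ᵇ 2) ∧ no2 M b) [r+3q]%3 [r+3q]/3

  data Ternary : ℕ → Set where
    digit : ∀ q r → r < 3 → Ternary (r + q * 3)

  ternary : ∀ v → Ternary v
  ternary v = subst Ternary (sym (m≡m%n+[m/n]*n v 3)) (digit (v / 3) (v % 3) (m%n<n v 3))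

  q<3^M : ∀ M q r → r + q * 3 < 3 ^ suc M → q < 3 ^ M
  q<3^M M q r lt = *-cancelʳ-< 3 q (3 ^ M) (<-≤-trans (≤-<-trans (m≤n+m (q * 3) r) lt) (≤-reflexive (*-comm 3 (3 ^ M))))

  no2-stable-suc : ∀ M v → v < 3 ^ M → no2 M v ≡ no2 (suc M) v
  no2-stable-suc zero    zero    _ = refl
  no2-stable-suc zero    (suc v) (s≤s ())
  no2-stable-suc (suc M) v lt with ternary v
  ... | digit q r r<3 = trans (no2-digit q r<3 M) (trans (cong ((r <ᵇ 2) ∧_) (no2-stable-suc M q (q<3^M M q r lt))) (sym (no2-digit q r<3 (suc M))))

  no2-stable : ∀ k M v → v < 3 ^ M → no2 M v ≡ no2 (k + M) v
  no2-stable zero    M v lt = refl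
  no2-stable (suc k) M v lt = trans (no2-stable k M v lt) (no2-stable-suc (k + M) v (<-≤-trans lt (^-monoʳ-≤ 3 (m≤n+m M k))))

  n<p^n : ∀ {p} → 1 < p → ∀ n → n < p ^ n
  n<p^n 1<p zero    = s≤s z≤n
  n<p^n {p} 1<p (suc n) = ≤-<-trans (n<p^n 1<p n) (subst (p ^ n <_) (*-comm (p ^ n) p)
    (m<m*n (p ^ n) p {{m^n≢0 p n {{>-nonZero (<-trans (s≤s z≤n) 1<p)}}}} 1<p))

  n<3^n : ∀ n → n < 3 ^ n
  n<3^n = n<p^n (s≤s (s≤s z≤n))

  -- v serves as its own digit bound since v < 3^v; by `no2≡Q` every sufficient bound gives the same
  -- answer.
  Q : ℕ → Set
  Q v = no2 v v ≡ true

  no2≡Q : ∀ M v → v < 3 ^ M → no2 M v ≡ no2 v v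
  no2≡Q M v lt = trans (no2-stable v M v lt) (trans (cong (λ z → no2 z v) (+-comm v M)) (sym (no2-stable M v v (n<3^n v))))

  ∧-split : ∀ {a b} → a ∧ b ≡ true → a ≡ true × b ≡ true
  ∧-split {true} {true} _ = refl , refl

  -- Adding two numbers with digits 0, 1 produces no carry, so the terms of a progression agree digit by digit.
  no2-AP-trivial : ∀ M x y z → no2 M x ≡ true → no2 M y ≡ true → no2 M z ≡ true → x + z ≡ y + y → x ≡ y
  no2-AP-trivial zero zero zero z _ _ _ _ = refl
  no2-AP-trivial (suc M) x y z nx ny nz eq with ternary x | ternary y | ternary z
  ... | digit p a a<3 | digit q b b<3 | digit r c c<3
    with ∧-split (trans (sym (no2-digit p a<3 M)) nx) | ∧-split (trans (sym (no2-digit q b<3 M)) ny) | ∧-split (trans (sym (no2-digit r c<3 M)) nz)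
  ... | a<2 , np | b<2 , nq | c<2 , nr =
    cong₂ (λ a p → a + p * 3) (low a b c a<2 b<2 c<2 (trans (sym ([r+3q]%3 (p + r) a+c<3)) (trans (cong (_% 3) eq′) ([r+3q]%3 (q + q) b+b<3))))
      (no2-AP-trivial M p q r np nq nr (trans (sym ([r+3q]/3 (p + r) a+c<3)) (trans (cong (_/ 3) eq′) ([r+3q]/3 (q + q) b+b<3))))
    where
    regroup : ∀ a p c r → (a + p * 3) + (c + r * 3) ≡ (a + c) + (p + r) * 3
    regroup = solve 4 (λ a p c r → (a :+ p :* con 3) :+ (c :+ r :* con 3) := (a :+ c) :+ (p :+ r) :* con 3) refl
    eq′ : (a + c) + (p + r) * 3 ≡ (b + b) + (q + q) * 3
    eq′ = trans (sym (regroup a p c r)) (trans eq (regroup b q b q))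
    sum<3 : ∀ a c → (a <ᵇ 2) ≡ true → (c <ᵇ 2) ≡ true → a + c < 3
    sum<3 0 0 _ _ = s≤s z≤n
    sum<3 0 1 _ _ = s≤s (s≤s z≤n)
    sum<3 1 0 _ _ = s≤s (s≤s z≤n)
    sum<3 1 1 _ _ = s≤s (s≤s (s≤s z≤n))
    a+c<3 = sum<3 a c a<2 c<2
    b+b<3 = sum<3 b b b<2 b<2
    low : ∀ a b c → (a <ᵇ 2) ≡ true → (b <ᵇ 2) ≡ true → (c <ᵇ 2) ≡ true → a + c ≡ b + b → a ≡ b
    low 0 0 _ _ _ _ _  = refl
    low 0 1 0 _ _ _ ()
    low 0 1 1 _ _ _ ()
    low 1 0 0 _ _ _ ()
    low 1 0 1 _ _ _ ()
    low 1 1 _ _ _ _ _  = refl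

  Q-AP-trivial : ∀ a f → Q a → Q (a + f) → Q (a + (f + f)) → f ≡ 0
  Q-AP-trivial a f qa qaf qaff = sym (+-cancelˡ-≡ a 0 f (trans (+-identityʳ a) (no2-AP-trivial M a (a + f) (a + (f + f))
      (lift a (m≤m+n a _) qa) (lift (a + f) (+-monoʳ-≤ a (m≤m+n f f)) qaf) (lift M ≤-refl qaff)
      (solve 2 (λ a f → a :+ (a :+ (f :+ f)) := (a :+ f) :+ (a :+ f)) refl a f))))
    where
    M = a + (f + f)
    lift : ∀ x → x ≤ M → Q x → no2 M x ≡ true
    lift x le qx = trans (no2≡Q M x (≤-<-trans le (n<3^n M))) qx

  -- f has the digit 1 exactly where v has the digit 2.
  no2-decompose : ∀ M v → v < 3 ^ M → ∃₂ λ u f → v ≡ u + (f + f) × no2 M u ≡ true × no2 M (u + f) ≡ true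
  no2-decompose zero zero _ = 0 , 0 , refl , refl , refl
  no2-decompose zero (suc v) (s≤s ())
  no2-decompose (suc M) v lt with ternary v
  ... | digit q r r<3 with no2-decompose M q (q<3^M M q r lt)
  ...   | u , f , eq , nu , nuf = go r r<3
    where
    go : ∀ r → r < 3 → ∃₂ λ u f → r + q * 3 ≡ u + (f + f) × no2 (suc M) u ≡ true × no2 (suc M) (u + f) ≡ true
    go 0 r<3 = u * 3 , f * 3 ,
      trans (cong (_* 3) eq) (solve 2 (λ u f → (u :+ (f :+ f)) :* con 3 := u :* con 3 :+ (f :* con 3 :+ f :* con 3)) refl u f) ,
      trans (no2-digit u {0} r<3 M) nu ,
      trans (cong (no2 (suc M)) (sym (*-distribʳ-+ 3 u f))) (trans (no2-digit (u + f) {0} r<3 M) nuf)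
    go 1 r<3 = 1 + u * 3 , f * 3 ,
      trans (cong (λ z → 1 + z * 3) eq) (solve 2 (λ u f → con 1 :+ (u :+ (f :+ f)) :* con 3 := con 1 :+ u :* con 3 :+ (f :* con 3 :+ f :* con 3)) refl u f) ,
      trans (no2-digit u r<3 M) nu ,
      trans (cong (no2 (suc M) ∘ suc) (sym (*-distribʳ-+ 3 u f))) (trans (no2-digit (u + f) r<3 M) nuf)
    go 2 r<3 = u * 3 , 1 + f * 3 ,
      trans (cong (λ z → 2 + z * 3) eq) (solve 2 (λ u f → con 2 :+ (u :+ (f :+ f)) :* con 3 := u :* con 3 :+ ((con 1 :+ f :* con 3) :+ (con 1 :+ f :* con 3))) refl u f) ,
      trans (no2-digit u {0} (s≤s z≤n) M) nu ,
      trans (cong (no2 (suc M)) (solve 2 (λ u f → u :* con 3 :+ (con 1 :+ f :* con 3) := con 1 :+ (u :+ f) :* con 3) refl u f))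
        (trans (no2-digit (u + f) {1} (s≤s (s≤s z≤n)) M) nuf)
    go (suc (suc (suc r))) (s≤s (s≤s (s≤s ())))

  Q-decompose : ∀ v → ∃₂ λ u f → v ≡ u + (f + f) × Q u × Q (u + f)
  Q-decompose v with no2-decompose v v (n<3^n v)
  ... | u , f , eq , nu , nuf = u , f , eq ,
    trans (sym (no2≡Q v u (lt (≤-trans (m≤m+n u (f + f)) (≤-reflexive (sym eq)))))) nu ,
    trans (sym (no2≡Q v (u + f) (lt (≤-trans (+-monoʳ-≤ u (m≤m+n f f)) (≤-reflexive (sym eq)))))) nuf
    where
    lt : ∀ {x} → x ≤ v → x < 3 ^ v
    lt le = ≤-<-trans le (n<3^n v)

  no2-support : ∀ M v → no2 M v ≡ true → v < 3 ^ M
  no2-support zero    zero _ = s≤s z≤n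
  no2-support (suc M) v    h with ternary v
  ... | digit q r r<3 = begin-strict
    r + q * 3   <⟨ +-monoˡ-< (q * 3) r<3 ⟩
    suc q * 3     ≤⟨ *-monoˡ-≤ 3 (no2-support M q (proj₂ (∧-split {r <ᵇ 2} (trans (sym (no2-digit q r<3 M)) h)))) ⟩
    3 ^ M * 3     ≡⟨ *-comm (3 ^ M) 3 ⟩
    3 ^ suc M       ∎
    where open ≤-Reasoning

  -- For w < 3^M the summand 3^M is a top digit 1; for larger w the sum is at least 2 · 3^M and both
  -- sides are false. Together with `no2-stable-suc` this sorts numbers by their top digit, which is
  -- what the factor 1 + x^(-3^M) of f expresses.
  no2-top : ∀ M w → no2 (suc M) (3 ^ M + w) ≡ no2 M w
  no2-top zero 0 = refl
  no2-top zero 1 = refl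
  no2-top zero (suc (suc w)) with ternary w
  ... | digit q r r<3 = trans (cong (no2 1) (solve 2 (λ r q → con 3 :+ (r :+ q :* con 3) := r :+ (con 1 :+ q) :* con 3) refl r q))
         (trans (no2-digit (suc q) r<3 0) (∧-zeroʳ (r <ᵇ 2)))
  no2-top (suc M) w with ternary w
  ... | digit q r r<3 = trans (cong (no2 (suc (suc M))) (solve 3 (λ t r q → con 3 :* t :+ (r :+ q :* con 3) := r :+ (t :+ q) :* con 3) refl (3 ^ M) r q))
         (trans (no2-digit (3 ^ M + q) r<3 (suc M)) (trans (cong ((r <ᵇ 2) ∧_) (no2-top M q)) (sym (no2-digit q r<3 M))))

  -- Prime valuations and the good contents.

  ^-distrib-* : ∀ m n o → (m * n) ^ o ≡ m ^ o * n ^ o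
  ^-distrib-* m n zero    = refl
  ^-distrib-* m n (suc o) = trans (cong (m * n *_) (^-distrib-* m n o))
    (solve 4 (λ a b c d → (a :* b) :* (c :* d) := (a :* c) :* (b :* d)) refl m n (m ^ o) (n ^ o))

  prime>1 : ∀ {p} → Prime p → 1 < p
  prime>1 {p} pr = nonTrivial⇒n>1 p {{prime⇒nonTrivial pr}}

  prime∣prime : ∀ {p q} → Prime p → Prime q → q ∣ p → q ≡ p
  prime∣prime pp pq q∣p with prime⇒irreducible pp q∣p
  ... | inj₁ refl = contradiction (prime>1 pq) (<-irrefl refl)
  ... | inj₂ eq   = eq

  prime∤1 : ∀ {p} → Prime p → ¬ p ∣ 1
  prime∤1 pp p∣1 = contradiction (subst (1 <_) (∣1⇒≡1 p∣1) (prime>1 pp)) (<-irrefl refl)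

  prime∣^ : ∀ {p q} → Prime p → Prime q → ∀ a → q ∣ p ^ a → q ≡ p
  prime∣^ pp pq zero    d = contradiction d (prime∤1 pq)
  prime∣^ {p} pp pq (suc a) d with euclidsLemma p (p ^ a) pq d
  ... | inj₁ q∣p  = prime∣prime pp pq q∣p
  ... | inj₂ q∣pᵃ = prime∣^ pp pq a q∣pᵃ

  ∤-* : ∀ {p x y} → Prime p → ¬ p ∣ x → ¬ p ∣ y → ¬ p ∣ x * y
  ∤-* {p} {x} {y} pp nx ny d with euclidsLemma x y pp d
  ... | inj₁ e = nx e
  ... | inj₂ e = ny e

  prime-divisor : ∀ n → 1 < n → ∃ λ p → Prime p × p ∣ n
  prime-divisor n@(suc _) 1<n = go (factors f) (isFactorisation f) (factorsPrime f)
    where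
    open PrimeFactorisation
    f = factorise n
    go : ∀ ps → n ≡ product ps → All Prime ps → ∃ λ p → Prime p × p ∣ n
    go []       eq _         = contradiction (subst (1 <_) eq 1<n) (<-irrefl refl)
    go (p ∷ ps) eq (pp ∷ _) = p , pp , divides (product ps) (trans eq (*-comm p _))

  record Val (p g v x : ℕ) : Set where
    constructor mkVal
    field
      factor : g ≡ p ^ v * x
      cofree : ¬ p ∣ x

  module _ {p : ℕ} (1<p : 1 < p) where
    private instance
      p≢0 : NonZero p
      p≢0 = >-nonZero (<-trans (s≤s z≤n) 1<p)

    valuation : ∀ g .{{_ : NonZero g}} → ∃₂ λ v x → Val p g v x
    valuation g = <-rec (λ g → .{{_ : NonZero g}} → ∃₂ λ v x → Val p g v x) step g
      where
      step : ∀ g → (∀ {h} → h < g → .{{_ : NonZero h}} → ∃₂ λ v x → Val p h v x) → .{{_ : NonZero g}} → ∃₂ λ v x → Val p g v x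
      step g rec with p ∣? g
      ... | no ¬d = 0 , g , mkVal (sym (*-identityˡ g)) ¬d
      ... | yes (divides h eq) with rec (subst (h <_) (sym eq) (m<m*n h p {{h≢0}} 1<p)) {{h≢0}}
        where
        h≢0 : NonZero h
        h≢0 = ≢-nonZero (λ { refl → ≢-nonZero⁻¹ g eq })
      ...   | v , x , mkVal e f = suc v , x , mkVal (trans eq (trans (*-comm h p) (trans (cong (p *_) e) (sym (*-assoc p (p ^ v) x))))) f

    val-unique : ∀ {g v x w y} → Val p g v x → Val p g w y → v ≡ w
    val-unique {v = v} {x} {w} {y} (mkVal e f) (mkVal e′ nonzeroTerm) = go v w (trans (sym e) e′)
      where
      go : ∀ v w → p ^ v * x ≡ p ^ w * y → v ≡ w
      go zero    zero    _  = refl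
      go zero    (suc w) eq = contradiction (subst (p ∣_) (trans (sym eq) (*-identityˡ x)) (∣m⇒∣m*n y (m∣m*n (p ^ w)))) f
      go (suc v) zero    eq = contradiction (subst (p ∣_) (trans eq (*-identityˡ y)) (∣m⇒∣m*n x (m∣m*n (p ^ v)))) nonzeroTerm
      go (suc v) (suc w) eq = cong suc (go v w (*-cancelˡ-≡ _ _ p (trans (sym (*-assoc p (p ^ v) x)) (trans eq (*-assoc p (p ^ w) y)))))

    val-nonZero : ∀ {g v x} .{{_ : NonZero g}} → Val p g v x → NonZero x
    val-nonZero {g} {v} (mkVal e _) = ≢-nonZero (λ { refl → ≢-nonZero⁻¹ g (trans e (*-zeroʳ (p ^ v))) })

    val-positive : ∀ {g v x} → Val p g v x → p ∣ g → NonZero v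
    val-positive {v = zero} {x} (mkVal e f) d = contradiction (subst (p ∣_) (trans e (*-identityˡ x)) d) f
    val-positive {v = suc v} _ _ = _

  val-* : ∀ {p g h v w x y} → Prime p → Val p g v x → Val p h w y → Val p (g * h) (v + w) (x * y)
  val-* {p} {v = v} {w} {x} {y} pp (mkVal e f) (mkVal e′ nonzeroTerm) = mkVal (trans (cong₂ _*_ e e′) (trans
    (solve 4 (λ a b c d → (a :* b) :* (c :* d) := (a :* c) :* (b :* d)) refl (p ^ v) x (p ^ w) y)
    (cong (_* (x * y)) (sym (^-distribˡ-+-* p v w))))) (∤-* pp f nonzeroTerm)

  G : ℕ → Set
  G g = ∀ p v x → Prime p → Val p g v x → Q v

  G-1 : G 1
  G-1 p v x pp val = subst Q (val-unique (prime>1 pp) {v = 0} (mkVal refl (prime∤1 pp)) val) refl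

  G-* : ∀ {p a x} .{{_ : NonZero x}} → Prime p → ¬ p ∣ x → Q a → G x → G (p ^ a * x)
  G-* {p} {a} {x} pp p∤x qa gx q w y pq val with q ≟ p
  ... | yes refl = subst Q (val-unique (prime>1 pq) {v = a} (mkVal refl p∤x) val) qa
  ... | no q≢p with valuation (prime>1 pq) x
  ...   | v , z , vx@(mkVal e f) = subst Q (val-unique (prime>1 pq) {v = v} (mkVal
            (trans (cong (p ^ a *_) e) (solve 3 (λ a b c → a :* (b :* c) := b :* (a :* c)) refl (p ^ a) (q ^ v) z))
            (∤-* pq (q≢p ∘ prime∣^ pp pq a) f)) val) (gx q v z pq vx)

  -- `Q-decompose` for all primes at once: strip the full power p^v from g, decompose the smaller
  -- cofactor as u r² by strong induction, then put p^a into u and p^f into r, where v = a + 2f.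
  -- Both u and r are prime to p because u r² is, so the exponent of p in the new u r is a + f.
  G-decompose : ∀ g .{{_ : NonZero g}} → ∃₂ λ u r → g ≡ u * (r * r) × G u × G (u * r)
  G-decompose g = <-rec (λ g → .{{_ : NonZero g}} → ∃₂ λ u r → g ≡ u * (r * r) × G u × G (u * r)) step g
    where
    step : ∀ g → (∀ {h} → h < g → .{{_ : NonZero h}} → ∃₂ λ u r → h ≡ u * (r * r) × G u × G (u * r)) →
      .{{_ : NonZero g}} → ∃₂ λ u r → g ≡ u * (r * r) × G u × G (u * r)
    step 1 rec = 1 , 1 , refl , G-1 , G-1
    step g@(suc (suc _)) rec with prime-divisor g (s≤s (s≤s z≤n))
    ... | p , pp , p∣g with valuation (prime>1 pp) g
    ...   | v , x , val@(mkVal e p∤x) with rec (x<g v e (val-positive (prime>1 pp) val p∣g)) {{x≢0}} | Q-decompose v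
      where
      x≢0 : NonZero x
      x≢0 = val-nonZero (prime>1 pp) {v = v} val
      x<g : ∀ v → g ≡ p ^ v * x → NonZero v → x < g
      x<g (suc v) e _ = <-≤-trans (subst (x <_) (*-comm x p) (m<m*n x p {{x≢0}} (prime>1 pp))) (≤-trans (m≤m*n (p * x) (p ^ v) {{m^n≢0 p v {{prime⇒nonZero pp}}}})
        (≤-reflexive (trans (solve 3 (λ p x t → p :* x :* t := (p :* t) :* x) refl p x (p ^ v)) (sym e))))
    ...     | u , r , eq , gu , gur | a , f , veq , qa , qaf = p ^ a * u , p ^ f * r , geq ,
        G-* {a = a} {{u≢0}} pp p∤u qa gu ,
        subst G ureq (G-* {a = a + f} {{m*n≢0 u r {{u≢0}} {{r≢0}}}} pp (∤-* pp p∤u p∤r) qaf gur)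
      where
      p∤u : ¬ p ∣ u
      p∤u d = p∤x (subst (p ∣_) (sym eq) (∣m⇒∣m*n (r * r) d))
      p∤r : ¬ p ∣ r
      p∤r d = p∤x (subst (p ∣_) (sym eq) (∣n⇒∣m*n u (∣m⇒∣m*n r d)))
      u≢0 : NonZero u
      u≢0 = ≢-nonZero (λ { refl → p∤u (p ∣0) })
      r≢0 : NonZero r
      r≢0 = ≢-nonZero (λ { refl → p∤r (p ∣0) })
      ureq : p ^ (a + f) * (u * r) ≡ (p ^ a * u) * (p ^ f * r)
      ureq = trans (cong (_* (u * r)) (^-distribˡ-+-* p a f))
        (solve 4 (λ a f u r → (a :* f) :* (u :* r) := (a :* u) :* (f :* r)) refl (p ^ a) (p ^ f) u r)
      geq : g ≡ (p ^ a * u) * ((p ^ f * r) * (p ^ f * r))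
      geq = begin
        g                                          ≡⟨ e ⟩
        p ^ v * x                                  ≡⟨ cong₂ (λ v x → p ^ v * x) veq eq ⟩
        p ^ (a + (f + f)) * (u * (r * r))          ≡⟨ cong (_* (u * (r * r))) (trans (^-distribˡ-+-* p a (f + f)) (cong (p ^ a *_) (^-distribˡ-+-* p f f))) ⟩
        p ^ a * (p ^ f * p ^ f) * (u * (r * r))    ≡⟨ solve 4 (λ a f u r → a :* (f :* f) :* (u :* (r :* r)) := (a :* u) :* ((f :* r) :* (f :* r))) refl (p ^ a) (p ^ f) u r ⟩
        (p ^ a * u) * ((p ^ f * r) * (p ^ f * r))  ∎
        where open ≡-Reasoning

  -- At a prime p dividing r the exponents of the three terms are a, a + f, a + 2f with f ≥ 1, which
  -- `Q-AP-trivial` rules out.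
  G-no-GP : ∀ u r .{{_ : NonZero u}} → 1 < r → G u → G (u * r) → ¬ G (u * r * r)
  G-no-GP u r 1<r gu gur gurr with prime-divisor r 1<r
  ... | p , pp , p∣r with valuation (prime>1 pp) u | valuation (prime>1 pp) r {{>-nonZero (<-trans (s≤s z≤n) 1<r)}}
  ...   | a , x , vu | f , y , vr = ≢-nonZero⁻¹ f {{val-positive (prime>1 pp) vr p∣r}} (Q-AP-trivial a f (gu p a x pp vu)
          (gur p (a + f) (x * y) pp (val-* pp vu vr))
          (subst Q (+-assoc a f f) (gurr p (a + f + f) (x * y * y) pp (val-* pp (val-* pp vu vr) vr))))

-- The greedy set described by contents.

module GreedySet where

  open LatticeCounting using (content)
  open Valuations
  open import Data.Bool using (Bool; true)
  open import Data.Nat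
  open import Data.Nat.Properties
  open import Data.Nat.GCD using (gcd; gcd[m,n]∣m; gcd[m,n]∣n; c*gcd[m,n]≡gcd[cm,cn]; gcd[m,n]≡0⇒m≡0; gcd[m,n]≡0⇒n≡0)
  open import Data.Nat.Induction using (<-rec)
  open import Data.Nat.Solver using (module +-*-Solver)
  open +-*-Solver using (solve; _:=_; _:+_; _:*_)
  open import Data.Integer as ℤ using (ℤ)
  import Data.Integer.Properties as ℤP
  import Data.Integer.Divisibility.Signed as ℤD
  open import Data.Product using (_×_; _,_; ∃; ∃₂; proj₁; proj₂)
  open import Data.Sum using (inj₁; inj₂)
  open import Function.Bundles using (module Equivalence)
  open import Relation.Nullary using (¬_; contradiction)
  open import Relation.Binary.PropositionalEquality

  content-· : ∀ m r → content (m · r) ≡ content m * ℤ.∣ r ∣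
  content-· (a , b) r = begin
    gcd ℤ.∣ a ℤ.* r ∣ ℤ.∣ b ℤ.* r ∣                     ≡⟨ cong₂ gcd (eq a) (eq b) ⟩
    gcd (ℤ.∣ r ∣ * ℤ.∣ a ∣) (ℤ.∣ r ∣ * ℤ.∣ b ∣)         ≡⟨ sym (c*gcd[m,n]≡gcd[cm,cn] ℤ.∣ r ∣ ℤ.∣ a ∣ ℤ.∣ b ∣) ⟩
    ℤ.∣ r ∣ * gcd ℤ.∣ a ∣ ℤ.∣ b ∣                       ≡⟨ *-comm ℤ.∣ r ∣ _ ⟩
    gcd ℤ.∣ a ∣ ℤ.∣ b ∣ * ℤ.∣ r ∣                       ∎
    where
    open ≡-Reasoning
    eq : ∀ a → ℤ.∣ a ℤ.* r ∣ ≡ ℤ.∣ r ∣ * ℤ.∣ a ∣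
    eq a = trans (ℤP.abs-* a r) (*-comm ℤ.∣ a ∣ ℤ.∣ r ∣)

  content≢0 : ∀ {m} → ¬ (m ≡ zeroGI) → NonZero (content m)
  content≢0 {a , b} nz = ≢-nonZero (λ eq → nz (cong₂ _,_
    (ℤP.∣i∣≡0⇒i≡0 (gcd[m,n]≡0⇒m≡0 eq)) (ℤP.∣i∣≡0⇒i≡0 (gcd[m,n]≡0⇒n≡0 ℤ.∣ a ∣ eq))))

  N-· : ∀ m r → N (m · r) ≡ N m * (ℤ.∣ r ∣ * ℤ.∣ r ∣)
  N-· (a , b) r = trans (cong₂ (λ x y → x * x + y * y) (ℤP.abs-* a r) (ℤP.abs-* b r))
    (solve 3 (λ a b r → (a :* r) :* (a :* r) :+ (b :* r) :* (b :* r) := (a :* a :+ b :* b) :* (r :* r)) refl ℤ.∣ a ∣ ℤ.∣ b ∣ ℤ.∣ r ∣)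

  N≢0 : ∀ {m} → ¬ (m ≡ zeroGI) → NonZero (N m)
  N≢0 {a , b} nz = ≢-nonZero (λ eq → nz (cong₂ _,_ (sq a (m+n≡0⇒m≡0 _ eq)) (sq b (m+n≡0⇒n≡0 (ℤ.∣ a ∣ * ℤ.∣ a ∣) eq))))
    where
    sq : ∀ a → ℤ.∣ a ∣ * ℤ.∣ a ∣ ≡ 0 → a ≡ ℤ.+ 0
    sq a eq with m*n≡0⇒m≡0∨n≡0 ℤ.∣ a ∣ eq
    ... | inj₁ e = ℤP.∣i∣≡0⇒i≡0 e
    ... | inj₂ e = ℤP.∣i∣≡0⇒i≡0 e

  -- The norm is multiplied by r² ≥ 4. So the terms of one progression never tie, and the arbitrary
  -- order among equal norms does no harm.
  N-grows : ∀ {m r} → ¬ (m ≡ zeroGI) → 2 ≤ ℤ.∣ r ∣ → N m < N (m · r)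
  N-grows {m} {r} nz 2≤r = subst (N m <_) (sym (N-· m r)) (m<m*n (N m) (ℤ.∣ r ∣ * ℤ.∣ r ∣) {{N≢0 nz}} (≤-trans (s≤s (s≤s z≤n)) (*-mono-≤ 2≤r 2≤r)))

  ·-nonzero : ∀ {m r} → ¬ (m ≡ zeroGI) → 2 ≤ ℤ.∣ r ∣ → ¬ (m · r ≡ zeroGI)
  ·-nonzero {m} {r} nz 2≤r eq = n≮0 (subst (N m <_) (cong N eq) (N-grows {m} {r} nz 2≤r))

  ·-· : ∀ m r r' → (m · r) · r' ≡ m · (r ℤ.* r')
  ·-· (a , b) r r' = cong₂ _,_ (ℤP.*-assoc a r r') (ℤP.*-assoc b r r')

  primitive-part : ∀ m → ∃ λ n → m ≡ n · (ℤ.+ content m)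
  primitive-part m@(a , b) with ℤD.∣ᵤ⇒∣ {ℤ.+ content m} {a} (gcd[m,n]∣m ℤ.∣ a ∣ ℤ.∣ b ∣) | ℤD.∣ᵤ⇒∣ {ℤ.+ content m} {b} (gcd[m,n]∣n ℤ.∣ a ∣ ℤ.∣ b ∣)
  ... | ℤD.divides x ea | ℤD.divides y eb = (x , y) , cong₂ _,_ ea eb

  -- n is u times the primitive part of m. That part has content 1, as seen by cancelling the
  -- nonzero content of m.
  content-split : ∀ m u r → ¬ (m ≡ zeroGI) → content m ≡ u * (r * r) → ∃ λ n → m ≡ (n · (ℤ.+ r)) · (ℤ.+ r) × content n ≡ u
  content-split m u r nz eq with primitive-part m
  ... | n , m≡ = n · (ℤ.+ u) , trans m≡ (trans (cong (n ·_) ceq) (sym (trans (·-· (n · (ℤ.+ u)) (ℤ.+ r) (ℤ.+ r)) (·-· n (ℤ.+ u) (ℤ.+ r ℤ.* ℤ.+ r))))) ,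
    trans (content-· n (ℤ.+ u)) (trans (cong (_* u) content-n) (*-identityˡ u))
    where
    ceq : ℤ.+ content m ≡ ℤ.+ u ℤ.* (ℤ.+ r ℤ.* ℤ.+ r)
    ceq = trans (cong ℤ.+_ eq) (trans (ℤP.pos-* u (r * r)) (cong (ℤ.+ u ℤ.*_) (ℤP.pos-* r r)))
    content-n : content n ≡ 1
    content-n = *-cancelʳ-≡ (content n) 1 (content m) {{content≢0 nz}}
      (trans (sym (content-· n (ℤ.+ content m))) (trans (cong content (sym m≡)) (sym (*-identityˡ (content m)))))

  module Greedy {e : ℕ → GI} (ord : NormOrder e) {A : GI → Bool} (greedy : IsGreedy e A) where
    open NormOrder ord
    open IsGreedy greedy

    N<⇒index< : ∀ {i k} → N (e i) < N (e k) → i < k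
    N<⇒index< {i} {k} lt = ≰⇒> (λ k≤i → <⇒≱ lt (monotone k i k≤i))

    Char : ℕ → Set
    Char k = (A (e k) ≡ true → G (content (e k))) × (G (content (e k)) → A (e k) ≡ true)

    divisible⇒excluded : ∀ k → (∀ {i} → i < k → Char i) → ∀ n r → 2 ≤ r → e k ≡ (n · (ℤ.+ r)) · (ℤ.+ r) →
      G (content n) → G (content n * r) → ¬ (A (e k) ≡ true)
    divisible⇒excluded k rec n r 2≤r ek≡ gn gnr Ak = Equivalence.to (step k) Ak (i , j , i<k , j<k ,
        proj₂ (rec i<k) (subst (λ x → G (content x)) (sym ei≡) gn) ,
        proj₂ (rec j<k) (subst (λ x → G (content x)) (sym ej≡) (subst G (sym (content-· n (ℤ.+ r))) gnr)) ,
        n , ℤ.+ r , n≢0 , 2≤r , (inj₁ ei≡ , inj₂ (inj₁ ej≡) , inj₂ (inj₂ ek≡)) , (inj₁ (sym ei≡) , inj₂ (inj₁ (sym ej≡)) , inj₂ (inj₂ (sym ek≡))))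
      where
      n≢0 : ¬ (n ≡ zeroGI)
      n≢0 n≡0 = nonzero k (trans ek≡ (cong (λ x → (x · (ℤ.+ r)) · (ℤ.+ r)) n≡0))
      nr≢0 : ¬ (n · (ℤ.+ r) ≡ zeroGI)
      nr≢0 = ·-nonzero {n} {ℤ.+ r} n≢0 2≤r
      i = proj₁ (onto n n≢0)
      ei≡ = proj₂ (onto n n≢0)
      j = proj₁ (onto (n · (ℤ.+ r)) nr≢0)
      ej≡ = proj₂ (onto (n · (ℤ.+ r)) nr≢0)
      j<k : j < k
      j<k = N<⇒index< (subst₂ (λ x y → N x < N y) (sym ej≡) (sym ek≡) (N-grows {n · (ℤ.+ r)} {ℤ.+ r} nr≢0 2≤r))
      i<k : i < k
      i<k = <-trans (N<⇒index< (subst₂ (λ x y → N x < N y) (sym ei≡) (sym ej≡) (N-grows {n} {ℤ.+ r} n≢0 2≤r))) j<k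

    -- Decompose the content as u r². If r = 1 it equals u, which is good; r ≥ 2 would produce two
    -- earlier elements that exclude `e k`; r = 0 would make the content vanish.
    sound : ∀ k → (∀ {i} → i < k → Char i) → A (e k) ≡ true → G (content (e k))
    sound k rec Ak = let u , r , eq , gu , gur = G-decompose (content (e k)) {{content≢0 (nonzero k)}} in go u r eq gu gur
      where
      go : ∀ u r → content (e k) ≡ u * (r * r) → G u → G (u * r) → G (content (e k))
      go u zero          eq _  _   = contradiction (trans eq (*-zeroʳ u)) (≢-nonZero⁻¹ (content (e k)) {{content≢0 (nonzero k)}})
      go u (suc zero)    eq gu _   = subst G (sym (trans eq (*-identityʳ u))) gu
      go u (suc (suc r)) eq gu gur =
        let n , ek≡ , cn≡u = content-split (e k) u (suc (suc r)) (nonzero k) eq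
        in contradiction Ak (divisible⇒excluded k rec n (suc (suc r)) (s≤s (s≤s z≤n)) ek≡
             (subst G (sym cn≡u) gu) (subst (λ c → G (c * suc (suc r))) (sym cn≡u) gur))

    -- `IsGP3` compares sets and does not say which term is `e k`. As k is the largest index, n r²
    -- has norm at most that of `e k`; so `e k` is neither n nor n r and must be n r². Then n and n
    -- r are earlier members of A, good by induction, and `G-no-GP` applies to the contents.
    complete : ∀ k → (∀ {i} → i < k → Char i) → G (content (e k)) → A (e k) ≡ true
    complete k rec gk = Equivalence.from (step k) impossible
      where
      impossible : ¬ (∃₂ λ i j → i < k × j < k × A (e i) ≡ true × A (e j) ≡ true × IsGP3 (e i) (e j) (e k))
      impossible (i , j , i<k , j<k , Ai , Aj , n , r , n≢0 , 2≤r , (_ , _ , ek∈) , (n∈ , nr∈ , nrr∈)) =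
        G-no-GP (content n) ℤ.∣ r ∣ {{content≢0 n≢0}} 2≤r (good n∈ N<₁₃)
          (subst G (content-· n r) (good nr∈ N<₂₃))
          (subst G (trans (cong content (sym nrr≡ek)) (trans (content-· (n · r) r) (cong (_* ℤ.∣ r ∣) (content-· n r)))) gk)
        where
        N<₁₂ : N n < N (n · r)
        N<₁₂ = N-grows {n} {r} n≢0 2≤r
        N<₂₃ : N (n · r) < N ((n · r) · r)
        N<₂₃ = N-grows {n · r} {r} (·-nonzero {n} {r} n≢0 2≤r) 2≤r
        N<₁₃ : N n < N ((n · r) · r)
        N<₁₃ = <-trans N<₁₂ N<₂₃
        top≤ : In3 ((n · r) · r) (e i) (e j) (e k) → N ((n · r) · r) ≤ N (e k)
        top≤ (inj₁ eq)        = subst (λ x → N x ≤ N (e k)) (sym eq) (monotone i k (<⇒≤ i<k))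
        top≤ (inj₂ (inj₁ eq)) = subst (λ x → N x ≤ N (e k)) (sym eq) (monotone j k (<⇒≤ j<k))
        top≤ (inj₂ (inj₂ eq)) = ≤-reflexive (cong N eq)
        top : In3 (e k) n (n · r) ((n · r) · r) → (n · r) · r ≡ e k
        top (inj₁ eq)        = contradiction (subst (N ((n · r) · r) ≤_) (cong N eq) (top≤ nrr∈)) (<⇒≱ N<₁₃)
        top (inj₂ (inj₁ eq)) = contradiction (subst (N ((n · r) · r) ≤_) (cong N eq) (top≤ nrr∈)) (<⇒≱ N<₂₃)
        top (inj₂ (inj₂ eq)) = sym eq
        nrr≡ek : (n · r) · r ≡ e k
        nrr≡ek = top ek∈
        good : ∀ {x} → In3 x (e i) (e j) (e k) → N x < N ((n · r) · r) → G (content x)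
        good (inj₁ refl)        _  = proj₁ (rec i<k) Ai
        good (inj₂ (inj₁ refl)) _  = proj₁ (rec j<k) Aj
        good (inj₂ (inj₂ refl)) lt = contradiction (≤-reflexive (cong N nrr≡ek)) (<⇒≱ lt)

    char : ∀ k → Char k
    char = <-rec Char (λ k rec → sound k rec , complete k rec)

    A⇒G : ∀ m → ¬ (m ≡ zeroGI) → A m ≡ true → G (content m)
    A⇒G m nz Am with onto m nz
    ... | k , refl = proj₁ (char k) Am

    G⇒A : ∀ m → ¬ (m ≡ zeroGI) → G (content m) → A m ≡ true
    G⇒A m nz g with onto m nz
    ... | k , refl = proj₂ (char k) g

-- The list of primes as a filtered list.

module PrimeLists where

  open import Data.Bool using (true; false)
  open import Data.Nat
  open import Data.Nat.Primality using (prime?)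
  open import Data.List using (List; []; _∷_; upTo; filter; applyUpTo)
  open import Relation.Nullary using (does)
  open import Relation.Binary.PropositionalEquality

  -- The function local to `primesUpTo` has no name outside it, but its defining equations determine
  -- it.
  filter-unique : (f : List ℕ → List ℕ) → f [] ≡ [] →
    (∀ p ps → does (prime? p) ≡ true → f (p ∷ ps) ≡ p ∷ f ps) →
    (∀ p ps → does (prime? p) ≡ false → f (p ∷ ps) ≡ f ps) → ∀ xs → f xs ≡ filter prime? xs
  filter-unique f nil t h [] = nil
  filter-unique f nil t h (x ∷ xs) with does (prime? x) in eq
  ... | true  = trans (t x xs eq) (cong (x ∷_) (filter-unique f nil t h xs))
  ... | false = trans (h x xs eq) (filter-unique f nil t h xs)

  mutual
    -- The local function in the definition of primesUpTo, recovered by unification in primesUpTo≡filter.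
    sieve : ℕ → List ℕ → List ℕ
    sieve = _

    primesUpTo≡filter : ∀ M → primesUpTo M ≡ filter prime? (upTo (suc M))
    primesUpTo≡filter M with applyUpTo suc M
    ... | xs = filter-unique (sieve M) refl (sieve-prime M) (sieve-¬prime M) xs

    sieve-prime : ∀ M p ps → does (prime? p) ≡ true → sieve M (p ∷ ps) ≡ p ∷ sieve M ps
    sieve-prime M p ps eq rewrite eq = refl

    sieve-¬prime : ∀ M p ps → does (prime? p) ≡ false → sieve M (p ∷ ps) ≡ sieve M ps
    sieve-¬prime M p ps eq rewrite eq = refl

-- The truncated indicator as a combination of divisibility conditions.

module Sieve where

  open Rationals
  open LatticeCounting using (bit; bit-∧; ≤ᵇ-intro; dv; dv-yes; dv-no)
  open Valuations
  open PrimeLists using (primesUpTo≡filter)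
  open import Data.Bool using (Bool; true; false; _∧_)
  open import Data.Nat as ℕ using (ℕ; zero; suc; _^_; _∸_; _≤ᵇ_; NonZero; s≤s; z≤n)
  import Data.Nat.Properties as ℕP
  open import Data.Nat.Divisibility
  open import Data.Nat.Coprimality using (Coprime; coprime-divisor)
  open import Data.Nat.Primality using (Prime; prime?; prime⇒irreducible; prime⇒nonZero)
  open import Data.Rational hiding (NonZero; _≤ᵇ_)
  open import Data.Rational.Properties hiding (module ≤-Reasoning)
  open import Data.Rational.Solver using (module +-*-Solver)
  open +-*-Solver using (solve; _:=_; _:+_; _:*_; _:-_; :-_; con)
  open import Data.List using (List; []; _∷_; _++_; map; upTo; _∷ʳ_)
  open import Data.List.Properties using (upTo-∷ʳ; map-++)
  open import Data.List.Relation.Unary.All as All using (All; []; _∷_)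
  import Data.List.Relation.Unary.All.Properties as All
  open import Data.List.Relation.Unary.Any using (here; there)
  open import Data.List.Relation.Unary.AllPairs using ([]; _∷_)
  open import Data.List.Relation.Unary.Unique.Propositional using (Unique)
  import Data.List.Relation.Unary.Unique.Propositional.Properties as Unique
  open import Data.List.Membership.Propositional using (_∈_)
  open import Data.List.Membership.Propositional.Properties using (∈-filter⁺; ∈-upTo⁺)
  open import Data.Product using (_×_; _,_; ∃; proj₁; proj₂)
  open import Data.Sum using (inj₁; inj₂)
  open import Function using (_∘_)
  open import Relation.Nullary using (¬_; yes; no; contradiction)
  open import Relation.Binary.PropositionalEquality

  -- A list of pairs (c , y) stands for the operator ∏ (1 + c V_y), where (V_y φ)(g) = [y ∣ g] φ(g / y);
  -- eval L k g is the value at g of V_k ∏ (1 + c V_y) applied to the constant function 1.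
  Form : Set
  Form = List (ℚ × ℕ)

  eval : Form → ℕ → ℕ → ℚ
  eval []            k g = ι (dv k g)
  eval ((c , y) ∷ L) k g = eval L k g + c * eval L (k ℕ.* y) g

  -- The operator product with each V_y replaced by 1/y², the density of y ∣ content: the Dirichlet
  -- polynomial at s = 2.
  dens : Form → ℚ
  dens []            = 1ℚ
  dens ((c , y) ∷ L) = (1ℚ + c * inv (y ℕ.* y)) * dens L

  dens-++ : ∀ L L′ → dens (L ++ L′) ≡ dens L * dens L′
  dens-++ []            L′ = sym (*-identityˡ _)
  dens-++ ((c , y) ∷ L) L′ = trans (cong ((1ℚ + c * inv (y ℕ.* y)) *_) (dens-++ L L′)) (sym (*-assoc (1ℚ + c * inv (y ℕ.* y)) (dens L) (dens L′)))

  -- (1 - V_p) ∏_{i<M} (1 + V_{p^(3^i)})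
  block : ℕ → ℕ → Form
  block p zero    = (- 1ℚ , p) ∷ []
  block p (suc M) = (1ℚ , p ^ (3 ^ M)) ∷ block p M

  forms : ℕ → List ℕ → Form
  forms D []       = []
  forms D (p ∷ ps) = block p D ++ forms D ps

  prodℚ-∷ʳ : ∀ xs x → prodℚ (xs ∷ʳ x) ≡ prodℚ xs * x
  prodℚ-∷ʳ []       x = trans (*-identityʳ x) (sym (*-identityˡ x))
  prodℚ-∷ʳ (y ∷ xs) x = trans (cong (y *_) (prodℚ-∷ʳ xs x)) (sym (*-assoc y _ x))

  fTrunc-suc : ∀ M x → fTrunc (suc M) x ≡ (1ℚ + inv (x ^ (3 ^ M))) * fTrunc M x
  fTrunc-suc M x = begin
    (1ℚ - inv x) * prodℚ (map h (upTo (suc M)))            ≡⟨ cong (λ l → (1ℚ - inv x) * prodℚ (map h l)) (sym (upTo-∷ʳ M)) ⟩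
    (1ℚ - inv x) * prodℚ (map h (upTo M ∷ʳ M))             ≡⟨ cong (λ l → (1ℚ - inv x) * prodℚ l) (map-++ h (upTo M) (M ∷ [])) ⟩
    (1ℚ - inv x) * prodℚ (map h (upTo M) ∷ʳ h M)           ≡⟨ cong ((1ℚ - inv x) *_) (prodℚ-∷ʳ (map h (upTo M)) (h M)) ⟩
    (1ℚ - inv x) * (prodℚ (map h (upTo M)) * h M)          ≡⟨ solve 3 (λ a b c → a :* (b :* c) := c :* (a :* b)) refl (1ℚ - inv x) _ (h M) ⟩
    h M * fTrunc M x                                       ∎
    where
    open ≡-Reasoning
    h : ℕ → ℚ
    h i = 1ℚ + inv (x ^ (3 ^ i))

  -- Here p turns into p²: the square of p^(3^i) is (p²)^(3^i).
  dens-block : ∀ p M → dens (block p M) ≡ fTrunc M (p ℕ.* p)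
  dens-block p zero = solve 1 (λ i → (con 1ℚ :+ (:- con 1ℚ) :* i) :* con 1ℚ := (con 1ℚ :- i) :* con 1ℚ) refl (inv (p ℕ.* p))
  dens-block p (suc M) = trans (cong₂ (λ a b → (1ℚ + a) * b) (trans (*-identityˡ _) (cong inv (sym (^-distrib-* p p (3 ^ M))))) (dens-block p M))
    (sym (fTrunc-suc M (p ℕ.* p)))

  dens-forms : ∀ D ps → dens (forms D ps) ≡ prodℚ (map (λ p → fTrunc D (p ℕ.* p)) ps)
  dens-forms D []       = refl
  dens-forms D (p ∷ ps) = trans (dens-++ (block p D) (forms D ps)) (cong₂ _*_ (dens-block p D) (dens-forms D ps))

  -- The value at p^v of the block of p after the shift V_{p^j}, as `eval-block` shows.
  χ : ℕ → ℕ → ℕ → Bool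
  χ M j v = (j ≤ᵇ v) ∧ no2 M (v ∸ j)

  χ-yes : ∀ M j w → χ M j (j ℕ.+ w) ≡ no2 M w
  χ-yes M j w = cong₂ (λ a b → a ∧ no2 M b) (≤ᵇ-intro (ℕP.m≤m+n j w)) (ℕP.m+n∸m≡n j w)

  ≤ᵇ-false : ∀ {m n} → n ℕ.< m → (m ≤ᵇ n) ≡ false
  ≤ᵇ-false {m} {n} lt with m ≤ᵇ n in eq
  ... | false = refl
  ... | true  = contradiction (ℕP.≤ᵇ⇒≤ m n (subst Data.Bool.T (sym eq) _)) (ℕP.<⇒≱ lt)

  χ-no : ∀ M j v → v ℕ.< j → χ M j v ≡ false
  χ-no M j v lt = cong (_∧ no2 M (v ∸ j)) (≤ᵇ-false lt)

  -- Sorts v - j by its digit at 3^M. Below 3^M the second summand vanishes; from 3^M on the first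
  -- does, by `no2-support`, and `no2-top` identifies the second. This is the action of 1 +
  -- V_{p^(3^M)}.
  χ-suc : ∀ M j v → bit (χ (suc M) j v) ≡ bit (χ M j v) ℕ.+ bit (χ M (j ℕ.+ 3 ^ M) v)
  χ-suc M j v with ℕP.<-≤-connex v j
  ... | inj₁ v<j rewrite χ-no (suc M) j v v<j | χ-no M j v v<j | χ-no M (j ℕ.+ 3 ^ M) v (ℕP.<-≤-trans v<j (ℕP.m≤m+n j _)) = refl
  ... | inj₂ j≤v = subst (λ v → bit (χ (suc M) j v) ≡ bit (χ M j v) ℕ.+ bit (χ M (j ℕ.+ 3 ^ M) v)) (ℕP.m+[n∸m]≡n j≤v) (go (v ∸ j))
    where
    go : ∀ w → bit (χ (suc M) j (j ℕ.+ w)) ≡ bit (χ M j (j ℕ.+ w)) ℕ.+ bit (χ M (j ℕ.+ 3 ^ M) (j ℕ.+ w))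
    go w with ℕP.<-≤-connex w (3 ^ M)
    ... | inj₁ w<t rewrite χ-yes (suc M) j w | χ-yes M j w | χ-no M (j ℕ.+ 3 ^ M) (j ℕ.+ w) (ℕP.+-monoʳ-< j w<t)
          | sym (no2-stable-suc M w w<t) = sym (ℕP.+-identityʳ _)
    ... | inj₂ t≤w = subst (λ w → bit (χ (suc M) j (j ℕ.+ w)) ≡ bit (χ M j (j ℕ.+ w)) ℕ.+ bit (χ M (j ℕ.+ 3 ^ M) (j ℕ.+ w)))
          (ℕP.m+[n∸m]≡n t≤w) (go′ (w ∸ 3 ^ M))
      where
      go′ : ∀ w → bit (χ (suc M) j (j ℕ.+ (3 ^ M ℕ.+ w))) ≡ bit (χ M j (j ℕ.+ (3 ^ M ℕ.+ w))) ℕ.+ bit (χ M (j ℕ.+ 3 ^ M) (j ℕ.+ (3 ^ M ℕ.+ w)))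
      go′ w rewrite χ-yes (suc M) j (3 ^ M ℕ.+ w) | χ-yes M j (3 ^ M ℕ.+ w) | sym (ℕP.+-assoc j (3 ^ M) w) | χ-yes M (j ℕ.+ 3 ^ M) w | no2-top M w
        with no2 M (3 ^ M ℕ.+ w) in eq
      ... | true  = contradiction (no2-support M _ eq) (ℕP.≤⇒≯ (ℕP.m≤m+n (3 ^ M) w))
      ... | false = refl

  -- `χ 0 j v` says v = j, the difference of v ≥ j and v ≥ j + 1: the action of 1 - V_p.
  χ-zero : ∀ j v → bit (j ≤ᵇ v) ≡ bit (χ 0 j v) ℕ.+ bit (suc j ≤ᵇ v)
  χ-zero j v with ℕP.<-≤-connex v j
  ... | inj₁ v<j rewrite χ-no 0 j v v<j | ≤ᵇ-false v<j | ≤ᵇ-false (ℕP.<-trans v<j (ℕP.n<1+n j)) = refl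
  ... | inj₂ j≤v = subst (λ v → bit (j ≤ᵇ v) ≡ bit (χ 0 j v) ℕ.+ bit (suc j ≤ᵇ v)) (ℕP.m+[n∸m]≡n j≤v) (go (v ∸ j))
    where
    go : ∀ w → bit (j ≤ᵇ (j ℕ.+ w)) ≡ bit (χ 0 j (j ℕ.+ w)) ℕ.+ bit (suc j ≤ᵇ (j ℕ.+ w))
    go zero    rewrite χ-yes 0 j 0 | ≤ᵇ-intro (ℕP.m≤m+n j 0) | ≤ᵇ-false {suc j} {j ℕ.+ 0} (s≤s (ℕP.≤-reflexive (ℕP.+-identityʳ j))) = refl
    go (suc w) rewrite χ-yes 0 j (suc w) | ≤ᵇ-intro (ℕP.m≤m+n j (suc w)) | ≤ᵇ-intro {suc j} {j ℕ.+ suc w} (ℕP.m<m+n j (s≤s z≤n)) = refl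

  dv-⇔ : ∀ {k a l b} → (k ∣ a → l ∣ b) → (l ∣ b → k ∣ a) → dv k a ≡ dv l b
  dv-⇔ {k} {a} to from with k ∣? a
  ... | yes d = sym (dv-yes (to d))
  ... | no ¬d = sym (dv-no (¬d ∘ from))

  prime-coprime : ∀ {p k} → Prime p → ¬ p ∣ k → Coprime k p
  prime-coprime pp p∤k (d∣k , d∣p) with prime⇒irreducible pp d∣p
  ... | inj₁ eq   = eq
  ... | inj₂ refl = contradiction d∣k p∤k

  cancel-prime-power : ∀ {p k} → Prime p → ¬ p ∣ k → ∀ v x → k ∣ p ^ v ℕ.* x → k ∣ x
  cancel-prime-power pp p∤k zero    x d = subst (_ ∣_) (ℕP.*-identityˡ x) d
  cancel-prime-power {p} {k} pp p∤k (suc v) x d = cancel-prime-power pp p∤k v x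
    (coprime-divisor (prime-coprime pp p∤k) (subst (k ∣_) (ℕP.*-assoc p (p ^ v) x) d))

  dv-prime-power : ∀ {p k x} → Prime p → ¬ p ∣ k → ¬ p ∣ x → ∀ j v →
    dv (p ^ j ℕ.* k) (p ^ v ℕ.* x) ≡ bit (j ≤ᵇ v) ℕ.* dv k x
  dv-prime-power {p} {k} {x} pp p∤k p∤x j v with ℕP.<-≤-connex v j
  ... | inj₁ v<j rewrite ≤ᵇ-false v<j = dv-no (λ d → p∤x (p∣x (∣-trans (m∣m*n k) d)))
    where
    instance
      pᵛ≢0 : NonZero (p ^ v)
      pᵛ≢0 = ℕP.m^n≢0 p v {{prime⇒nonZero pp}}
    p∣x : p ^ j ∣ p ^ v ℕ.* x → p ∣ x
    p∣x d = *-cancelˡ-∣ (p ^ v) (∣-trans (subst (_∣ p ^ j) (ℕP.*-comm p (p ^ v)) (subst (λ i → p ^ suc v ∣ p ^ i) (ℕP.m+[n∸m]≡n v<j)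
      (subst (p ^ suc v ∣_) (sym (ℕP.^-distribˡ-+-* p (suc v) (j ∸ suc v))) (m∣m*n _)))) d)
  ... | inj₂ j≤v rewrite ≤ᵇ-intro j≤v = trans (dv-⇔
          (λ d → cancel-prime-power pp p∤k v x (∣-trans (n∣m*n (p ^ j)) d))
          (λ d → subst (λ i → p ^ j ℕ.* k ∣ p ^ i ℕ.* x) (ℕP.m+[n∸m]≡n j≤v) (subst (λ z → p ^ j ℕ.* k ∣ z ℕ.* x) (sym (ℕP.^-distribˡ-+-* p j (v ∸ j)))
             (*-pres-∣ (m∣m*n {p ^ j} (p ^ (v ∸ j))) d))))
        (sym (ℕP.*-identityˡ (dv k x)))

  Free : ℕ → Form → Set
  Free p = All (λ (_ , y) → ¬ p ∣ y)

  -- Shifts V_y with y prime to p leave the power of p untouched, so the comparison of exponents at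
  -- p factors out of the whole operator.
  eval-free : ∀ {p k x} → Prime p → ∀ L → Free p L → ¬ p ∣ k → ¬ p ∣ x → ∀ j v →
    eval L (p ^ j ℕ.* k) (p ^ v ℕ.* x) ≡ ι (bit (j ≤ᵇ v)) * eval L k x
  eval-free {p} {k} {x} pp [] [] p∤k p∤x j v = trans (cong ι (dv-prime-power pp p∤k p∤x j v)) (ι-* (bit (j ≤ᵇ v)) (dv k x))
  eval-free {p} {k} {x} pp ((c , y) ∷ L) (p∤y ∷ free) p∤k p∤x j v = begin
    eval L (p ^ j ℕ.* k) g + c * eval L (p ^ j ℕ.* k ℕ.* y) g
      ≡⟨ cong (λ z → eval L (p ^ j ℕ.* k) g + c * eval L z g) (ℕP.*-assoc (p ^ j) k y) ⟩
    eval L (p ^ j ℕ.* k) g + c * eval L (p ^ j ℕ.* (k ℕ.* y)) g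
      ≡⟨ cong₂ (λ a b → a + c * b) (eval-free pp L free p∤k p∤x j v) (eval-free pp L free (∤-* pp p∤k p∤y) p∤x j v) ⟩
    b * eval L k x + c * (b * eval L (k ℕ.* y) x)
      ≡⟨ solve 4 (λ b c e f → b :* e :+ c :* (b :* f) := b :* (e :+ c :* f)) refl b c (eval L k x) (eval L (k ℕ.* y) x) ⟩
    b * eval ((c , y) ∷ L) k x ∎
    where
    open ≡-Reasoning
    g = p ^ v ℕ.* x
    b = ι (bit (j ≤ᵇ v))

  shift-power : ∀ p j t k → p ^ j ℕ.* k ℕ.* p ^ t ≡ p ^ (j ℕ.+ t) ℕ.* k
  shift-power p j t k = begin
    p ^ j ℕ.* k ℕ.* p ^ t       ≡⟨ ℕP.*-assoc (p ^ j) k (p ^ t) ⟩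
    p ^ j ℕ.* (k ℕ.* p ^ t)     ≡⟨ cong (p ^ j ℕ.*_) (ℕP.*-comm k (p ^ t)) ⟩
    p ^ j ℕ.* (p ^ t ℕ.* k)     ≡⟨ sym (ℕP.*-assoc (p ^ j) (p ^ t) k) ⟩
    p ^ j ℕ.* p ^ t ℕ.* k       ≡⟨ cong (ℕ._* k) (sym (ℕP.^-distribˡ-+-* p j t)) ⟩
    p ^ (j ℕ.+ t) ℕ.* k         ∎
    where open ≡-Reasoning

  -- The exponent j is arbitrary because every factor of the block moves it: 1 - V_p to j + 1, the
  -- others to j + 3^M.
  eval-block : ∀ {p k x} → Prime p → ∀ M L → Free p L → ¬ p ∣ k → ¬ p ∣ x → ∀ j v →
    eval (block p M ++ L) (p ^ j ℕ.* k) (p ^ v ℕ.* x) ≡ ι (bit (χ M j v)) * eval L k x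
  eval-block {p} {k} {x} pp zero L free p∤k p∤x j v = begin
    eval L (p ^ j ℕ.* k) g + - 1ℚ * eval L (p ^ j ℕ.* k ℕ.* p) g
      ≡⟨ cong (λ z → eval L (p ^ j ℕ.* k) g + - 1ℚ * eval L z g) eq ⟩
    eval L (p ^ j ℕ.* k) g + - 1ℚ * eval L (p ^ suc j ℕ.* k) g
      ≡⟨ cong₂ (λ a b → a + - 1ℚ * b) (eval-free pp L free p∤k p∤x j v) (eval-free pp L free p∤k p∤x (suc j) v) ⟩
    ι (bit (j ≤ᵇ v)) * E + - 1ℚ * (ι b′ * E)
      ≡⟨ cong (λ z → z * E + - 1ℚ * (ι b′ * E)) (trans (cong ι (χ-zero j v)) (ι-+ (bit (χ 0 j v)) b′)) ⟩
    (ι (bit (χ 0 j v)) + ι b′) * E + - 1ℚ * (ι b′ * E)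
      ≡⟨ solve 3 (λ a b e → (a :+ b) :* e :+ (:- con 1ℚ) :* (b :* e) := a :* e) refl (ι (bit (χ 0 j v))) (ι b′) E ⟩
    ι (bit (χ 0 j v)) * E ∎
    where
    open ≡-Reasoning
    g = p ^ v ℕ.* x
    E = eval L k x
    b′ = bit (suc j ≤ᵇ v)
    eq : p ^ j ℕ.* k ℕ.* p ≡ p ^ suc j ℕ.* k
    eq = trans (ℕP.*-comm (p ^ j ℕ.* k) p) (sym (ℕP.*-assoc p (p ^ j) k))
  eval-block {p} {k} {x} pp (suc M) L free p∤k p∤x j v = begin
    eval B (p ^ j ℕ.* k) g + 1ℚ * eval B (p ^ j ℕ.* k ℕ.* p ^ (3 ^ M)) g
      ≡⟨ cong (λ z → eval B (p ^ j ℕ.* k) g + 1ℚ * eval B z g) (shift-power p j (3 ^ M) k) ⟩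
    eval B (p ^ j ℕ.* k) g + 1ℚ * eval B (p ^ (j ℕ.+ 3 ^ M) ℕ.* k) g
      ≡⟨ cong₂ (λ a b → a + 1ℚ * b) (eval-block pp M L free p∤k p∤x j v) (eval-block pp M L free p∤k p∤x (j ℕ.+ 3 ^ M) v) ⟩
    ι a * E + 1ℚ * (ι b * E)
      ≡⟨ solve 3 (λ a b e → a :* e :+ con 1ℚ :* (b :* e) := (a :+ b) :* e) refl (ι a) (ι b) E ⟩
    (ι a + ι b) * E
      ≡⟨ cong (_* E) (sym (trans (cong ι (χ-suc M j v)) (ι-+ a b))) ⟩
    ι (bit (χ (suc M) j v)) * E ∎
    where
    open ≡-Reasoning
    g = p ^ v ℕ.* x
    E = eval L k x
    B = block p M ++ L
    a = bit (χ M j v)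
    b = bit (χ M (j ℕ.+ 3 ^ M) v)

  block-free : ∀ {p q} → Prime p → Prime q → p ≢ q → ∀ M → Free p (block q M)
  block-free pp pq p≢q zero    = (p≢q ∘ prime∣prime pq pp) ∷ []
  block-free pp pq p≢q (suc M) = (p≢q ∘ prime∣^ pq pp (3 ^ M)) ∷ block-free pp pq p≢q M

  forms-free : ∀ {p} → Prime p → ∀ D ps → All Prime ps → All (p ≢_) ps → Free p (forms D ps)
  forms-free pp D []       []         []         = []
  forms-free pp D (q ∷ ps) (pq ∷ pps) (p≢q ∷ ps≢) = All.++⁺ (block-free pp pq p≢q D) (forms-free pp D ps pps ps≢)

  val-cofactor : ∀ {p q g v x w y} → Prime p → Prime q → p ≢ q → Val p g v x → Val q x w y → Val q g w (p ^ v ℕ.* y)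
  val-cofactor {p} {q} {v = v} {w = w} {y} pp pq p≢q (mkVal e _) (mkVal e′ f) = mkVal
    (trans e (trans (cong (p ^ v ℕ.*_) e′) (trans (sym (ℕP.*-assoc (p ^ v) (q ^ w) y)) (trans (cong (ℕ._* y) (ℕP.*-comm (p ^ v) (q ^ w))) (ℕP.*-assoc (q ^ w) (p ^ v) y)))))
    (∤-* pq (p≢q ∘ sym ∘ prime∣^ pp pq v) f)

  Sifted : ℕ → List ℕ → ℕ → Set
  Sifted D ps g = ∀ p → p ∈ ps → ∀ v x → Val p g v x → no2 D v ≡ true

  -- The block of p contributes the condition on its exponent, and what remains is the same claim
  -- for the p-free part of g. Since the listed primes are distinct, the exponents of the others are
  -- the same there as in g.
  eval-forms : ∀ D ps → All Prime ps → Unique ps → ∀ g .{{_ : NonZero g}} →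
    ∃ λ b → eval (forms D ps) 1 g ≡ ι (bit b) × (b ≡ true → Sifted D ps g) × (Sifted D ps g → b ≡ true)
  eval-forms D [] [] [] g = true , cong ι (dv-yes (1∣ g)) , (λ _ p ()) , (λ _ → refl)
  eval-forms D (p ∷ ps) (pp ∷ pps) (p≢ ∷ uniq) g with valuation (prime>1 pp) g
  ... | v , x , val@(mkVal g≡ p∤x) with eval-forms D ps pps uniq x {{val-nonZero (prime>1 pp) {v = v} val}}
  ...   | b , eval≡ , to , from = no2 D v ∧ b , eq , to′ , from′
    where
    eq : eval (block p D ++ forms D ps) 1 g ≡ ι (bit (no2 D v ∧ b))
    eq = begin
      eval (block p D ++ forms D ps) 1 g                 ≡⟨ cong (eval (block p D ++ forms D ps) 1) g≡ ⟩
      eval (block p D ++ forms D ps) 1 (p ^ v ℕ.* x)     ≡⟨ eval-block pp D (forms D ps) (forms-free pp D ps pps p≢) (prime∤1 pp) p∤x 0 v ⟩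
      ι (bit (no2 D v)) * eval (forms D ps) 1 x          ≡⟨ cong (ι (bit (no2 D v)) *_) eval≡ ⟩
      ι (bit (no2 D v)) * ι (bit b)                      ≡⟨ sym (ι-* (bit (no2 D v)) (bit b)) ⟩
      ι (bit (no2 D v) ℕ.* bit b)                        ≡⟨ cong ι (sym (bit-∧ (no2 D v) b)) ⟩
      ι (bit (no2 D v ∧ b))                              ∎
      where open ≡-Reasoning
    to′ : no2 D v ∧ b ≡ true → Sifted D (p ∷ ps) g
    to′ h .p (here refl) w y val′ = subst (λ v → no2 D v ≡ true) (val-unique (prime>1 pp) val val′) (proj₁ (∧-split h))
    to′ h q (there q∈) w y val′ =
      let pq = All.lookup pps q∈
          w′ , y′ , val″ = valuation (prime>1 pq) x {{val-nonZero (prime>1 pp) {v = v} val}}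
      in subst (λ v → no2 D v ≡ true) (val-unique (prime>1 pq) (val-cofactor pp pq (All.lookup p≢ q∈) val val″) val′)
           (to (proj₂ (∧-split {no2 D v} h)) q q∈ w′ y′ val″)
    from′ : Sifted D (p ∷ ps) g → no2 D v ∧ b ≡ true
    from′ h = cong₂ _∧_ (h p (here refl) v x val) (from (λ q q∈ w y val′ → h q (there q∈) w _ (val-cofactor pp (All.lookup pps q∈) (All.lookup p≢ q∈) val val′)))

  module _ (D : ℕ) where
    primes : List ℕ
    primes = primesUpTo D

    primes-prime : All Prime primes
    primes-prime = subst (All Prime) (sym (primesUpTo≡filter D)) (All.all-filter prime? (upTo (suc D)))

    primes-unique : Unique primes
    primes-unique = subst Unique (sym (primesUpTo≡filter D)) (Unique.filter⁺ prime? (Unique.upTo⁺ (suc D)))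

    ∈-primes : ∀ {p} → Prime p → p ℕ.≤ D → p ∈ primes
    ∈-primes pp p≤D = subst (_ ∈_) (sym (primesUpTo≡filter D)) (∈-filter⁺ prime? (∈-upTo⁺ (s≤s p≤D)) pp)

    F : Form
    F = forms D primes

    dens-F : dens F ≡ P D
    dens-F = dens-forms D primes

    val<3^D : ∀ {p g v x} .{{_ : NonZero g}} → Prime p → Val p g v x → g ℕ.≤ D → v ℕ.< 3 ^ D
    val<3^D {p} {g} {v} {x} pp val@(mkVal e _) g≤D = begin-strict
      v              <⟨ n<p^n (prime>1 pp) v ⟩
      p ^ v          ≤⟨ ℕP.m≤m*n (p ^ v) x {{val-nonZero (prime>1 pp) {v = v} val}} ⟩
      p ^ v ℕ.* x    ≡⟨ sym e ⟩
      g              ≤⟨ g≤D ⟩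
      D              ≤⟨ ℕP.<⇒≤ (n<3^n D) ⟩
      3 ^ D          ∎
      where open ℕP.≤-Reasoning

    -- A prime with positive exponent divides g, hence is at most D and in the list; its exponent
    -- lies below 3^D, so D digits decide `Q`.
    Sifted⇒G : ∀ g .{{_ : NonZero g}} → g ℕ.≤ D → Sifted D primes g → G g
    Sifted⇒G g g≤D h p zero    x pp val = refl
    Sifted⇒G g g≤D h p (suc v) x pp val@(mkVal e _) =
      trans (sym (no2≡Q D (suc v) (val<3^D pp val g≤D))) (h p (∈-primes pp (ℕP.≤-trans (∣⇒≤ p∣g) g≤D)) (suc v) x val)
      where
      p∣g : p ∣ g
      p∣g = subst (p ∣_) (sym e) (∣m⇒∣m*n x (m∣m*n (p ^ v)))

    G⇒Sifted : ∀ g .{{_ : NonZero g}} → g ℕ.≤ D → G g → Sifted D primes g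
    G⇒Sifted g g≤D gg p p∈ v x val = let pp = All.lookup primes-prime p∈ in
      trans (no2≡Q D v (val<3^D pp val g≤D)) (gg p v x pp val)

-- From the truncated indicator to the density of the greedy set.

module Density where

  open Rationals
  open LatticeCounting using (bit; bit≤1; dv; sumL; sumL-cong; countB≡sumL; Near; content; inB; C; C₁; C-near; s; s-large; s²≤9C₁; bigContent; bigContent-bound)
  open Valuations
  open GreedySet
  open Sieve
  open import Data.Bool using (Bool; true; false; _∧_; not; T)
  open import Data.Bool.Properties using (∧-assoc)
  open import Data.Nat as ℕ using (ℕ; zero; suc; NonZero; s≤s; z≤n)
  import Data.Nat.Properties as ℕP
  open import Data.Nat.Primality using (Prime; prime⇒nonZero)
  open import Data.Nat.Solver renaming (module +-*-Solver to ℕ-Solver)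
  open import Data.Integer as ℤ using (-[1+_])
  open import Data.Rational hiding (NonZero; _≤ᵇ_)
  open import Data.Rational.Properties
  open import Data.Rational.Solver using (module +-*-Solver)
  open +-*-Solver using (solve; _:=_; _:+_; _:*_; _:-_; :-_; con)
  open import Data.List using (List; []; _∷_)
  open import Data.List.Relation.Unary.All as All using (All; []; _∷_)
  import Data.List.Relation.Unary.All.Properties as All
  open import Data.Product using (_×_; _,_; ∃; proj₁; proj₂)
  open import Function using (_∘_)
  open import Relation.Nullary using (¬_)
  open import Relation.Binary.PropositionalEquality

  private variable X : Set

  sumQ : (X → ℚ) → List X → ℚ
  sumQ f []       = 0ℚ
  sumQ f (x ∷ xs) = f x + sumQ f xs

  sumQ-cong : ∀ {f g : X → ℚ} → (∀ x → f x ≡ g x) → ∀ xs → sumQ f xs ≡ sumQ g xs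
  sumQ-cong eq []       = refl
  sumQ-cong eq (x ∷ xs) = cong₂ _+_ (eq x) (sumQ-cong eq xs)

  sumQ-mono : ∀ {f g : X → ℚ} → (∀ x → f x ≤ g x) → ∀ xs → sumQ f xs ≤ sumQ g xs
  sumQ-mono le []       = ≤-refl
  sumQ-mono le (x ∷ xs) = +-mono-≤ (le x) (sumQ-mono le xs)

  sumQ-ι : ∀ (f : X → ℕ) xs → sumQ (ι ∘ f) xs ≡ ι (sumL f xs)
  sumQ-ι f []       = refl
  sumQ-ι f (x ∷ xs) = trans (cong (ι (f x) +_) (sumQ-ι f xs)) (sym (ι-+ (f x) (sumL f xs)))

  sumQ-linear : ∀ (f g : X → ℚ) c xs → sumQ (λ x → f x + c * g x) xs ≡ sumQ f xs + c * sumQ g xs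
  sumQ-linear f g c []       = sym (trans (+-identityˡ _) (*-zeroʳ c))
  sumQ-linear f g c (x ∷ xs) = trans (cong (f x + c * g x +_) (sumQ-linear f g c xs))
    (solve 5 (λ a b c d e → (a :+ c :* b) :+ (d :+ c :* e) := (a :+ d) :+ c :* (b :+ e)) refl (f x) (g x) c (sumQ f xs) (sumQ g xs))

  sumQ-+ : ∀ (f g : X → ℚ) xs → sumQ (λ x → f x + g x) xs ≡ sumQ f xs + sumQ g xs
  sumQ-+ f g xs = trans (sumQ-cong (λ x → cong (f x +_) (sym (*-identityˡ (g x)))) xs)
    (trans (sumQ-linear f g 1ℚ xs) (cong (sumQ f xs +_) (*-identityˡ (sumQ g xs))))

  discSum : ℕ → (ℕ → ℚ) → ℚ
  discSum n φ = sumQ (λ m → ι (bit (inB n m)) * φ (content m)) (square n)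

  discSum-linear : ∀ n φ ψ c → discSum n (λ g → φ g + c * ψ g) ≡ discSum n φ + c * discSum n ψ
  discSum-linear n φ ψ c = trans (sumQ-cong (λ m → solve 4 (λ w a b c → w :* (a :+ c :* b) := w :* a :+ c :* (w :* b)) refl
      (ι (bit (inB n m))) (φ (content m)) (ψ (content m)) c) (square n))
    (sumQ-linear (λ m → ι (bit (inB n m)) * φ (content m)) (λ m → ι (bit (inB n m)) * ψ (content m)) c (square n))

  discSum-dv : ∀ n k → discSum n (λ g → ι (dv k g)) ≡ ι (C n k)
  discSum-dv n k = trans (sumQ-cong (λ m → sym (ι-* (bit (inB n m)) (dv k (content m)))) (square n))
    (sumQ-ι (λ m → bit (inB n m) ℕ.* dv k (content m)) (square n))

  scale-inv : ∀ k .{{_ : NonZero k}} a b → ι (k ℕ.* a) ≤ b → ι a ≤ b * inv k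
  scale-inv k a b le = subst (_≤ b * inv k) eq (*-monoʳ-≤ (0≤inv k) le)
    where
    eq : ι (k ℕ.* a) * inv k ≡ ι a
    eq = trans (cong (_* inv k) (ι-* k a)) (trans (solve 3 (λ k a i → k :* a :* i := a :* (k :* i)) refl (ι k) (ι a) (inv k))
      (trans (cong (ι a *_) (ι*inv k)) (*-identityʳ _)))

  -- Division by k² makes the error uniform in k. The factor 1ℚ is `dens []`, in the form needed by
  -- the base case of `density`.
  near⇒density : ∀ k .{{_ : NonZero k}} c t s → Near (3 ℕ.* (k ℕ.* k) ℕ.* s) (k ℕ.* k ℕ.* c) t → ∣ ι c - 1ℚ * inv (k ℕ.* k) * ι t ∣ ≤ ι 3 * ι s
  near⇒density k c t s near = ∣p-q∣≤r
    (≤-trans (scale-inv (k ℕ.* k) c (ι (t ℕ.+ 3 ℕ.* (k ℕ.* k) ℕ.* s)) (ι-mono-≤ (proj₁ near)))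
      (≤-reflexive (trans (cong (_* i) (ι-+ t (3 ℕ.* (k ℕ.* k) ℕ.* s))) (trans (*-distribʳ-+ i (ι t) (ι (3 ℕ.* (k ℕ.* k) ℕ.* s)))
        (cong₂ _+_ (solve 2 (λ c i → c :* i := con 1ℚ :* i :* c) refl (ι t) i) err)))))
    (≤-trans (≤-reflexive (solve 2 (λ c i → con 1ℚ :* i :* c := c :* i) refl (ι t) i))
      (≤-trans (*-monoʳ-≤ (0≤inv (k ℕ.* k)) (ι-mono-≤ (proj₂ near)))
        (≤-reflexive (trans (cong (_* i) (ι-+ (k ℕ.* k ℕ.* c) (3 ℕ.* (k ℕ.* k) ℕ.* s))) (trans (*-distribʳ-+ i (ι (k ℕ.* k ℕ.* c)) (ι (3 ℕ.* (k ℕ.* k) ℕ.* s)))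
          (cong₂ _+_ (trans (cong (_* i) (ι-* (k ℕ.* k) c)) (trans (solve 3 (λ k c i → k :* c :* i := c :* (k :* i)) refl (ι (k ℕ.* k)) (ι c) i)
            (trans (cong (ι c *_) (ι*inv (k ℕ.* k))) (*-identityʳ (ι c))))) err))))))
    where
    instance
      kk≢0 : NonZero (k ℕ.* k)
      kk≢0 = ℕP.m*n≢0 k k
    i = inv (k ℕ.* k)
    err : ι (3 ℕ.* (k ℕ.* k) ℕ.* s) * i ≡ ι 3 * ι s
    err = trans (cong (_* i) (trans (ι-* (3 ℕ.* (k ℕ.* k)) s) (cong (_* ι s) (ι-* 3 (k ℕ.* k)))))
      (trans (solve 4 (λ t k s i → t :* k :* s :* i := t :* s :* (k :* i)) refl (ι 3) (ι (k ℕ.* k)) (ι s) i)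
        (trans (cong (ι 3 * ι s *_) (ι*inv (k ℕ.* k))) (*-identityʳ (ι 3 * ι s))))

  C-density : ∀ n k .{{_ : NonZero k}} → ∣ ι (C n k) - 1ℚ * inv (k ℕ.* k) * ι (C₁ n) ∣ ≤ ι 3 * ι (s n)
  C-density n k = near⇒density k (C n k) (C₁ n) (s n) (C-near n k)

  Admissible : Form → Set
  Admissible = All (λ (c , y) → ∣ c ∣ ≤ 1ℚ × NonZero y)

  -- Each factor 1 + c V_y splits the sum into those for k and for k y, whose main terms combine
  -- because 1/(k y)² = 1/k² · 1/y². As |c| ≤ 1 the error constants add, so K doubles with every
  -- factor but depends neither on n nor on k.
  density : ∀ L → Admissible L → ∀ k .{{_ : NonZero k}} → ∃ λ K →
    ∀ n → ∣ discSum n (eval L k) - dens L * inv (k ℕ.* k) * ι (C₁ n) ∣ ≤ ι K * ι (s n)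
  density [] [] k = 3 , λ n → subst (λ z → ∣ z - 1ℚ * inv (k ℕ.* k) * ι (C₁ n) ∣ ≤ ι 3 * ι (s n)) (sym (discSum-dv n k)) (C-density n k)
  density ((c , y) ∷ L) ((∣c∣≤1 , y≢0) ∷ adm) k {{k≢0}} =
    let K₁ , h₁ = density L adm k ; K₂ , h₂ = density L adm (k ℕ.* y) {{ℕP.m*n≢0 k y {{k≢0}} {{y≢0}}}}
    in K₁ ℕ.+ K₂ , λ n → step K₁ K₂ n (h₁ n) (h₂ n)
    where
    d = dens L
    step : ∀ K₁ K₂ n → ∣ discSum n (eval L k) - d * inv (k ℕ.* k) * ι (C₁ n) ∣ ≤ ι K₁ * ι (s n) →
      ∣ discSum n (eval L (k ℕ.* y)) - d * inv (k ℕ.* y ℕ.* (k ℕ.* y)) * ι (C₁ n) ∣ ≤ ι K₂ * ι (s n) →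
      ∣ discSum n (eval ((c , y) ∷ L) k) - (1ℚ + c * inv (y ℕ.* y)) * d * inv (k ℕ.* k) * ι (C₁ n) ∣ ≤ ι (K₁ ℕ.+ K₂) * ι (s n)
    step K₁ K₂ n h₁ h₂ = begin
      ∣ discSum n (eval ((c , y) ∷ L) k) - (1ℚ + c * j) * d * i * t ∣ ≡⟨ cong ∣_∣ split ⟩
      ∣ u + c * v ∣                       ≤⟨ ∣p+q∣≤∣p∣+∣q∣ u (c * v) ⟩
      ∣ u ∣ + ∣ c * v ∣                   ≡⟨ cong (∣ u ∣ +_) (∣p*q∣≡∣p∣*∣q∣ c v) ⟩
      ∣ u ∣ + ∣ c ∣ * ∣ v ∣               ≤⟨ +-monoʳ-≤ ∣ u ∣ (*-monoʳ-≤ (0≤∣p∣ v) ∣c∣≤1) ⟩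
      ∣ u ∣ + 1ℚ * ∣ v ∣                  ≡⟨ cong (∣ u ∣ +_) (*-identityˡ _) ⟩
      ∣ u ∣ + ∣ v ∣                       ≤⟨ +-mono-≤ h₁ h₂ ⟩
      ι K₁ * ι (s n) + ι K₂ * ι (s n)     ≡⟨ sym (*-distribʳ-+ (ι (s n)) (ι K₁) (ι K₂)) ⟩
      (ι K₁ + ι K₂) * ι (s n)             ≡⟨ cong (_* ι (s n)) (sym (ι-+ K₁ K₂)) ⟩
      ι (K₁ ℕ.+ K₂) * ι (s n)             ∎
      where
      open ≤-Reasoning
      i = inv (k ℕ.* k)
      j = inv (y ℕ.* y)
      t = ι (C₁ n)
      u = discSum n (eval L k) - d * i * t
      v = discSum n (eval L (k ℕ.* y)) - d * inv (k ℕ.* y ℕ.* (k ℕ.* y)) * t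
      inv-eq : inv (k ℕ.* y ℕ.* (k ℕ.* y)) ≡ i * j
      inv-eq = trans (cong inv (ℕ-Solver.solve 2 (λ k y → k ℕ-Solver.:* y ℕ-Solver.:* (k ℕ-Solver.:* y) ℕ-Solver.:= k ℕ-Solver.:* k ℕ-Solver.:* (y ℕ-Solver.:* y)) refl k y)) (inv-* (k ℕ.* k) (y ℕ.* y))
      split : discSum n (eval ((c , y) ∷ L) k) - (1ℚ + c * j) * d * i * t ≡ u + c * v
      split = trans (cong (_- (1ℚ + c * j) * d * i * t) (discSum-linear n (eval L k) (eval L (k ℕ.* y)) c))
        (trans (solve 7 (λ a b c d i j t → (a :+ c :* b) :- (con 1ℚ :+ c :* j) :* d :* i :* t := (a :- d :* i :* t) :+ c :* (b :- d :* (i :* j) :* t)) refl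
           (discSum n (eval L k)) (discSum n (eval L (k ℕ.* y))) c d i j t)
         (cong (λ z → u + c * (discSum n (eval L (k ℕ.* y)) - d * z * t)) (sym inv-eq)))

  block-admissible : ∀ {p} → Prime p → ∀ M → Admissible (block p M)
  block-admissible pp zero    = (≤-refl , prime⇒nonZero pp) ∷ []
  block-admissible {p} pp (suc M) = (≤-refl , ℕP.m^n≢0 p (3 ℕ.^ M) {{prime⇒nonZero pp}}) ∷ block-admissible pp M

  forms-admissible : ∀ D ps → All Prime ps → Admissible (forms D ps)
  forms-admissible D []       []         = []
  forms-admissible D (p ∷ ps) (pp ∷ pps) = All.++⁺ (block-admissible pp D) (forms-admissible D ps pps)

  Close : ℚ → ℚ → ℚ → Set
  Close x y z = x ≤ y + z × y ≤ x + z

  bit-close : ∀ a b x → (x ≡ false → a ≡ b) → Close (ι (bit a)) (ι (bit b)) (ι (bit x))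
  bit-close a b true  _ = bit≤1+ a b , bit≤1+ b a
    where
    bit≤1+ : ∀ a b → ι (bit a) ≤ ι (bit b) + ι 1
    bit≤1+ a b = subst (ι (bit a) ≤_) (ι-+ (bit b) 1) (ι-mono-≤ (ℕP.≤-trans (bit≤1 a) (ℕP.m≤n+m 1 (bit b))))
  bit-close a b false h = subst (λ b → Close (ι (bit a)) (ι (bit b)) 0ℚ) (h refl)
    (≤-reflexive (sym (+-identityʳ (ι (bit a)))) , ≤-reflexive (sym (+-identityʳ (ι (bit a)))))

  restrict-close : ∀ z w a y x → (z ≡ false → Close (ι (bit a)) y (ι (bit x))) →
    Close (ι (bit ((not z ∧ w) ∧ a))) (ι (bit (not z ∧ w)) * y) (ι (bit (not z ∧ w) ℕ.* bit x))
  restrict-close true  w     a y x h = ≤-reflexive (sym (trans (+-identityʳ (0ℚ * y)) (*-zeroˡ y))) , ≤-reflexive (*-zeroˡ y)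
  restrict-close false false a y x h = ≤-reflexive (sym (trans (+-identityʳ (0ℚ * y)) (*-zeroˡ y))) , ≤-reflexive (*-zeroˡ y)
  restrict-close false true  a y x h = subst₂ (Close (ι (bit a))) (sym (*-identityˡ y)) (cong ι (sym (ℕP.*-identityˡ (bit x)))) (h refl)

  Bool-ext : ∀ a b → (a ≡ true → b ≡ true) → (b ≡ true → a ≡ true) → a ≡ b
  Bool-ext true  b     h _ = sym (h refl)
  Bool-ext false true  _ h = h refl
  Bool-ext false false _ _ = refl

  isZeroB-sound : ∀ {m} → isZeroB m ≡ false → ¬ (m ≡ zeroGI)
  isZeroB-sound () refl

  module Limit {e : ℕ → GI} (ord : NormOrder e) {A : GI → Bool} (greedy : IsGreedy e A) where
    open Greedy ord greedy

    module _ (D : ℕ) .{{_ : NonZero D}} where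

      -- For content at most D both sides are the indicator of `G (content m)`; beyond D the error
      -- bit is 1 and covers any difference of two bits.
      sifted-close : ∀ m → ¬ (m ≡ zeroGI) → Close (ι (bit (A m))) (eval (F D) 1 (content m)) (ι (bit (D ℕ.<ᵇ content m)))
      sifted-close m nz =
        let b , eq , to , from = eval-forms D (primes D) (primes-prime D) (primes-unique D) (content m)
        in subst (λ z → Close (ι (bit (A m))) z (ι (bit (D ℕ.<ᵇ content m)))) (sym eq) (bit-close (A m) b (D ℕ.<ᵇ content m) (λ small →
          Bool-ext (A m) b (λ Am → from (G⇒Sifted D (content m) (g≤D small) (A⇒G m nz Am)))
                           (λ b≡t → G⇒A m nz (Sifted⇒G D (content m) (g≤D small) (to b≡t)))))
        where
        instance
          g≢0 : NonZero (content m)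
          g≢0 = content≢0 nz
        g≤D : (D ℕ.<ᵇ content m) ≡ false → content m ℕ.≤ D
        g≤D eq = ℕP.≮⇒≥ (λ lt → subst T eq (ℕP.<⇒<ᵇ lt))

      countA-close : ∀ n → Close (ι (countA A n)) (discSum n (eval (F D) 1)) (ι (sumL (bigContent n D) (square n)))
      countA-close n = subst₂ (λ x z → Close x (discSum n (eval (F D) 1)) z) count≡ (sumQ-ι (bigContent n D) (square n))
        ( ≤-trans (sumQ-mono (proj₁ ∘ pointwise) (square n)) (≤-reflexive (sumQ-+ (λ m → ι (bit (inB n m)) * eval (F D) 1 (content m)) (ι ∘ bigContent n D) (square n)))
        , ≤-trans (sumQ-mono (proj₂ ∘ pointwise) (square n)) (≤-reflexive (sumQ-+ (λ m → ι (bit (inB n m ∧ A m))) (ι ∘ bigContent n D) (square n))))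
        where
        pointwise : ∀ m → Close (ι (bit (inB n m ∧ A m))) (ι (bit (inB n m)) * eval (F D) 1 (content m)) (ι (bigContent n D m))
        pointwise m = restrict-close (isZeroB m) (N m ℕ.≤ᵇ n) (A m) (eval (F D) 1 (content m)) (D ℕ.<ᵇ content m) (λ z → sifted-close m (isZeroB-sound z))
        count≡ : sumQ (λ m → ι (bit (inB n m ∧ A m))) (square n) ≡ ι (countA A n)
        count≡ = trans (sumQ-ι (λ m → bit (inB n m ∧ A m)) (square n)) (cong ι (sym (trans (countB≡sumL (λ m → not (isZeroB m) ∧ (N m ℕ.≤ᵇ n) ∧ A m) (square n))
          (sumL-cong (λ m → cong bit (sym (∧-assoc (not (isZeroB m)) (N m ℕ.≤ᵇ n) (A m)))) (square n)))))

      F-density : ∃ λ K → ∀ n → ∣ discSum n (eval (F D) 1) - P D * ι (C₁ n) ∣ ≤ ι K * ι (s n)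
      F-density = let K , h = density (F D) (forms-admissible D (primes D) (primes-prime D)) 1 in
        K , λ n → subst (λ z → ∣ discSum n (eval (F D) 1) - z * ι (C₁ n) ∣ ≤ ι K * ι (s n)) (trans (*-identityʳ (dens (F D))) (dens-F D)) (h n)

      bigContent-small : ∀ n → ι (sumL (bigContent n D) (square n)) ≤ ι 9 * inv D * ι (C₁ n)
      bigContent-small n = ≤-trans (scale-inv D (sumL (bigContent n D) (square n)) (ι (9 ℕ.* C₁ n)) (ι-mono-≤ (bigContent-bound n D)))
        (≤-reflexive (trans (cong (_* inv D) (ι-* 9 (C₁ n))) (solve 3 (λ a c i → a :* c :* i := a :* i :* c) refl (ι 9) (ι (C₁ n)) (inv D))))

      -- The threshold gives 9 K D ≤ `s n`, hence 9 K D · `s n` ≤ `s n`² ≤ 9 |I_n|.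
      boundary-small : ∀ K n → (9 ℕ.* (K ℕ.* D)) ℕ.* (9 ℕ.* (K ℕ.* D)) ℕ.≤ n → ι K * ι (s n) ≤ inv D * ι (C₁ n)
      boundary-small K n le = subst₂ _≤_ (ι-* K (s n)) (*-comm (ι (C₁ n)) (inv D)) (scale-inv D (K ℕ.* s n) (ι (C₁ n)) (ι-mono-≤
        (ℕP.*-cancelˡ-≤ {D ℕ.* (K ℕ.* s n)} {C₁ n} 9 (begin
          9 ℕ.* (D ℕ.* (K ℕ.* s n))     ≡⟨ ℕ-Solver.solve 4 (λ a d k s → a ℕ:* (d ℕ:* (k ℕ:* s)) ℕ:= a ℕ:* (k ℕ:* d) ℕ:* s) refl 9 D K (s n) ⟩
          9 ℕ.* (K ℕ.* D) ℕ.* s n       ≤⟨ ℕP.*-monoˡ-≤ (s n) (s-large n (9 ℕ.* (K ℕ.* D)) le) ⟩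
          s n ℕ.* s n                   ≤⟨ s²≤9C₁ n ⟩
          9 ℕ.* C₁ n                    ∎))))
        where
        open ℕP.≤-Reasoning
        open ℕ-Solver renaming (_:*_ to _ℕ:*_; _:=_ to _ℕ:=_)

      -- 10 = 9 + 1: the points with content above D, and the boundary error for large n.
      ratio-close : ∃ λ N₀ → ∀ n → N₀ ℕ.≤ n → ∣ ratio A n - P D ∣ ≤ ι 10 * inv D
      ratio-close = let K , h = F-density in (9 ℕ.* (K ℕ.* D)) ℕ.* (9 ℕ.* (K ℕ.* D)) , λ n le → go K n (h n) (boundary-small K n le)
        where
        go : ∀ K n → ∣ discSum n (eval (F D) 1) - P D * ι (C₁ n) ∣ ≤ ι K * ι (s n) → ι K * ι (s n) ≤ inv D * ι (C₁ n) → ∣ ratio A n - P D ∣ ≤ ι 10 * inv D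
        go K n h₁ h₂ = begin
          ∣ ratio A n - P D ∣                  ≡⟨ cong ∣_∣ clear ⟩
          ∣ (a - P D * c) * i ∣                ≡⟨ ∣p*q∣≡∣p∣*∣q∣ (a - P D * c) i ⟩
          ∣ a - P D * c ∣ * ∣ i ∣              ≡⟨ cong (∣ a - P D * c ∣ *_) (0≤p⇒∣p∣≡p (0≤inv (C₁ n))) ⟩
          ∣ a - P D * c ∣ * i                  ≤⟨ *-monoʳ-≤ (0≤inv (C₁ n)) main ⟩
          ι 10 * inv D * c * i                 ≡⟨ *-assoc (ι 10 * inv D) c i ⟩
          ι 10 * inv D * (c * i)               ≡⟨ cong (ι 10 * inv D *_) (ι*inv (C₁ n)) ⟩
          ι 10 * inv D * 1ℚ                    ≡⟨ *-identityʳ _ ⟩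
          ι 10 * inv D                         ∎
          where
          open ≤-Reasoning
          a = ι (countA A n)
          c = ι (C₁ n)
          i = inv (C₁ n)
          x = discSum n (eval (F D) 1)
          clear : ratio A n - P D ≡ (a - P D * c) * i
          clear = trans (cong₂ _-_ (/≡ι*inv (countA A n) (countNZ n)) (trans (sym (*-identityʳ (P D))) (cong (P D *_) (sym (ι*inv (C₁ n))))))
            (solve 4 (λ a p c i → a :* i :- p :* (c :* i) := (a :- p :* c) :* i) refl a (P D) c i)
          main : ∣ a - P D * c ∣ ≤ ι 10 * inv D * c
          main = begin
            ∣ a - P D * c ∣                    ≡⟨ cong ∣_∣ (solve 3 (λ a x y → a :- y := (a :- x) :+ (x :- y)) refl a x (P D * c)) ⟩
            ∣ (a - x) + (x - P D * c) ∣        ≤⟨ ∣p+q∣≤∣p∣+∣q∣ (a - x) (x - P D * c) ⟩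
            ∣ a - x ∣ + ∣ x - P D * c ∣        ≤⟨ +-mono-≤ (≤-trans (∣p-q∣≤r (proj₁ (countA-close n)) (proj₂ (countA-close n))) (bigContent-small n)) (≤-trans h₁ h₂) ⟩
            ι 9 * inv D * c + inv D * c        ≡⟨ solve 3 (λ t d c → t :* d :* c :+ d :* c := (t :+ con 1ℚ) :* d :* c) refl (ι 9) (inv D) c ⟩
            ι 10 * inv D * c                   ∎

    -- Both are compared with ratio A n, for n large in terms of D and M.
    P-cauchy : ∀ D M .{{_ : NonZero D}} .{{_ : NonZero M}} → ∣ P D - P M ∣ ≤ ι 10 * inv D + ι 10 * inv M
    P-cauchy D M = let N₁ , h₁ = ratio-close D ; N₂ , h₂ = ratio-close M in
      go (N₁ ℕ.⊔ N₂) (h₁ (N₁ ℕ.⊔ N₂) (ℕP.m≤m⊔n N₁ N₂)) (h₂ (N₁ ℕ.⊔ N₂) (ℕP.m≤n⊔m N₁ N₂))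
      where
      go : ∀ n → ∣ ratio A n - P D ∣ ≤ ι 10 * inv D → ∣ ratio A n - P M ∣ ≤ ι 10 * inv M → ∣ P D - P M ∣ ≤ ι 10 * inv D + ι 10 * inv M
      go n h₁ h₂ = begin
        ∣ P D - P M ∣               ≡⟨ cong ∣_∣ (solve 3 (λ a b r → a :- b := (r :- b) :- (r :- a)) refl (P D) (P M) r) ⟩
        ∣ (r - P M) - (r - P D) ∣   ≤⟨ ∣p-q∣≤∣p∣+∣q∣ (r - P M) (r - P D) ⟩
        ∣ r - P M ∣ + ∣ r - P D ∣   ≡⟨ +-comm ∣ r - P M ∣ ∣ r - P D ∣ ⟩
        ∣ r - P D ∣ + ∣ r - P M ∣   ≤⟨ +-mono-≤ h₁ h₂ ⟩
        ι 10 * inv D + ι 10 * inv M ∎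
        where
        open ≤-Reasoning
        r = ratio A n

    archimedean : ∀ ε → 0ℚ < ε → ∃ λ q → NonZero q × inv q ≤ ε
    archimedean ε@(mkℚ (ℤ.+ suc p) d _) _ = suc d , _ , ≤-trans (≤-reflexive (sym (*-identityˡ (inv (suc d)))))
      (≤-trans (*-monoʳ-≤ (0≤inv (suc d)) (ι-mono-≤ {1} {suc p} (s≤s z≤n))) (≤-reflexive (trans (sym (/≡ι*inv (suc p) d)) (↥p/↧p≡p ε))))
    archimedean (mkℚ (ℤ.+ zero) d _) (*<* (ℤ.+<+ ()))
    archimedean (mkℚ -[1+ _ ] d _) (*<* ())

    -- The threshold for n from `ratio-close` depends on its D and N₀ must not depend on M; so the
    -- ratio is compared with `P D` for one fixed D, and `P D` with `P M` by `P-cauchy`.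
    limit : (ε : ℚ) → 0ℚ < ε → ∃ λ N₀ → ∃ λ M₀ → (n M : ℕ) → N₀ ℕ.≤ n → M₀ ℕ.≤ M → ∣ ratio A n - P M ∣ ≤ ε
    limit ε 0<ε = let q , q≢0 , invq≤ε = archimedean ε 0<ε in go q q≢0 invq≤ε
      where
      go : ∀ q → NonZero q → inv q ≤ ε → ∃ λ N₀ → ∃ λ M₀ → (n M : ℕ) → N₀ ℕ.≤ n → M₀ ℕ.≤ M → ∣ ratio A n - P M ∣ ≤ ε
      go q q≢0 invq≤ε = proj₁ (ratio-close D) , D , λ n M N₀≤n D≤M → ≤-trans (bound n M N₀≤n D≤M) invq≤ε
        where
        -- Three errors of at most 10/D add up to 30/D = 1/q; the one with M is covered by D ≤ M.
        D = 30 ℕ.* q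
        instance
          D≢0 : NonZero D
          D≢0 = ℕP.m*n≢0 30 q {{_}} {{q≢0}}
        bound : ∀ n M → proj₁ (ratio-close D) ℕ.≤ n → D ℕ.≤ M → ∣ ratio A n - P M ∣ ≤ inv q
        bound n M N₀≤n D≤M = begin
          ∣ r - P M ∣                                ≡⟨ cong ∣_∣ (solve 3 (λ r a b → r :- b := (r :- a) :+ (a :- b)) refl r (P D) (P M)) ⟩
          ∣ (r - P D) + (P D - P M) ∣                ≤⟨ ∣p+q∣≤∣p∣+∣q∣ (r - P D) (P D - P M) ⟩
          ∣ r - P D ∣ + ∣ P D - P M ∣                ≤⟨ +-mono-≤ (proj₂ (ratio-close D) n N₀≤n) (P-cauchy D M) ⟩
          t * inv D + (t * inv D + t * inv M)        ≤⟨ +-monoʳ-≤ (t * inv D) (+-monoʳ-≤ (t * inv D) (ι*inv-mono-≤ 10 10 M D (ℕP.*-monoʳ-≤ 10 D≤M))) ⟩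
          t * inv D + (t * inv D + t * inv D)        ≡⟨ solve 2 (λ t i → t :* i :+ (t :* i :+ t :* i) := (t :+ t :+ t) :* i) refl t (inv D) ⟩
          ι 30 * inv D                               ≤⟨ ι*inv-mono-≤ 30 1 D q {{D≢0}} {{q≢0}} (ℕP.≤-reflexive (sym (ℕP.*-identityˡ D))) ⟩
          ι 1 * inv q                                ≡⟨ *-identityˡ (inv q) ⟩
          inv q                                      ∎
          where
          open ≤-Reasoning
          r = ratio A n
          t = ι 10
          instance
            M≢0 : NonZero M
            M≢0 = ℕ.>-nonZero (ℕP.≤-trans (ℕ.>-nonZero⁻¹ D) D≤M)

-- Explicit enclosure of the product.

module NumericalValue where

  open Rationals
  open PrimeLists using (primesUpTo≡filter)
  open Sieve using (fTrunc-suc)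
  open import Data.Nat as ℕ using (ℕ; zero; suc; _^_; _∸_; NonZero; s≤s; z≤n)
  import Data.Nat.Properties as ℕP
  open import Data.Nat.Primality using (Prime; prime?; prime⇒nonZero)
  open import Data.Nat.Solver renaming (module +-*-Solver to ℕ-Solver)
  open import Data.Integer as ℤ using ()
  open import Data.Rational hiding (NonZero; _≤ᵇ_)
  open import Data.Rational.Properties
  open import Data.Rational.Solver using (module +-*-Solver)
  open +-*-Solver using (solve; _:=_; _:+_; _:*_; _:-_; :-_; con)
  open import Data.List using (List; []; _∷_; _++_; map; upTo; applyUpTo; filter)
  open import Data.List.Properties using (applyUpTo-∷ʳ; filter-++)
  open import Data.List.Relation.Unary.All as All using (All; []; _∷_)
  import Data.List.Relation.Unary.All.Properties as All
  open import Data.Product using (_×_; _,_; ∃; proj₁; proj₂)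
  open import Data.Unit using (tt)
  open import Function using (_∘_; id)
  open import Relation.Nullary using (yes; no)
  open import Relation.Binary.PropositionalEquality

  inv≤1 : ∀ x → inv x ≤ 1ℚ
  inv≤1 zero    = 0≤ι 1
  inv≤1 (suc x) = subst₂ _≤_ (*-identityˡ (inv (suc x))) refl (ι*inv-mono-≤ 1 1 (suc x) 1 (s≤s z≤n))

  q≤p+q : ∀ {p q} → 0ℚ ≤ p → q ≤ q + p
  q≤p+q {p} {q} 0≤p = subst (_≤ q + p) (+-identityʳ q) (+-monoʳ-≤ q 0≤p)

  p-q≤p : ∀ {p q} → 0ℚ ≤ q → p - q ≤ p
  p-q≤p {p} {q} 0≤q = p≤q+r⇒p-q≤r {p} {q} (subst (p ≤_) (+-comm p q) (q≤p+q 0≤q))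

  cube≤square : ∀ {z} → 0ℚ ≤ z → z ≤ 1ℚ → z * z * z ≤ z * z
  cube≤square {z} 0≤z z≤1 = subst (z * z * z ≤_) (*-identityʳ (z * z)) (*-monoˡ-≤ (0≤* 0≤z 0≤z) z≤1)

  module Trunc (x : ℕ) where
    z : ℕ → ℚ
    z M = inv (x ^ (3 ^ M))

    f : ℕ → ℚ
    f M = fTrunc M x

    0≤z : ∀ M → 0ℚ ≤ z M
    0≤z M = 0≤inv (x ^ (3 ^ M))

    z-suc : ∀ M → z (suc M) ≡ z M * z M * z M
    z-suc M = begin
      inv (x ^ (3 ^ M ℕ.+ (3 ^ M ℕ.+ (3 ^ M ℕ.+ 0))))   ≡⟨ cong (λ t → inv (x ^ (3 ^ M ℕ.+ (3 ^ M ℕ.+ t)))) (ℕP.+-identityʳ (3 ^ M)) ⟩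
      inv (x ^ (3 ^ M ℕ.+ (3 ^ M ℕ.+ 3 ^ M)))           ≡⟨ split (3 ^ M) (3 ^ M ℕ.+ 3 ^ M) ⟩
      z M * inv (x ^ (3 ^ M ℕ.+ 3 ^ M))                 ≡⟨ cong (z M *_) (split (3 ^ M) (3 ^ M)) ⟩
      z M * (z M * z M)                                 ≡⟨ sym (*-assoc (z M) (z M) (z M)) ⟩
      z M * z M * z M                                   ∎
      where
      open ≡-Reasoning
      split : ∀ a b → inv (x ^ (a ℕ.+ b)) ≡ inv (x ^ a) * inv (x ^ b)
      split a b = trans (cong inv (ℕP.^-distribˡ-+-* x a b)) (inv-* (x ^ a) (x ^ b))

    z-suc≤ : ∀ M → z (suc M) ≤ z M * z M
    z-suc≤ M = subst (_≤ z M * z M) (sym (z-suc M)) (cube≤square (0≤z M) (inv≤1 (x ^ (3 ^ M))))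

    0≤f : ∀ M → 0ℚ ≤ f M
    0≤f zero    = 0≤* (p≤q⇒0≤q-p (inv≤1 x)) (0≤ι 1)
      where
      p≤q⇒0≤q-p : ∀ {p q} → p ≤ q → 0ℚ ≤ q - p
      p≤q⇒0≤q-p {p} {q} le = subst (_≤ q - p) (+-inverseʳ p) (+-monoˡ-≤ (- p) le)
    0≤f (suc M) = subst (0ℚ ≤_) (sym (fTrunc-suc M x)) (0≤* (0≤+ (0≤ι 1) (0≤z M)) (0≤f M))

    -- Invariant of the recursion: (1 + z)(1 - z) = 1 - z² ≤ 1 - z³, and z³ is the next z.
    f≤1-z : ∀ M → f M ≤ 1ℚ - z M
    f≤1-z zero = ≤-reflexive (trans (*-identityʳ (1ℚ - inv x)) (cong (λ t → 1ℚ - inv t) (sym (ℕP.*-identityʳ x))))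
    f≤1-z (suc M) = begin
      f (suc M)                    ≡⟨ fTrunc-suc M x ⟩
      (1ℚ + z M) * f M             ≤⟨ *-monoˡ-≤ (0≤+ (0≤ι 1) (0≤z M)) (f≤1-z M) ⟩
      (1ℚ + z M) * (1ℚ - z M)      ≡⟨ solve 1 (λ z → (con 1ℚ :+ z) :* (con 1ℚ :- z) := con 1ℚ :- z :* z) refl (z M) ⟩
      1ℚ - z M * z M               ≤⟨ +-monoʳ-≤ 1ℚ (neg-antimono-≤ (z-suc≤ M)) ⟩
      1ℚ - z (suc M)               ∎
      where open ≤-Reasoning

    f≤1 : ∀ M → f M ≤ 1ℚ
    f≤1 M = ≤-trans (f≤1-z M) (p-q≤p (0≤z M))

    f-suc : ∀ M → f (suc M) ≡ f M + z M * f M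
    f-suc M = trans (fTrunc-suc M x) (solve 2 (λ z f → (con 1ℚ :+ z) :* f := f :+ z :* f) refl (z M) (f M))

    f-mono : ∀ k M → f M ≤ f (k ℕ.+ M)
    f-mono zero    M = ≤-refl
    f-mono (suc k) M = ≤-trans (f-mono k M) (subst (f (k ℕ.+ M) ≤_) (sym (f-suc (k ℕ.+ M))) (q≤p+q (0≤* (0≤z (k ℕ.+ M)) (0≤f (k ℕ.+ M)))))

    -- By `f≤1-z` an increment z f is at most z - z² ≤ z - z³, a difference of consecutive values of
    -- z, so the increments telescope.
    f-upper : ∀ k M → f (k ℕ.+ M) ≤ f M + (z M - z (k ℕ.+ M))
    f-upper zero    M = ≤-reflexive (solve 2 (λ f z → f := f :+ (z :- z)) refl (f M) (z M))
    f-upper (suc k) M = begin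
      f (suc k ℕ.+ M)                              ≡⟨ f-suc (k ℕ.+ M) ⟩
      f (k ℕ.+ M) + w * f (k ℕ.+ M)                ≤⟨ +-mono-≤ (f-upper k M) (*-monoˡ-≤ (0≤z (k ℕ.+ M)) (f≤1-z (k ℕ.+ M))) ⟩
      f M + (z M - w) + w * (1ℚ - w)               ≡⟨ solve 3 (λ f z w → f :+ (z :- w) :+ w :* (con 1ℚ :- w) := f :+ (z :- w :* w)) refl (f M) (z M) w ⟩
      f M + (z M - w * w)                          ≤⟨ +-monoʳ-≤ (f M) (+-monoʳ-≤ (z M) (neg-antimono-≤ (z-suc≤ (k ℕ.+ M)))) ⟩
      f M + (z M - z (suc k ℕ.+ M))                ∎
      where
      open ≤-Reasoning
      w = z (k ℕ.+ M)

    f≤f+z : ∀ k M → f (k ℕ.+ M) ≤ f M + z M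
    f≤f+z k M = ≤-trans (f-upper k M) (+-monoʳ-≤ (f M) (p-q≤p (0≤z (k ℕ.+ M))))

    -- One factor of the product already gives (1 - y)(1 + y) with y = 1/x; for x = p² this is 1 -
    -- p⁻⁴.
    1-y²≤f : ∀ k → 1ℚ - inv (x ℕ.* x) ≤ f (k ℕ.+ 1)
    1-y²≤f k = ≤-trans (≤-reflexive eq) (f-mono k 1)
      where
      eq : 1ℚ - inv (x ℕ.* x) ≡ f 1
      eq = trans (cong (λ t → 1ℚ - t) (inv-* x x)) (trans (solve 1 (λ y → con 1ℚ :- y :* y := (con 1ℚ :- y) :* ((con 1ℚ :+ y) :* con 1ℚ)) refl (inv x))
        (cong (λ t → (1ℚ - inv x) * ((1ℚ + inv t) * 1ℚ)) (sym (ℕP.*-identityʳ x))))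

  1-inv : ∀ x .{{_ : NonZero x}} → 1ℚ - inv x ≡ ι (x ∸ 1) * inv x
  1-inv (suc x) = begin
    1ℚ - i                        ≡⟨ cong (_- i) (sym (ι*inv (suc x))) ⟩
    ι (suc x) * i - i             ≡⟨ cong (λ t → t * i - i) (ι-+ 1 x) ⟩
    (1ℚ + ι x) * i - i            ≡⟨ solve 2 (λ a i → (con 1ℚ :+ a) :* i :- i := a :* i) refl (ι x) i ⟩
    ι x * i                       ∎
    where
    open ≡-Reasoning
    i = inv (suc x)

  1+inv : ∀ x .{{_ : NonZero x}} → 1ℚ + inv x ≡ ι (suc x) * inv x
  1+inv x = trans (cong (_+ inv x) (sym (ι*inv x))) (trans (solve 2 (λ a i → a :* i :+ i := (con 1ℚ :+ a) :* i) refl (ι x) (inv x))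
    (cong (_* inv x) (sym (ι-+ 1 x))))

  frac-* : ∀ a b c d → (ι a * inv b) * (ι c * inv d) ≡ ι (a ℕ.* c) * inv (b ℕ.* d)
  frac-* a b c d = trans (solve 4 (λ a b c d → (a :* b) :* (c :* d) := (a :* c) :* (b :* d)) refl (ι a) (inv b) (ι c) (inv d))
    (cong₂ _*_ (sym (ι-* a c)) (sym (inv-* b d)))

  frac-+ : ∀ a b d .{{_ : NonZero b}} .{{_ : NonZero d}} → ι a * inv b + inv d ≡ ι (a ℕ.* d ℕ.+ b) * inv (b ℕ.* d)
  frac-+ a b d = begin
    ι a * inv b + inv d
      ≡⟨ solve 3 (λ a i j → a :* i :+ j := a :* i :* con 1ℚ :+ con 1ℚ :* j) refl (ι a) (inv b) (inv d) ⟩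
    ι a * inv b * 1ℚ + 1ℚ * inv d
      ≡⟨ cong₂ (λ u v → ι a * inv b * u + v * inv d) (sym (ι*inv d)) (sym (ι*inv b)) ⟩
    ι a * inv b * (ι d * inv d) + ι b * inv b * inv d
      ≡⟨ solve 5 (λ a b d i j → a :* i :* (d :* j) :+ b :* i :* j := (a :* d :+ b) :* (i :* j)) refl (ι a) (ι b) (ι d) (inv b) (inv d) ⟩
    (ι a * ι d + ι b) * (inv b * inv d)
      ≡⟨ cong₂ _*_ (sym (trans (ι-+ (a ℕ.* d) b) (cong (_+ ι b) (ι-* a d)))) (sym (inv-* b d)) ⟩
    ι (a ℕ.* d ℕ.+ b) * inv (b ℕ.* d) ∎
    where open ≡-Reasoning

  -- lowN x / lowD x = fTrunc 3 x and upN x / upD x = fTrunc 3 x + x⁻²⁷.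
  lowN lowD upN upD : ℕ → ℕ
  lowN x = (x ∸ 1) ℕ.* (suc (x ^ 1) ℕ.* (suc (x ^ 3) ℕ.* suc (x ^ 9)))
  lowD x = x ℕ.* (x ^ 1 ℕ.* (x ^ 3 ℕ.* x ^ 9))
  upN x = lowN x ℕ.* x ^ 27 ℕ.+ lowD x
  upD x = lowD x ℕ.* x ^ 27

  module _ (x : ℕ) .{{x≢0 : NonZero x}} where
    open Trunc x
    private
      pow : ∀ k → NonZero (x ^ k)
      pow k = ℕP.m^n≢0 x k

    lowD≢0 : NonZero (lowD x)
    lowD≢0 = ℕP.m*n≢0 x _ {{x≢0}} {{ℕP.m*n≢0 (x ^ 1) _ {{pow 1}} {{ℕP.m*n≢0 (x ^ 3) _ {{pow 3}} {{pow 9}}}}}}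

    upD≢0 : NonZero (upD x)
    upD≢0 = ℕP.m*n≢0 (lowD x) (x ^ 27) {{lowD≢0}} {{pow 27}}

    f3≡ : f 3 ≡ ι (lowN x) * inv (lowD x)
    f3≡ = trans (cong₂ _*_ (1-inv x) (cong₂ _*_ (1+inv (x ^ 1) {{pow 1}}) (cong₂ _*_ (1+inv (x ^ 3) {{pow 3}}) (trans (*-identityʳ _) (1+inv (x ^ 9) {{pow 9}})))))
      (trans (cong ((ι (x ∸ 1) * inv x) *_) (trans (cong ((ι (suc (x ^ 1)) * inv (x ^ 1)) *_) (frac-* (suc (x ^ 3)) (x ^ 3) (suc (x ^ 9)) (x ^ 9)))
          (frac-* (suc (x ^ 1)) (x ^ 1) (suc (x ^ 3) ℕ.* suc (x ^ 9)) (x ^ 3 ℕ.* x ^ 9))))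
        (frac-* (x ∸ 1) x (suc (x ^ 1) ℕ.* (suc (x ^ 3) ℕ.* suc (x ^ 9))) (x ^ 1 ℕ.* (x ^ 3 ℕ.* x ^ 9))))

    f-low : ∀ k → ι (lowN x) * inv (lowD x) ≤ f (k ℕ.+ 3)
    f-low k = subst (_≤ f (k ℕ.+ 3)) f3≡ (f-mono k 3)

    f-up : ∀ k → f (k ℕ.+ 3) ≤ ι (upN x) * inv (upD x)
    f-up k = subst (f (k ℕ.+ 3) ≤_) (trans (cong (_+ z 3) f3≡) (frac-+ (lowN x) (lowD x) (x ^ 27) {{lowD≢0}} {{pow 27}})) (f≤f+z k 3)

  -- Numerators and denominators are multiplied separately in ℕ, so the final comparison is one of
  -- natural numbers, with no fraction to reduce.
  prodN : (ℕ → ℕ) → List ℕ → ℕ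
  prodN g []       = 1
  prodN g (p ∷ ps) = g (p ℕ.* p) ℕ.* prodN g ps

  prodN≢0 : ∀ {g} → (∀ x .{{_ : NonZero x}} → NonZero (g x)) → ∀ ps → All NonZero ps → NonZero (prodN g ps)
  prodN≢0 h []       []          = _
  prodN≢0 {g} h (p ∷ ps) (p≢0 ∷ ps≢0) = ℕP.m*n≢0 (g (p ℕ.* p)) _ {{h (p ℕ.* p) {{ℕP.m*n≢0 p p {{p≢0}} {{p≢0}}}}}} {{prodN≢0 h ps ps≢0}}

  module Bounds (k : ℕ) where
    M = k ℕ.+ 3

    F : ℕ → ℚ
    F p = fTrunc M (p ℕ.* p)

    prodF : List ℕ → ℚ
    prodF ps = prodℚ (map F ps)

    0≤prodF : ∀ ps → 0ℚ ≤ prodF ps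
    0≤prodF []       = 0≤ι 1
    0≤prodF (p ∷ ps) = 0≤* (Trunc.0≤f (p ℕ.* p) M) (0≤prodF ps)

    0≤frac : ∀ a b → 0ℚ ≤ ι a * inv b
    0≤frac a b = 0≤* (0≤ι a) (0≤inv b)

    prodF-low : ∀ ps → All NonZero ps → ι (prodN lowN ps) * inv (prodN lowD ps) ≤ prodF ps
    prodF-low []       []            = ≤-refl
    prodF-low (p ∷ ps) (p≢0 ∷ ps≢0) = subst (_≤ prodF (p ∷ ps)) (frac-* (lowN x) (lowD x) (prodN lowN ps) (prodN lowD ps))
      (*-mono-≤ (0≤frac (lowN x) (lowD x)) (0≤prodF ps) (f-low x {{ℕP.m*n≢0 p p {{p≢0}} {{p≢0}}}} k) (prodF-low ps ps≢0))
      where x = p ℕ.* p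

    prodF-up : ∀ ps → All NonZero ps → prodF ps ≤ ι (prodN upN ps) * inv (prodN upD ps)
    prodF-up []       []            = ≤-refl
    prodF-up (p ∷ ps) (p≢0 ∷ ps≢0) = subst (prodF (p ∷ ps) ≤_) (frac-* (upN x) (upD x) (prodN upN ps) (prodN upD ps))
      (*-mono-≤ (Trunc.0≤f x M) (0≤frac (prodN upN ps) (prodN upD ps)) (f-up x {{ℕP.m*n≢0 p p {{p≢0}} {{p≢0}}}} k) (prodF-up ps ps≢0))
      where x = p ℕ.* p

    prodF-++ : ∀ ps qs → prodF (ps ++ qs) ≡ prodF ps * prodF qs
    prodF-++ []       qs = sym (*-identityˡ (prodF qs))
    prodF-++ (p ∷ ps) qs = trans (cong (F p *_) (prodF-++ ps qs)) (sym (*-assoc (F p) (prodF ps) (prodF qs)))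

    module Tail (Y : ℕ) .{{_ : NonZero Y}} where
      tail : ℕ → List ℕ
      tail j = filter prime? (applyUpTo (λ i → suc Y ℕ.+ i) j)

      prodF-tail-suc : ∀ j → prodF (tail (suc j)) ≡ prodF (tail j) * prodF (filter prime? ((suc Y ℕ.+ j) ∷ []))
      prodF-tail-suc j = trans (cong (prodF ∘ filter prime?) (sym (applyUpTo-∷ʳ (λ i → suc Y ℕ.+ i) j)))
        (trans (cong prodF (filter-++ prime? (applyUpTo (λ i → suc Y ℕ.+ i) j) _)) (prodF-++ (tail j) _))

      -- A composite n contributes the empty product 1. Treating every n alike keeps the
      -- distribution of primes out of the tail estimate.
      factor-bounds : ∀ n → let φ = prodF (filter prime? (n ∷ [])) in 1ℚ - inv (n ℕ.* n ℕ.* (n ℕ.* n)) ≤ φ × φ ≤ 1ℚ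
      factor-bounds n with prime? n
      ... | no  _ = p-q≤p (0≤inv (n ℕ.* n ℕ.* (n ℕ.* n))) , ≤-refl
      ... | yes _ = subst (λ t → 1ℚ - inv (n ℕ.* n ℕ.* (n ℕ.* n)) ≤ t × t ≤ 1ℚ) (sym (*-identityʳ (F n)))
        (subst (λ M → 1ℚ - inv (n ℕ.* n ℕ.* (n ℕ.* n)) ≤ fTrunc M (n ℕ.* n)) (ℕP.+-assoc k 2 1) (Trunc.1-y²≤f (n ℕ.* n) (k ℕ.+ 2)) ,
         Trunc.f≤1 (n ℕ.* n) M)

      tail≤1 : ∀ j → prodF (tail j) ≤ 1ℚ
      tail≤1 zero    = ≤-refl
      tail≤1 (suc j) = subst₂ _≤_ (sym (prodF-tail-suc j)) (*-identityˡ 1ℚ)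
        (*-mono-≤ (0≤prodF (tail j)) (0≤ι 1) (tail≤1 j) (proj₂ (factor-bounds (suc Y ℕ.+ j))))

      cube : ℕ → ℕ
      cube m = m ℕ.* m ℕ.* m

      -- The left side is (n + 1)/n⁴, and (m + 2) m³ ≤ (m + 1)⁴ with difference 2m³ + 6m² + 4m + 1.
      telescoping : ∀ m .{{_ : NonZero m}} → let n = suc m in inv (cube n) + inv (n ℕ.* n ℕ.* (n ℕ.* n)) ≤ inv (cube m)
      telescoping m = subst₂ _≤_ eq (*-identityˡ (inv (cube m))) (ι*inv-mono-≤ (suc n) 1 (n ℕ.* n ℕ.* (n ℕ.* n)) (cube m) {{_}} {{ℕP.m*n≢0 (m ℕ.* m) m {{ℕP.m*n≢0 m m}}}} le)
        where
        n = suc m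
        i⁴ = inv (n ℕ.* n ℕ.* (n ℕ.* n))
        le : suc n ℕ.* cube m ℕ.≤ 1 ℕ.* (n ℕ.* n ℕ.* (n ℕ.* n))
        le = ℕP.≤-trans (ℕP.m≤m+n _ (2 ℕ.* (m ℕ.* m ℕ.* m) ℕ.+ 6 ℕ.* (m ℕ.* m) ℕ.+ 4 ℕ.* m ℕ.+ 1)) (ℕP.≤-reflexive
          (ℕ-Solver.solve 1 (λ m → (ℕcon 2 ⊕ m) ⊗ (m ⊗ m ⊗ m) ⊕ (ℕcon 2 ⊗ (m ⊗ m ⊗ m) ⊕ ℕcon 6 ⊗ (m ⊗ m) ⊕ ℕcon 4 ⊗ m ⊕ ℕcon 1)
              ≔ ℕcon 1 ⊗ ((ℕcon 1 ⊕ m) ⊗ (ℕcon 1 ⊕ m) ⊗ ((ℕcon 1 ⊕ m) ⊗ (ℕcon 1 ⊕ m)))) refl m))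
          where open ℕ-Solver renaming (_:*_ to infixl 7 _⊗_; _:=_ to infix 4 _≔_; _:+_ to infixl 6 _⊕_; con to ℕcon)
        eq : ι (suc n) * i⁴ ≡ inv (cube n) + i⁴
        eq = begin
          ι (suc n) * i⁴                        ≡⟨ cong (_* i⁴) (ι-+ 1 n) ⟩
          (1ℚ + ι n) * i⁴                       ≡⟨ solve 2 (λ a i → (con 1ℚ :+ a) :* i := i :* a :+ i) refl (ι n) i⁴ ⟩
          i⁴ * ι n + i⁴                         ≡⟨ cong (λ t → t * ι n + i⁴) (trans (cong inv (sym (ℕP.*-assoc (n ℕ.* n) n n))) (inv-* (cube n) n)) ⟩
          inv (cube n) * inv n * ι n + i⁴       ≡⟨ cong (_+ i⁴) (solve 3 (λ c i n → c :* i :* n := c :* (n :* i)) refl (inv (cube n)) (inv n) (ι n)) ⟩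
          inv (cube n) * (ι n * inv n) + i⁴     ≡⟨ cong (λ t → inv (cube n) * t + i⁴) (ι*inv n) ⟩
          inv (cube n) * 1ℚ + i⁴                ≡⟨ cong (_+ i⁴) (*-identityʳ (inv (cube n))) ⟩
          inv (cube n) + i⁴                     ∎
          where open ≡-Reasoning

      -- The positive term is the slack that the induction consumes: a new factor 1 - δ lowers the
      -- product t ≤ 1 by at most δ, and `telescoping` pays for it.
      tail-lower : ∀ j → 1ℚ - inv (cube Y) + inv (cube (Y ℕ.+ j)) ≤ prodF (tail j)
      tail-lower zero = ≤-reflexive (trans (cong (λ t → 1ℚ - inv (cube Y) + inv (cube t)) (ℕP.+-identityʳ Y))
        (solve 1 (λ i → con 1ℚ :- i :+ i := con 1ℚ) refl (inv (cube Y))))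
      tail-lower (suc j) = begin
        1ℚ - c + inv (cube (Y ℕ.+ suc j))    ≡⟨ cong (λ t → 1ℚ - c + inv (cube t)) (ℕP.+-suc Y j) ⟩
        1ℚ - c + inv (cube n)                ≡⟨ solve 3 (λ c a b → con 1ℚ :- c :+ a := con 1ℚ :- c :+ (a :+ b) :- b) refl c (inv (cube n)) δ ⟩
        1ℚ - c + (inv (cube n) + δ) - δ      ≤⟨ +-monoˡ-≤ (- δ) (+-monoʳ-≤ (1ℚ - c) (telescoping (Y ℕ.+ j) {{Y+j≢0}})) ⟩
        1ℚ - c + inv (cube (Y ℕ.+ j)) - δ    ≤⟨ +-monoˡ-≤ (- δ) (tail-lower j) ⟩
        t - δ                                ≡⟨ cong (λ u → t - u) (sym (*-identityˡ δ)) ⟩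
        t - 1ℚ * δ                           ≤⟨ +-monoʳ-≤ t (neg-antimono-≤ (*-monoʳ-≤ (0≤inv (n ℕ.* n ℕ.* (n ℕ.* n))) (tail≤1 j))) ⟩
        t - t * δ                            ≡⟨ solve 2 (λ t d → t :- t :* d := t :* (con 1ℚ :- d)) refl t δ ⟩
        t * (1ℚ - δ)                         ≤⟨ *-monoˡ-≤ (0≤prodF (tail j)) (proj₁ (factor-bounds n)) ⟩
        t * prodF (filter prime? (n ∷ []))   ≡⟨ sym (prodF-tail-suc j) ⟩
        prodF (tail (suc j))                 ∎
        where
        open ≤-Reasoning
        n = suc Y ℕ.+ j
        c = inv (cube Y)
        δ = inv (n ℕ.* n ℕ.* (n ℕ.* n))
        t = prodF (tail j)
        Y+j≢0 : NonZero (Y ℕ.+ j)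
        Y+j≢0 = ℕ.>-nonZero (ℕP.≤-trans (ℕ.>-nonZero⁻¹ Y) (ℕP.m≤m+n Y j))

  applyUpTo-+ : ∀ (f : ℕ → ℕ) m n → applyUpTo f (m ℕ.+ n) ≡ applyUpTo f m ++ applyUpTo (λ i → f (m ℕ.+ i)) n
  applyUpTo-+ f zero    n = refl
  applyUpTo-+ f (suc m) n = cong (f 0 ∷_) (applyUpTo-+ (f ∘ suc) m n)

  module Numeric (Y : ℕ) .{{_ : NonZero Y}} (ps : List ℕ) (ps≢0 : All NonZero ps) (primes≡ : filter prime? (upTo (suc Y)) ≡ ps) where

    module _ (k j : ℕ) (eq : k ℕ.+ 3 ≡ Y ℕ.+ j) where
      open Bounds k
      open Tail Y

      P-split : P M ≡ prodF ps * prodF (tail j)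
      P-split = trans (cong prodF (begin
        primesUpTo M                                                  ≡⟨ primesUpTo≡filter M ⟩
        filter prime? (upTo (suc M))                                  ≡⟨ cong (λ t → filter prime? (upTo (suc t))) eq ⟩
        filter prime? (upTo (suc Y ℕ.+ j))                            ≡⟨ cong (filter prime?) (applyUpTo-+ id (suc Y) j) ⟩
        filter prime? (upTo (suc Y) ++ applyUpTo (λ i → suc Y ℕ.+ i) j) ≡⟨ filter-++ prime? (upTo (suc Y)) _ ⟩
        filter prime? (upTo (suc Y)) ++ tail j                        ≡⟨ cong (_++ tail j) primes≡ ⟩
        ps ++ tail j                                                  ∎)) (prodF-++ ps (tail j))
        where open ≡-Reasoning

      P-upper : ∀ a b .{{_ : NonZero b}} → prodN upN ps ℕ.* b ℕ.≤ a ℕ.* prodN upD ps → P M ≤ ι a * inv b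
      P-upper a b le = begin
        P M                                        ≡⟨ P-split ⟩
        prodF ps * prodF (tail j)                  ≤⟨ *-monoˡ-≤ (0≤prodF ps) (tail≤1 j) ⟩
        prodF ps * 1ℚ                              ≡⟨ *-identityʳ (prodF ps) ⟩
        prodF ps                                   ≤⟨ prodF-up ps ps≢0 ⟩
        ι (prodN upN ps) * inv (prodN upD ps)      ≤⟨ ι*inv-mono-≤ (prodN upN ps) a (prodN upD ps) b {{prodN≢0 upD≢0 ps ps≢0}} le ⟩
        ι a * inv b                                ∎
        where open ≤-Reasoning

      P-lower : ∀ a b .{{_ : NonZero b}} → a ℕ.* (prodN lowD ps ℕ.* cube Y) ℕ.≤ prodN lowN ps ℕ.* (cube Y ∸ 1) ℕ.* b → ι a * inv b ≤ P M
      P-lower a b {{b≢0}} le = begin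
        ι a * inv b                                                  ≤⟨ ι*inv-mono-≤ a (prodN lowN ps ℕ.* (cube Y ∸ 1)) b (prodN lowD ps ℕ.* cube Y) {{b≢0}} {{ℕP.m*n≢0 (prodN lowD ps) (cube Y) {{prodN≢0 lowD≢0 ps ps≢0}}}} le ⟩
        ι (prodN lowN ps ℕ.* (cube Y ∸ 1)) * inv (prodN lowD ps ℕ.* cube Y) ≡⟨ sym (frac-* (prodN lowN ps) (prodN lowD ps) (cube Y ∸ 1) (cube Y)) ⟩
        ι (prodN lowN ps) * inv (prodN lowD ps) * (ι (cube Y ∸ 1) * inv (cube Y)) ≤⟨ *-mono-≤ (0≤frac (prodN lowN ps) (prodN lowD ps)) (0≤prodF (tail j)) (prodF-low ps ps≢0) tail-low ⟩
        prodF ps * prodF (tail j)                                    ≡⟨ sym P-split ⟩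
        P M                                                          ∎
        where
        open ≤-Reasoning
        instance
          Y³≢0 : NonZero (cube Y)
          Y³≢0 = ℕP.m*n≢0 (Y ℕ.* Y) Y {{ℕP.m*n≢0 Y Y}}
        tail-low : ι (cube Y ∸ 1) * inv (cube Y) ≤ prodF (tail j)
        tail-low = subst (_≤ prodF (tail j)) (1-inv (cube Y)) (≤-trans (q≤p+q (0≤inv (cube (Y ℕ.+ j)))) (tail-lower j))

  within : ∀ x a b ε .{{_ : NonZero b}} → 0ℚ < ε → ι a * inv b ≤ x → x ≤ ι (2 ℕ.+ a) * inv b →
    ∣ x - ι (1 ℕ.+ a) * inv b ∣ ≤ ι 1 * inv b + ε
  within x a b ε 0<ε lo hi = ≤-trans (∣p-q∣≤r
      (≤-trans hi (≤-reflexive (trans (cong (_* inv b) (ι-+ 1 (1 ℕ.+ a))) (trans (*-distribʳ-+ (inv b) (ι 1) (ι (1 ℕ.+ a))) (+-comm (ι 1 * inv b) (ι (1 ℕ.+ a) * inv b))))))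
      (≤-trans (≤-reflexive (trans (cong (_* inv b) (ι-+ 1 a)) (trans (*-distribʳ-+ (inv b) (ι 1) (ι a)) (+-comm (ι 1 * inv b) (ι a * inv b))))) (+-monoˡ-≤ (ι 1 * inv b) lo)))
    (q≤p+q (<⇒≤ 0<ε))

  -- The cutoff 120 makes the tail error 1/120³ smaller than 6 · 10⁻⁷, within the tolerance 10⁻⁶.
  smallPrimes : List ℕ
  smallPrimes = 2 ∷ 3 ∷ 5 ∷ 7 ∷ 11 ∷ 13 ∷ 17 ∷ 19 ∷ 23 ∷ 29 ∷ 31 ∷ 37 ∷ 41 ∷ 43 ∷ 47 ∷ 53 ∷ 59 ∷ 61 ∷ 67 ∷ 71 ∷ 73 ∷ 79 ∷ 83 ∷ 89 ∷ 97 ∷ 101 ∷ 103 ∷ 107 ∷ 109 ∷ 113 ∷ []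

  primes≤120 : filter prime? (upTo 121) ≡ smallPrimes
  primes≤120 = refl

  smallPrimes≢0 : All NonZero smallPrimes
  smallPrimes≢0 = All.map (λ {p} pp → prime⇒nonZero pp) (subst (All Prime) primes≤120 (All.all-filter prime? (upTo 121)))

  open Numeric 120 smallPrimes smallPrimes≢0 primes≤120

  value : (ε : ℚ) → 0ℚ < ε → ∃ λ M₀ → (M : ℕ) → M₀ ℕ.≤ M → ∣ P M - approx ∣ ≤ (ℤ.+ 1 / 1000000) + ε
  value ε 0<ε = 120 , λ M 120≤M → go M (M ∸ 3) (M ∸ 120) (ℕP.m∸n+n≡m (ℕP.≤-trans (ℕP.≤ᵇ⇒≤ 3 120 tt) 120≤M)) (sym (ℕP.m+[n∸m]≡n 120≤M))
    where
    go : ∀ M k j → k ℕ.+ 3 ≡ M → M ≡ 120 ℕ.+ j → ∣ P M - approx ∣ ≤ (ℤ.+ 1 / 1000000) + ε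
    -- `/≡ι*inv` takes the predecessor of the denominator, hence 999999. The bounds 939734 and
    -- 939736 are the numerator of `approx` minus and plus 1; both inequalities are settled by
    -- evaluating `≤ᵇ` on explicit natural numbers.
    go M k j refl eq = subst₂ (λ u v → ∣ P M - u ∣ ≤ v + ε) (sym (/≡ι*inv 939735 999999)) (sym (/≡ι*inv 1 999999))
      (within (P M) 939734 1000000 ε 0<ε (P-lower k j eq 939734 1000000 (ℕP.≤ᵇ⇒≤ _ _ tt)) (P-upper k j eq 939736 1000000 (ℕP.≤ᵇ⇒≤ _ _ tt)))

open import Data.Bool using (Bool)
open import Data.Nat using (ℕ)
open import Data.Integer using (+_)
open import Data.Rational using (ℚ; _≤_; _<_; _-_; _+_; ∣_∣; 0ℚ; _/_)
open import Data.Product using (_×_; _,_; ∃)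

theorem3p10 : (e : ℕ → GI) → NormOrder e → (A : GI → Bool) → IsGreedy e A →
    ((ε : ℚ) → 0ℚ < ε → ∃ λ N₀ → ∃ λ M₀ →
    (n M : ℕ) → N₀ Data.Nat.≤ n → M₀ Data.Nat.≤ M → ∣ ratio A n - P M ∣ ≤ ε)
    × ((ε : ℚ) → 0ℚ < ε → ∃ λ M₀ →
    (M : ℕ) → M₀ Data.Nat.≤ M → ∣ P M - approx ∣ ≤ (+ 1 / 1000000) + ε)
theorem3p10 e ord A greedy = Density.Limit.limit ord greedy , NumericalValue.value
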